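{- Let $k\ge1$, $0\le t\le k$, $n=k+t$, $V=\{1,\dots,n\}$, and let $H_{k,t}=(V,F)$ be the graph with edge set $F=\{\{i,i+k\}:1\le i\le t\}$. Put $V_i=\{i,i+k\}$ for $1\le i\le t$ and $V_i=\{i\}$ for $t+1\le i\le k$ (the node sets of the connected components of $H_{k,t}$). Let $G=(V,E)$ be a graph whose edge set consists of exactly $\binom{k}{2}$ edges, namely for each $1\le i<j\le k$ exactly one edge $e_{ij}$ (also written $e_{ji}$), which joins a node of $V_i$ and a node of $V_j$. Assume $G$ contains a cycle $C$ of length four all of whose four nodes have indices at most $k$, and let $V_C$ be the set of these four nodes. Call a node $i$ of $C$ free if $1\le i\le t$ and the node $i+k$ is an endpoint of the edge $e_{ij}$, where $j$ is the unique node of $C$ not adjacent to $i$ in $C$. Let $I'(G,H_{k,t},C)$ denote the inequality, in variables $x_{uv}$ indexed by the edges of the complete graph on $V\cup\{n+1,n+2\}$, \[ \sum_{uv\in E} T(u,v;n+1)-\sum_{uv\in F}T(u,v;n+1)+2\sum_{i=t+1}^{k}x_{i,n+1}+\sum_{u\in V_C}\bigl(x_{u,n+1}-x_{u,n+2}\bigr)\le 2, \] where $T(u,v;w)=x_{uv}-x_{uw}-x_{vw}$. Suppose that: (i) every node of $G$ has at least two neighbors in $G$; (ii) for each $i$ with $t+1\le i\le k$ and $i\notin V_C$, there exists a free node $j$ of $C$ such that $e_{ij}$ is incident to $j+k$; (iii) for each $i$ with $1\le i\le t$ and $i\notin V_C$, either each of the nodes $i$ and $i+k$ is an endpoint of exactly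 two of the four edges $e_{ij}$ with $j\in V_C$, or there exists a free node $j$ of $C$ such that $e_{ij}$ is incident to $j+k$. Then $I'(G,H_{k,t},C)$ defines a facet of $\mathrm{CUT}^\square_{n+2}$.
   Context: For a graph with node set $W$ and edge set $D$, the cut vector $\boldsymbol{\delta}(S)\in\mathbb{R}^D$ of $S\subseteq W$ has $\delta_{uv}(S)=1$ if exactly one of $u,v$ lies in $S$, and $0$ otherwise. $\mathrm{CUT}^\square_N$ is the cut polytope of $\mathrm{K}_N$: the convex hull of all cut vectors of subsets of the node set of $\mathrm{K}_N$, in $\mathbb{R}^{E(\mathrm{K}_N)}$; here the nodes of $\mathrm{K}_{n+2}$ are $V\cup\{n+1,n+2\}$. An inequality is a facet of a polytope $P$ if it is valid for $P$ and the set of points of $P$ satisfying it with equality has dimension $\dim P-1$.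
   Formalization: The cut polytope is taken as the set of rational convex combinations of cut vectors in ℚ^E instead of ℝ^E, and validity and (affine) dimension are taken over the rationals. -}

module Defs where

open import Data.Nat as ℕ using (ℕ; zero; suc; _∸_; _<?_; _≤?_) renaming (_+_ to _+ℕ_; _≤_ to _≤ℕ_; _<_ to _<ℕ_)
open import Data.Nat.Properties using (_≟_)
open import Data.Fin using (Fin; zero; suc)
open import Data.Bool using (Bool; true; false; _xor_; if_then_else_)
open import Data.List using (List; []; _∷_; map; upTo; foldr; filter; length)
open import Data.Product using (Σ; ∃; ∃-syntax; _×_; _,_)
open import Data.Sum using (_⊎_)
open import Relation.Nullary using (¬_; yes; no)
open import Relation.Binary.PropositionalEquality using (_≡_; _≢_)
open import Data.Rational using (ℚ; 0ℚ; 1ℚ; _+_; _-_; _*_; _≤_)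

record Edge (N : ℕ) : Set where
  constructor edge
  field
    u v : ℕ
    1≤u : 1 ≤ℕ u
    u<v : u <ℕ v
    v≤N : v ≤ℕ N

Pt : ℕ → Set
Pt N = Edge N → ℚ

sumF : ∀ {m} → (Fin m → ℚ) → ℚ
sumF {zero}  f = 0ℚ
sumF {suc m} f = f zero + sumF (λ i → f (suc i))

δ : ∀ {N} → (ℕ → Bool) → Pt N
δ S (edge u v _ _ _) = if S u xor S v then 1ℚ else 0ℚ

InCUT : (N : ℕ) → Pt N → Set
InCUT N x =
  ∃[ m ] Σ (Fin m → ℚ) λ w → Σ (Fin m → (ℕ → Bool)) λ S →
    (∀ i → 0ℚ ≤ w i) × (sumF w ≡ 1ℚ) ×
    (∀ e → x e ≡ sumF (λ i → w i * δ (S i) e))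

AffInd : ∀ {N m} → (Fin m → Pt N) → Set
AffInd {N} {m} p =
  ∀ (λ' : Fin m → ℚ) → sumF λ' ≡ 0ℚ →
  (∀ e → sumF (λ i → λ' i * p i e) ≡ 0ℚ) → ∀ i → λ' i ≡ 0ℚ

HasDim : ∀ {N} → (Pt N → Set) → ℕ → Set
HasDim {N} X d =
  (Σ (Fin (suc d) → Pt N) λ p → (∀ i → X (p i)) × AffInd p) ×
  (∀ (p : Fin (suc (suc d)) → Pt N) → (∀ i → X (p i)) → ¬ AffInd p)

-- the inequality  lhs x ≤ β  (lhs linear) defines a facet of P
IsFacet : ∀ {N} → (Pt N → Set) → (Pt N → ℚ) → ℚ → Set
IsFacet {N} P lhs β =
  (∀ x → P x → lhs x ≤ β) ×
  ∃[ d ] (HasDim P (suc d) × HasDim (λ x → P x × lhs x ≡ β) d)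

val : ∀ {N} → Pt N → ℕ → ℕ → ℚ
val {N} x u v with 1 ≤? u | u <? v | v ≤? N
... | yes p | yes q | yes r = x (edge u v p q r)
... | _ | _ | _ = 0ℚ

xs : ∀ {N} → Pt N → ℕ → ℕ → ℚ
xs x u v with u <? v
... | yes _ = val x u v
... | no _  = val x v u

sumR : ℕ → ℕ → (ℕ → ℚ) → ℚ
sumR a b f = foldr _+_ 0ℚ (map (λ i → f (a +ℕ i)) (upTo (suc b ∸ a)))

sumL : List ℕ → (ℕ → ℚ) → ℚ
sumL l f = foldr _+_ 0ℚ (map f l)

two : ℚ
two = 1ℚ + 1ℚ

-- The graph G, encoded by endpoint choices.
-- For distinct i, j in 1..k, `end i j` is the endpoint of e_ij lying in V_i,
-- so e_ij = e_ji = {end i j , end j i}.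

ValidEnds : (k t : ℕ) → (ℕ → ℕ → ℕ) → Set
ValidEnds k t end =
  ∀ i j → 1 ≤ℕ i → i ≤ℕ k → 1 ≤ℕ j → j ≤ℕ k → i ≢ j →
    (end i j ≡ i) ⊎ ((i ≤ℕ t) × (end i j ≡ i +ℕ k))

Adj : (k : ℕ) → (ℕ → ℕ → ℕ) → ℕ → ℕ → Set
Adj k end x y =
  ∃[ i ] ∃[ j ] (1 ≤ℕ i × i <ℕ j × j ≤ℕ k ×
    (((x ≡ end i j) × (y ≡ end j i)) ⊎ ((x ≡ end j i) × (y ≡ end i j))))

MinDeg2 : (k t : ℕ) → (ℕ → ℕ → ℕ) → Set
MinDeg2 k t end =
  ∀ u → 1 ≤ℕ u → u ≤ℕ k +ℕ t →
    ∃[ v ] ∃[ w ] (v ≢ w × Adj k end u v × Adj k end u w)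

IsC4 : (k : ℕ) → (ℕ → ℕ → ℕ) → ℕ → ℕ → ℕ → ℕ → Set
IsC4 k end a b c d =
  (1 ≤ℕ a × a ≤ℕ k) × (1 ≤ℕ b × b ≤ℕ k) × (1 ≤ℕ c × c ≤ℕ k) × (1 ≤ℕ d × d ≤ℕ k) ×
  (a ≢ b × a ≢ c × a ≢ d × b ≢ c × b ≢ d × c ≢ d) ×
  Adj k end a b × Adj k end b c × Adj k end c d × Adj k end d a

InC : ℕ → ℕ → ℕ → ℕ → ℕ → Set
InC a b c d i = (i ≡ a) ⊎ (i ≡ b) ⊎ (i ≡ c) ⊎ (i ≡ d)

Opp : ℕ → ℕ → ℕ → ℕ → ℕ → ℕ → Set
Opp a b c d j j' =
  ((j ≡ a) × (j' ≡ c)) ⊎ ((j ≡ c) × (j' ≡ a)) ⊎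
  ((j ≡ b) × (j' ≡ d)) ⊎ ((j ≡ d) × (j' ≡ b))

Free : (k t : ℕ) → (ℕ → ℕ → ℕ) → ℕ → ℕ → ℕ → ℕ → ℕ → Set
Free k t end a b c d j =
  InC a b c d j × 1 ≤ℕ j × j ≤ℕ t ×
  ∃[ j' ] (Opp a b c d j j' × end j j' ≡ j +ℕ k)

FreeWitness : (k t : ℕ) → (ℕ → ℕ → ℕ) → ℕ → ℕ → ℕ → ℕ → ℕ → Set
FreeWitness k t end a b c d i =
  ∃[ j ] (Free k t end a b c d j × end j i ≡ j +ℕ k)

CondII : (k t : ℕ) → (ℕ → ℕ → ℕ) → ℕ → ℕ → ℕ → ℕ → Set
CondII k t end a b c d =
  ∀ i → suc t ≤ℕ i → i ≤ℕ k → ¬ InC a b c d i → FreeWitness k t end a b c d i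

countEnd : (ℕ → ℕ → ℕ) → ℕ → ℕ → ℕ → ℕ → ℕ → ℕ → ℕ
countEnd end a b c d i y = length (filter (λ j → end i j ≟ y) (a ∷ b ∷ c ∷ d ∷ []))

CondIII : (k t : ℕ) → (ℕ → ℕ → ℕ) → ℕ → ℕ → ℕ → ℕ → Set
CondIII k t end a b c d =
  ∀ i → 1 ≤ℕ i → i ≤ℕ t → ¬ InC a b c d i →
    ((countEnd end a b c d i i ≡ 2) × (countEnd end a b c d i (i +ℕ k) ≡ 2))
    ⊎ FreeWitness k t end a b c d i

T : ∀ {N} → Pt N → ℕ → ℕ → ℕ → ℚ
T x u v w = xs x u v - xs x u w - xs x v w

lhsI' : (k t : ℕ) → (ℕ → ℕ → ℕ) → ℕ → ℕ → ℕ → ℕ → Pt (k +ℕ t +ℕ 2) → ℚ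
lhsI' k t end a b c d x =
  sumR 1 k (λ j → sumR 1 (j ∸ 1) (λ i → T x (end i j) (end j i) (n +ℕ 1)))
  - sumR 1 t (λ i → T x i (i +ℕ k) (n +ℕ 1))
  + two * sumR (suc t) k (λ i → xs x i (n +ℕ 1))
  + sumL (a ∷ b ∷ c ∷ d ∷ []) (λ u → xs x u (n +ℕ 1) - xs x u (n +ℕ 2))
  where n = k +ℕ t

{-# OPTIONS --safe #-}
-- Switching makes node n+1 avoid S. Then half of the left-hand side at δ(S) is
-- M - e + z (s - 2), where M counts the components V_i contained in S, e the edges of
-- G inside S, s the nodes of C in S, and z tells whether n+2 ∈ S. Counting each edge
-- of G twice and each full component once gives M + 2e ≥ M², with a surplus for every
-- edge of C whose ends lie in S without both their components being full; this yields
-- validity.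
--
-- For the dimension, a vector α with α₀ + α·δ(S) = 0 on all roots S and α = 0 at the
-- edge between the first node of C and n+2 is shown to vanish; a greedy choice then
-- yields enough independent roots. As S ↦ α·δ(S) is a quadratic function of S, the
-- roots V_i, V_i ∪ V_j and their enlargements by nodes not joined to them determine
-- all its coefficients that do not involve n+2, up to the factor α₀ (every node having
-- two neighbours in G). The roots containing n+2 determine the others: three full
-- components of C fix the coefficients of C, and conditions (ii) and (iii) supply a
-- root through each remaining node.
module Submission where

-- The inequality is itself an equation satisfied by all roots, so uniqueness can hold only up to
-- its multiples. Prescribing the coefficient at the edge from the first cycle node to n+2, where
-- the inequality has coefficient -1, removes them. As the right-hand side is not zero, the origin
-- lies off the face, and adding it to the roots shows that the polytope is full-dimensional. In the
-- validity proof the difficulty is n+2 ∈ S, where M + s ≤ 3 + e is required: M sees only full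
-- components, while s also counts nodes of C whose components are not full. The surplus pays for
-- such nodes. It fails to suffice only if at least three nodes of C lie in S and all their
-- components are full; then M ≥ 3, and M² - 3M has grown enough. Roots through n+2 satisfy M - e +
-- s = 3. Two full components of C achieve this with an edge between them. A free node j and its
-- opposite j' achieve it by {j} ∪ V_j', with a single full component and no edge, which leaves room
-- for a further full component joined to V_j' but not to j.

-- Linear algebra over the rationals: kernels and a greedy choice of independent vectors.

module LinearAlgebra where

  open import Defs using (sumF)
  open import Data.Nat using (zero; suc; s≤s) renaming (_<_ to _<ℕ_)
  import Data.Nat.Properties as ℕ
  open import Data.Fin using (Fin; zero; suc; punchIn; punchOut)
  open import Data.Fin.Properties using (any?; punchIn-punchOut) renaming (_≟_ to _≟F_)
  open import Data.Product using (∃; _×_; _,_; proj₁; proj₂)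
  open import Data.Sum using (_⊎_; inj₁; inj₂)
  open import Data.Empty using (⊥-elim)
  open import Relation.Nullary using (yes; no; ¬?; decidable-stable)
  open import Data.Rational using (ℚ; 0ℚ; 1ℚ; _+_; _-_; _*_; -_; 1/_; ≢-nonZero)
  open import Data.Rational.Properties
  open import Data.Rational.Solver
  open +-*-Solver
  open import Relation.Binary.PropositionalEquality
  open ≡-Reasoning

  sum-cong : ∀ {n} {f g : Fin n → ℚ} → (∀ i → f i ≡ g i) → sumF f ≡ sumF g
  sum-cong {zero} eq = refl
  sum-cong {suc n} eq = cong₂ _+_ (eq zero) (sum-cong (λ i → eq (suc i)))

  sum-zero : ∀ {n} {f : Fin n → ℚ} → (∀ i → f i ≡ 0ℚ) → sumF f ≡ 0ℚ
  sum-zero {zero} eq = refl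
  sum-zero {suc n} eq = cong₂ _+_ (eq zero) (sum-zero (λ i → eq (suc i)))

  sum-+ : ∀ {n} (f g : Fin n → ℚ) → sumF (λ i → f i + g i) ≡ sumF f + sumF g
  sum-+ {zero} f g = refl
  sum-+ {suc n} f g = trans (cong (f zero + g zero +_) (sum-+ (λ i → f (suc i)) (λ i → g (suc i))))
    (solve 4 (λ a b c d → a :+ b :+ (c :+ d) := a :+ c :+ (b :+ d)) refl (f zero) (g zero) _ _)

  sum-* : ∀ {n} c (f : Fin n → ℚ) → sumF (λ i → c * f i) ≡ c * sumF f
  sum-* {zero} c f = sym (*-zeroʳ c)
  sum-* {suc n} c f = trans (cong (c * f zero +_) (sum-* c (λ i → f (suc i)))) (sym (*-distribˡ-+ c _ _))

  sum-*ʳ : ∀ {n} c (f : Fin n → ℚ) → sumF (λ i → f i * c) ≡ sumF f * c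
  sum-*ʳ c f = trans (sum-cong (λ i → *-comm (f i) c)) (trans (sum-* c f) (*-comm c _))

  sum-swap : ∀ {m n} (f : Fin m → Fin n → ℚ) →
    sumF (λ i → sumF (f i)) ≡ sumF (λ j → sumF (λ i → f i j))
  sum-swap {zero} {n} f = sym (sum-zero {n} {λ j → 0ℚ} (λ _ → refl))
  sum-swap {suc m} f = trans (cong (sumF (f zero) +_) (sum-swap (λ i → f (suc i))))
    (sym (sum-+ (f zero) (λ j → sumF (λ i → f (suc i) j))))

  sum-single : ∀ {n} {f : Fin n → ℚ} i → (∀ j → j ≢ i → f j ≡ 0ℚ) → sumF f ≡ f i
  sum-single {f = f} zero off =
    trans (cong (f zero +_) (sum-zero (λ j → off (suc j) λ ()))) (+-identityʳ _)
  sum-single {f = f} (suc i) off =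
    trans (cong₂ _+_ (off zero λ ()) (sum-single i (λ j j≢i → off (suc j) λ where refl → j≢i refl)))
          (+-identityˡ _)

  dot : ∀ {n} → (Fin n → ℚ) → (Fin n → ℚ) → ℚ
  dot x y = sumF (λ i → x i * y i)

  dot-comm : ∀ {n} (x y : Fin n → ℚ) → dot x y ≡ dot y x
  dot-comm x y = sum-cong (λ i → *-comm (x i) (y i))

  dot-eliminate : ∀ {n} (u v x : Fin n → ℚ) c →
    dot (λ j → u j - c * v j) x ≡ dot u x - c * dot v x
  dot-eliminate {n} u v x c = begin
    sumF (λ j → (u j - c * v j) * x j)
      ≡⟨ sum-cong (λ j → solve 4 (λ u c v x → (u :- c :* v) :* x := u :* x :+ (:- c) :* (v :* x))
                     refl (u j) c (v j) (x j)) ⟩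
    sumF (λ j → u j * x j + (- c) * (v j * x j))
      ≡⟨ sum-+ {n} _ _ ⟩
    dot u x + sumF (λ j → (- c) * (v j * x j))
      ≡⟨ cong (dot u x +_) (trans (sum-* {n} (- c) _) (sym (neg-distribˡ-* c (dot v x)))) ⟩
    dot u x - c * dot v x ∎

  *-cancel-0 : ∀ {a b} → a ≢ 0ℚ → a * b ≡ 0ℚ → b ≡ 0ℚ
  *-cancel-0 {a} {b} a≢0 ab≡0 = begin
    b              ≡⟨ *-identityˡ b ⟨
    1ℚ * b         ≡⟨ cong (_* b) (*-inverseˡ a) ⟨
    (1/ a) * a * b ≡⟨ *-assoc (1/ a) a b ⟩
    (1/ a) * (a * b) ≡⟨ cong ((1/ a) *_) ab≡0 ⟩
    (1/ a) * 0ℚ    ≡⟨ *-zeroʳ (1/ a) ⟩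
    0ℚ             ∎
    where instance a-nonZero = ≢-nonZero a≢0

  -- Gaussian elimination on the first column. If that column is zero, the first unit vector is a
  -- solution. Otherwise a pivot row clears the column in the other rows, induction solves the
  -- smaller system, and the pivot row fixes the first coordinate.
  kernel : ∀ {m n} → m <ℕ n → (A : Fin m → Fin n → ℚ) →
    ∃ λ x → (∃ λ j → x j ≢ 0ℚ) × (∀ i → dot (A i) x ≡ 0ℚ)
  kernel {zero} {suc n} _ A = (λ _ → 1ℚ) , (zero , 1≢0) , λ ()
  kernel {suc m} {suc n} (s≤s m<n) A with any? (λ i → ¬? (A i zero ≟ 0ℚ))
  ... | no ∄pivot = e₀ , (zero , 1≢0) , λ i →
      cong₂ _+_ (cong (_* 1ℚ) (column-0 i)) (sum-zero (λ j → *-zeroʳ (A i (suc j))))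
    where
    e₀ : Fin (suc n) → ℚ
    e₀ zero = 1ℚ
    e₀ (suc _) = 0ℚ
    column-0 : ∀ i → A i zero ≡ 0ℚ
    column-0 i = decidable-stable (A i zero ≟ 0ℚ) (λ ne → ∄pivot (i , ne))
  ... | yes (i₀ , a≢0) = x , (suc (proj₁ x′≢0) , proj₂ x′≢0) , solves
    where
    instance a-nonZero = ≢-nonZero a≢0
    inv : ℚ
    inv = 1/ A i₀ zero
    eliminated : Fin m → Fin n → ℚ
    eliminated i j = A (punchIn i₀ i) (suc j) - (A (punchIn i₀ i) zero * inv) * A i₀ (suc j)
    IH = kernel m<n eliminated
    x′ = proj₁ IH
    x′≢0 = proj₁ (proj₂ IH)
    t : ℚ
    t = dot (λ j → A i₀ (suc j)) x′
    x : Fin (suc n) → ℚ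
    x zero = - (inv * t)
    x (suc j) = x′ j
    solves : ∀ i → dot (A i) x ≡ 0ℚ
    solves i with i₀ ≟F i
    ... | yes refl = begin
      A i₀ zero * - (inv * t) + t
        ≡⟨ solve 3 (λ a v t → a :* (:- (v :* t)) :+ t := (con 1ℚ :- a :* v) :* t) refl (A i₀ zero) inv t ⟩
      (1ℚ - A i₀ zero * inv) * t ≡⟨ cong (λ y → (1ℚ - y) * t) (*-inverseʳ (A i₀ zero)) ⟩
      0ℚ * t                     ≡⟨ *-zeroˡ t ⟩
      0ℚ ∎
    ... | no i₀≢i = begin
      A i zero * - (inv * t) + r i
        ≡⟨ solve 4 (λ a v t r → a :* (:- (v :* t)) :+ r := r :- (a :* v) :* t) refl (A i zero) inv t (r i) ⟩
      r i - (A i zero * inv) * t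
        ≡⟨ cong (λ k → r k - (A k zero * inv) * t) (punchIn-punchOut i₀≢i) ⟨
      r i′ - (A i′ zero * inv) * t ≡⟨ dot-eliminate {n} (λ j → A i′ (suc j)) (λ j → A i₀ (suc j)) x′ (A i′ zero * inv) ⟨
      dot (eliminated (punchOut i₀≢i)) x′ ≡⟨ proj₂ (proj₂ IH) (punchOut i₀≢i) ⟩
      0ℚ ∎
      where
      r : Fin (suc m) → ℚ
      r k = dot (λ j → A k (suc j)) x′
      i′ = punchIn i₀ (punchOut i₀≢i)

  LinInd : ∀ {m n} → (Fin m → Fin n → ℚ) → Set
  LinInd {m} v = ∀ (c : Fin m → ℚ) → (∀ j → sumF (λ i → c i * v i j) ≡ 0ℚ) → ∀ i → c i ≡ 0ℚ

  dot-combination : ∀ {m n} (α : Fin n → ℚ) (c : Fin m → ℚ) (v : Fin m → Fin n → ℚ) →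
    dot α (λ j → sumF (λ i → c i * v i j)) ≡ sumF (λ i → c i * dot α (v i))
  dot-combination {m} {n} α c v = begin
    sumF (λ j → α j * sumF (λ i → c i * v i j))
      ≡⟨ sum-cong (λ j → trans (sym (sum-* {m} (α j) (λ i → c i * v i j)))
           (sum-cong (λ i → solve 3 (λ a c v → a :* (c :* v) := c :* (a :* v)) refl (α j) (c i) (v i j)))) ⟩
    sumF (λ j → sumF (λ i → c i * (α j * v i j))) ≡⟨ sum-swap {n} {m} (λ j i → c i * (α j * v i j)) ⟩
    sumF (λ i → sumF (λ j → c i * (α j * v i j))) ≡⟨ sum-cong (λ i → sum-* {n} (c i) (λ j → α j * v i j)) ⟩
    sumF (λ i → c i * dot α (v i)) ∎

  -- `unique` says that the φ i and κ together span, so the φ i alone have rank at least n - 1; this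
  -- is why `independent` goes up to r < n. `search` takes the place of excluded middle in deciding
  -- whether a functional vanishes on the whole family.
  module Greedy {n} {I : Set} (φ : I → Fin n → ℚ) (κ : Fin n → ℚ)
    (search : ∀ α → (∃ λ i → dot α (φ i) ≢ 0ℚ) ⊎ (∀ i → dot α (φ i) ≡ 0ℚ))
    (unique : ∀ α → (∀ i → dot α (φ i) ≡ 0ℚ) → dot α κ ≡ 0ℚ → ∀ j → α j ≡ 0ℚ) where

    -- A nonzero functional killing κ and the family chosen so far is nonzero on
    -- some φ i, which can therefore be added to the family.
    independent : ∀ r → r <ℕ n → ∃ λ (f : Fin r → I) → LinInd (λ i → φ (f i))
    independent zero _ = (λ ()) , λ _ _ ()
    independent (suc r) r<n with independent r (ℕ.<-trans (ℕ.n<1+n r) r<n)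
    ... | f , indep = extend (search α)
      where
      rows : Fin (suc r) → Fin n → ℚ
      rows zero = κ
      rows (suc i) = φ (f i)
      ker = kernel r<n rows
      α = proj₁ ker
      kills : ∀ i → dot α (rows i) ≡ 0ℚ
      kills i = trans (dot-comm α (rows i)) (proj₂ (proj₂ ker) i)
      extend : (∃ λ i → dot α (φ i) ≢ 0ℚ) ⊎ (∀ i → dot α (φ i) ≡ 0ℚ) →
        ∃ λ (f : Fin (suc r) → I) → LinInd (λ i → φ (f i))
      extend (inj₂ α⊥φ) with j , αj≢0 ← proj₁ (proj₂ ker) = ⊥-elim (αj≢0 (unique α α⊥φ (kills zero) j))
      extend (inj₁ (i₀ , ≢0)) = f′ , indep′
        where
        f′ : Fin (suc r) → I
        f′ zero = i₀
        f′ (suc i) = f i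
        indep′ : LinInd (λ i → φ (f′ i))
        indep′ c comb≡0 = all-zero
          where
          -- α kills the old members, so applying it to the relation leaves only the term of the new
          -- one.
          c₀≡0 : c zero ≡ 0ℚ
          c₀≡0 = *-cancel-0 ≢0 (begin
            dot α (φ i₀) * c zero ≡⟨ *-comm (dot α (φ i₀)) (c zero) ⟩
            c zero * dot α (φ i₀) ≡⟨ +-identityʳ (c zero * dot α (φ i₀)) ⟨
            c zero * dot α (φ i₀) + 0ℚ
              ≡⟨ cong (c zero * dot α (φ i₀) +_)
                   (sum-zero (λ i → trans (cong (c (suc i) *_) (kills (suc i))) (*-zeroʳ (c (suc i))))) ⟨
            sumF (λ i → c i * dot α (φ (f′ i))) ≡⟨ dot-combination α c (λ i → φ (f′ i)) ⟨
            dot α (λ j → sumF (λ i → c i * φ (f′ i) j))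
              ≡⟨ sum-zero (λ j → trans (cong (α j *_) (comb≡0 j)) (*-zeroʳ (α j))) ⟩
            0ℚ ∎)
          all-zero : ∀ i → c i ≡ 0ℚ
          all-zero zero = c₀≡0
          all-zero (suc i) = indep (λ k → c (suc k)) (λ j → begin
            sumF (λ k → c (suc k) * φ (f k) j) ≡⟨ +-identityˡ (sumF (λ k → c (suc k) * φ (f k) j)) ⟨
            0ℚ + sumF (λ k → c (suc k) * φ (f k) j)
              ≡⟨ cong (_+ sumF (λ k → c (suc k) * φ (f k) j))
                   (trans (cong (_* φ i₀ j) c₀≡0) (*-zeroˡ (φ i₀ j))) ⟨
            sumF (λ i → c i * φ (f′ i) j) ≡⟨ comb≡0 j ⟩
            0ℚ ∎) i

-- Edges as coordinates, and a criterion for facets of the cut polytope.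

module FacetCriterion where

  open import Defs
  open LinearAlgebra
  open import Data.Nat using (ℕ; zero; suc; z≤n; s≤s; s≤s⁻¹) renaming (_+_ to _+ℕ_; _<_ to _<ℕ_)
  import Data.Nat.Properties as ℕ
  open import Data.Fin using (Fin; zero; suc; punchIn; punchOut; toℕ; fromℕ<)
  open import Data.Fin.Properties using (+↔⊎; toℕ<n; toℕ-fromℕ<; fromℕ<-toℕ; punchIn-punchOut) renaming (_≟_ to _≟F_)
  open import Data.Fin.Subset using (Subset)
  open import Data.Fin.Subset.Properties using (anySubset?)
  open import Data.Bool using (Bool; false; _xor_; if_then_else_)
  open import Data.Vec using ([]; _∷_)
  open import Data.Product using (Σ; ∃; _×_; _,_; proj₁; proj₂)
  open import Data.Sum using (_⊎_; inj₁; inj₂)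
  open import Data.Sum.Function.Propositional using (_⊎-↔_)
  open import Data.Empty using (⊥-elim)
  open import Function using (_↔_; mk↔ₛ′; Inverse)
  open import Function.Properties.Inverse using (↔-trans; ↔-sym; ↔-refl)
  open import Relation.Nullary using (¬_; yes; no; ¬?; decidable-stable; _×-dec_)
  open import Data.Rational using (ℚ; 0ℚ; 1ℚ; _+_; _*_; _≤_; nonNegative)
  open import Data.Rational.Properties
  open import Relation.Binary.PropositionalEquality
  open ≡-Reasoning

  edge-≡ : ∀ {N} {e e′ : Edge N} → Edge.u e ≡ Edge.u e′ → Edge.v e ≡ Edge.v e′ → e ≡ e′
  edge-≡ {e = edge u v p q r} {edge _ _ p′ q′ r′} refl refl
    rewrite ℕ.≤-irrelevant p p′ | ℕ.≤-irrelevant q q′ | ℕ.≤-irrelevant r r′ = refl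

  -- An edge on N + 1 nodes either ends at the top node, and is then given by its other end shifted
  -- to start at zero, or is an edge on N nodes. Iterating this numbers the edges, so that points
  -- become vectors.
  peel-top-vertex : ∀ N → Edge (suc N) ↔ (Fin N ⊎ Edge N)
  peel-top-vertex N = mk↔ₛ′ to from to-from from-to
    where
    to : Edge (suc N) → Fin N ⊎ Edge N
    to (edge (suc u) v p q r) with ℕ.m≤n⇒m<n∨m≡n r
    ... | inj₁ v<1+N = inj₂ (edge (suc u) v p q (s≤s⁻¹ v<1+N))
    ... | inj₂ refl = inj₁ (fromℕ< (s≤s⁻¹ q))
    from : Fin N ⊎ Edge N → Edge (suc N)
    from (inj₁ i) = edge (suc (toℕ i)) (suc N) (s≤s z≤n) (s≤s (toℕ<n i)) ℕ.≤-refl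
    from (inj₂ (edge u v p q r)) = edge u v p q (ℕ.m≤n⇒m≤1+n r)
    to-from : ∀ y → to (from y) ≡ y
    to-from (inj₁ i) with ℕ.m≤n⇒m<n∨m≡n (ℕ.≤-refl {suc N})
    ... | inj₁ lt = ⊥-elim (ℕ.n≮n _ lt)
    ... | inj₂ refl = cong inj₁ (fromℕ<-toℕ i _)
    to-from (inj₂ (edge (suc u) v p q r)) with ℕ.m≤n⇒m<n∨m≡n (ℕ.m≤n⇒m≤1+n r)
    ... | inj₁ lt = cong inj₂ (edge-≡ refl refl)
    ... | inj₂ refl = ⊥-elim (ℕ.n≮n _ r)
    from-to : ∀ e → from (to e) ≡ e
    from-to (edge (suc u) v p q r) with ℕ.m≤n⇒m<n∨m≡n r
    ... | inj₁ lt = edge-≡ refl refl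
    ... | inj₂ refl = edge-≡ (cong suc (toℕ-fromℕ< _)) refl

  -- The binomial coefficient N choose 2, in the shape produced by `peel-top-vertex`.
  edgeCount : ℕ → ℕ
  edgeCount zero = zero
  edgeCount (suc N) = N +ℕ edgeCount N

  edge↔ : ∀ N → Edge N ↔ Fin (edgeCount N)
  edge↔ zero = mk↔ₛ′ (λ where (edge _ _ _ (s≤s _) ())) (λ ()) (λ ()) (λ where (edge _ _ _ (s≤s _) ()))
  edge↔ (suc N) = ↔-trans (peel-top-vertex N) (↔-trans (↔-refl ⊎-↔ edge↔ N) (↔-sym (+↔⊎ {N} {edgeCount N})))

  nthEdge : ∀ {N} → Fin (edgeCount N) → Edge N
  nthEdge {N} = Inverse.from (edge↔ N)

  edgeIndex : ∀ {N} → Edge N → Fin (edgeCount N)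
  edgeIndex {N} = Inverse.to (edge↔ N)

  nthEdge-edgeIndex : ∀ {N} (e : Edge N) → nthEdge (edgeIndex e) ≡ e
  nthEdge-edgeIndex {N} = Inverse.strictlyInverseʳ (edge↔ N)

  edgeIndex-nthEdge : ∀ {N} (i : Fin (edgeCount N)) → edgeIndex {N} (nthEdge i) ≡ i
  edgeIndex-nthEdge {N} = Inverse.strictlyInverseˡ (edge↔ N)

  sumE : ∀ {N} → (Edge N → ℚ) → ℚ
  sumE {N} f = sumF {edgeCount N} (λ i → f (nthEdge i))

  -- The point x need only agree with the combination edge by edge, which does the work of function
  -- extensionality: m = 0 yields `linear-0` and m = 1 yields `linear-cong`.
  Linear : ∀ {N} → (Pt N → ℚ) → Set
  Linear {N} F = ∀ {m} (w : Fin m → ℚ) (p : Fin m → Pt N) (x : Pt N) →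
    (∀ e → x e ≡ sumF (λ i → w i * p i e)) → F x ≡ sumF (λ i → w i * F (p i))

  linear-0 : ∀ {N} {F : Pt N → ℚ} → Linear F → ∀ {x} → (∀ e → x e ≡ 0ℚ) → F x ≡ 0ℚ
  linear-0 lin {x} x≡0 = lin {zero} (λ ()) (λ ()) x x≡0

  linear-cong : ∀ {N} {F : Pt N → ℚ} → Linear F → ∀ {x y} → (∀ e → x e ≡ y e) → F x ≡ F y
  linear-cong {F = F} lin {x} {y} x≡y =
    trans (lin {1} (λ _ → 1ℚ) (λ _ → y) x (λ e → trans (x≡y e) (sym (one-term (y e))))) (one-term (F y))
    where
    one-term : ∀ q → 1ℚ * q + 0ℚ ≡ q
    one-term q = trans (+-identityʳ _) (*-identityˡ q)

  sum-≤ : ∀ {n} {f g : Fin n → ℚ} → (∀ i → f i ≤ g i) → sumF f ≤ sumF g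
  sum-≤ {zero} le = ≤-refl
  sum-≤ {suc n} le = +-mono-≤ (le zero) (sum-≤ (λ i → le (suc i)))

  -- A set of nodes is a Boolean function on all of ℕ, but a cut vector on N nodes depends only on
  -- its values up to N. Passing to `Subset (suc N)` and back leaves finitely many sets to search
  -- for a root.
  restrict : ∀ n → (ℕ → Bool) → Subset n
  restrict zero S = []
  restrict (suc n) S = S 0 ∷ restrict n (λ u → S (suc u))

  extend : ∀ {n} → Subset n → ℕ → Bool
  extend [] _ = false
  extend (b ∷ s) zero = b
  extend (b ∷ s) (suc u) = extend s u

  extend-restrict : ∀ {n} S {u} → u <ℕ n → extend (restrict n S) u ≡ S u
  extend-restrict {suc n} S {zero} _ = refl
  extend-restrict {suc n} S {suc u} (s≤s u<n) = extend-restrict (λ u → S (suc u)) u<n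

  δ-cong : ∀ {N} {S S′ : ℕ → Bool} → (∀ {u} → u <ℕ suc N → S u ≡ S′ u) → ∀ (e : Edge N) → δ S e ≡ δ S′ e
  δ-cong eq (edge u v _ u<v v≤N) =
    cong₂ (λ b b′ → if b xor b′ then 1ℚ else 0ℚ) (eq (ℕ.<-trans u<v (s≤s v≤N))) (eq (s≤s v≤N))

  δ-empty : ∀ {N} (e : Edge N) → δ (λ _ → false) e ≡ 0ℚ
  δ-empty (edge _ _ _ _ _) = refl

  δ∈CUT : ∀ {N} S → InCUT N (δ S)
  δ∈CUT S = 1 , (λ _ → 1ℚ) , (λ _ → S) , (λ _ → 0≤1) , refl , λ e → sym (trans (+-identityʳ _) (*-identityˡ _))
    where
    0≤1 : 0ℚ ≤ 1ℚ
    0≤1 = ≤ᵇ⇒≤ _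

  -- `p-determined` says that lhs has a nonzero coefficient at p. A multiple of lhs x = β can
  -- therefore be subtracted from any equation satisfied by all roots to clear its coefficient at p,
  -- and `unique` demands that nothing remains: the roots span the hyperplane of the inequality.
  module Criterion {N} (lhs : Pt N → ℚ) (lin : Linear lhs) (β : ℚ) (β≢0 : β ≢ 0ℚ)
    (valid : ∀ S → lhs (δ S) ≤ β)
    (p : Edge N)
    (p-determined : ∀ x → (∀ e → e ≢ p → x e ≡ 0ℚ) → lhs x ≡ 0ℚ → x p ≡ 0ℚ)
    (unique : ∀ α₀ (α : Edge N → ℚ) → α p ≡ 0ℚ →
      (∀ S → lhs (δ S) ≡ β → α₀ + sumE (λ e → α e * δ S e) ≡ 0ℚ) →
      α₀ ≡ 0ℚ × (∀ e → α e ≡ 0ℚ)) where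

    M = edgeCount N

    -- The index zero is the homogenising coordinate.
    homogenise : Pt N → Fin (suc M) → ℚ
    homogenise x zero = 1ℚ
    homogenise x (suc i) = x (nthEdge i)

    Root : Set
    Root = Σ (ℕ → Bool) λ S → lhs (δ S) ≡ β

    search : ∀ α → (∃ λ (R : Root) → dot α (homogenise (δ (proj₁ R))) ≢ 0ℚ) ⊎
                   (∀ (R : Root) → dot α (homogenise (δ (proj₁ R))) ≡ 0ℚ)
    search α with anySubset? {suc N} (λ s → (lhs (δ (extend s)) ≟ β) ×-dec
                                         ¬? (dot α (homogenise (δ (extend s))) ≟ 0ℚ))
    ... | yes (s , root , ≢0) = inj₁ ((extend s , root) , ≢0)
    ... | no none = inj₂ λ (S , root) →
        let s = restrict (suc N) S
            same : ∀ e → δ (extend s) e ≡ δ S e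
            same = δ-cong (extend-restrict S)
        in trans (cong (α zero * 1ℚ +_) (sum-cong (λ i → cong (α (suc i) *_) (sym (same (nthEdge i))))))
                 (decidable-stable (_ ≟ 0ℚ) λ ≢0 → none (s , trans (linear-cong lin same) root , ≢0))

    -- The unit vector of the coordinate p: orthogonality to it is the normalisation `α p ≡ 0` in
    -- `unique`.
    κ : Fin (suc M) → ℚ
    κ zero = 0ℚ
    κ (suc i) with i ≟F edgeIndex p
    ... | yes _ = 1ℚ
    ... | no _ = 0ℚ

    dot-κ : ∀ α → dot α κ ≡ α (suc (edgeIndex p))
    dot-κ α = trans (cong (_+ sumF (λ i → α (suc i) * κ (suc i))) (*-zeroʳ (α zero)))
      (trans (+-identityˡ _) (trans (sum-single (edgeIndex p) off) on))
      where
      off : ∀ j → j ≢ edgeIndex p → α (suc j) * κ (suc j) ≡ 0ℚ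
      off j j≢ with j ≟F edgeIndex p
      ... | yes j≡ = ⊥-elim (j≢ j≡)
      ... | no _ = *-zeroʳ (α (suc j))
      on : α (suc (edgeIndex p)) * κ (suc (edgeIndex p)) ≡ α (suc (edgeIndex p))
      on with edgeIndex p ≟F edgeIndex p
      ... | yes _ = *-identityʳ _
      ... | no ≢ = ⊥-elim (≢ refl)

    unique′ : ∀ α → (∀ (R : Root) → dot α (homogenise (δ (proj₁ R))) ≡ 0ℚ) → dot α κ ≡ 0ℚ → ∀ j → α j ≡ 0ℚ
    unique′ α α⊥ α⊥κ = both
      where
      α′ : Edge N → ℚ
      α′ e = α (suc (edgeIndex e))
      result = unique (α zero) α′ (trans (sym (dot-κ α)) α⊥κ) λ S root →
        trans (cong₂ _+_ (sym (*-identityʳ (α zero)))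
                (sum-cong (λ i → cong (λ k → α (suc k) * δ S (nthEdge {N} i)) (edgeIndex-nthEdge {N} i))))
              (α⊥ (S , root))
      both : ∀ j → α j ≡ 0ℚ
      both zero = proj₁ result
      both (suc i) = trans (cong (λ k → α (suc k)) (sym (edgeIndex-nthEdge {N} i))) (proj₂ result (nthEdge i))

    open Greedy (λ (R : Root) → homogenise (δ (proj₁ R))) κ search unique′

    -- The homogenised vectors have M + 1 coordinates, and the normalisation costs one.
    family : ∃ λ (f : Fin M → Root) → LinInd (λ i → homogenise (δ (proj₁ (f i))))
    family = independent M ℕ.≤-refl

    root : Fin M → Pt N
    root i = δ (proj₁ (proj₁ family i))

    root-affInd : AffInd root
    root-affInd c sum-c≡0 comb≡0 = proj₂ family c λ where
      zero → trans (sum-cong (λ i → *-identityʳ (c i))) sum-c≡0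
      (suc j) → comb≡0 (nthEdge j)

    withZero : Fin (suc M) → Pt N
    withZero zero = δ (λ _ → false)
    withZero (suc i) = root i

    -- Applied to an affine relation, lhs gives β times the sum of the coefficients of the roots,
    -- the origin contributing zero. As β is nonzero this sum vanishes; hence the origin has
    -- coefficient zero too, and `root-affInd` applies.
    withZero-affInd : AffInd withZero
    withZero-affInd c sum-c≡0 comb≡0 = all-zero
      where
      rest : ℚ
      rest = sumF (λ i → c (suc i))
      rest≡0 : rest ≡ 0ℚ
      rest≡0 = *-cancel-0 β≢0 (begin
        β * rest ≡⟨ sum-* β (λ i → c (suc i)) ⟨
        sumF (λ i → β * c (suc i))
          ≡⟨ sum-cong (λ i → trans (*-comm β (c (suc i)))
               (cong (c (suc i) *_) (sym (proj₂ (proj₁ family i))))) ⟩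
        sumF (λ i → c (suc i) * lhs (root i)) ≡⟨ +-identityˡ _ ⟨
        0ℚ + sumF (λ i → c (suc i) * lhs (root i))
          ≡⟨ cong (_+ sumF (λ i → c (suc i) * lhs (root i)))
               (trans (cong (c zero *_) (linear-0 lin δ-empty)) (*-zeroʳ (c zero))) ⟨
        sumF (λ i → c i * lhs (withZero i)) ≡⟨ lin c withZero (λ _ → 0ℚ) (λ e → sym (comb≡0 e)) ⟨
        lhs (λ _ → 0ℚ) ≡⟨ linear-0 lin (λ _ → refl) ⟩
        0ℚ ∎)
      all-zero : ∀ i → c i ≡ 0ℚ
      all-zero zero = begin
        c zero        ≡⟨ +-identityʳ (c zero) ⟨
        c zero + 0ℚ   ≡⟨ cong (c zero +_) rest≡0 ⟨
        c zero + rest ≡⟨ sum-c≡0 ⟩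
        0ℚ ∎
      all-zero (suc i) = root-affInd (λ k → c (suc k)) rest≡0 (λ e → begin
        sumF (λ k → c (suc k) * root k e) ≡⟨ +-identityˡ _ ⟨
        0ℚ + sumF (λ k → c (suc k) * root k e)
          ≡⟨ cong (_+ sumF (λ k → c (suc k) * root k e))
               (trans (cong (c zero *_) (δ-empty e)) (*-zeroʳ (c zero))) ⟨
        sumF (λ k → c k * withZero k e) ≡⟨ comb≡0 e ⟩
        0ℚ ∎) i

    -- With fewer rows than points there is a nonzero coefficient vector in the kernel; the last
    -- hypothesis turns it into an affine dependence.
    dependent : ∀ {m n} (x : Fin n → Pt N) (rows : Fin m → Fin n → ℚ) → m <ℕ n →
      (∀ c → (∀ i → dot (rows i) c ≡ 0ℚ) → sumF c ≡ 0ℚ × (∀ e → sumF (λ i → c i * x i e) ≡ 0ℚ)) →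
      ¬ AffInd x
    dependent x rows m<n suffices indep with kernel m<n rows
    ... | c , (j , cj≢0) , kills with suffices c kills
    ... | sum≡0 , comb≡0 = cj≢0 (indep c sum≡0 comb≡0 j)

    polytope-dependent : (x : Fin (suc (suc M)) → Pt N) → ¬ AffInd x
    polytope-dependent x = dependent x rows ℕ.≤-refl λ c kills →
        trans (sum-cong (λ i → sym (*-identityˡ (c i)))) (kills zero) ,
        λ e → trans (sum-cong (λ i → trans (*-comm (c i) (x i e))
                                       (cong (λ e → x i e * c i) (sym (nthEdge-edgeIndex e)))))
                    (kills (suc (edgeIndex e)))
      where
      rows : Fin (suc M) → Fin (suc (suc M)) → ℚ
      rows i j = homogenise (x j) i

    face-dependent : (x : Fin (suc M) → Pt N) → (∀ i → lhs (x i) ≡ β) → ¬ AffInd x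
    face-dependent x on-face = go M refl (edgeIndex p) (nthEdge-edgeIndex p)
      where
      -- The coordinate p is redundant: it is determined by the others on the face.
      go : ∀ k → M ≡ k → (ip : Fin M) → nthEdge ip ≡ p → ¬ AffInd x
      go zero M≡0 ip _ with () ← subst Fin M≡0 ip
      go (suc k) M≡1+k ip ip≡p = dependent x rows (subst (λ m → suc k <ℕ suc m) (sym M≡1+k) ℕ.≤-refl) suffices
        where
        skip : Fin k → Fin M
        skip j = subst Fin (sym M≡1+k) (punchIn (subst Fin M≡1+k ip) j)
        skip-onto : ∀ i → i ≢ ip → ∃ λ j → skip j ≡ i
        skip-onto i i≢ip = onto M≡1+k i ip i≢ip
          where
          onto : ∀ {m} (eq : m ≡ suc k) (i ip : Fin m) → i ≢ ip →
            ∃ λ j → subst Fin (sym eq) (punchIn (subst Fin eq ip) j) ≡ i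
          onto refl i ip i≢ip = punchOut (≢-sym i≢ip) , punchIn-punchOut (≢-sym i≢ip)
        rows : Fin (suc k) → Fin (suc M) → ℚ
        rows zero _ = 1ℚ
        rows (suc j) i = x i (nthEdge (skip j))
        suffices : ∀ c → (∀ i → dot (rows i) c ≡ 0ℚ) →
          sumF c ≡ 0ℚ × (∀ e → sumF (λ i → c i * x i e) ≡ 0ℚ)
        suffices c kills = sum≡0 , all-coordinates
          where
          y : Pt N
          y e = sumF (λ i → c i * x i e)
          sum≡0 : sumF c ≡ 0ℚ
          sum≡0 = trans (sum-cong (λ i → sym (*-identityˡ (c i)))) (kills zero)
          others : ∀ e → e ≢ p → y e ≡ 0ℚ
          others e e≢p with skip-onto (edgeIndex e) (λ eq → e≢p
              (trans (sym (nthEdge-edgeIndex e)) (trans (cong nthEdge eq) ip≡p)))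
          ... | j , skip-j≡ = trans (sum-cong (λ i → trans (*-comm (c i) (x i e))
                  (cong (λ e → x i e * c i) (trans (sym (nthEdge-edgeIndex e)) (cong nthEdge (sym skip-j≡))))))
                (kills (suc j))
          -- On the face lhs is constant, so it sends a combination with coefficient sum zero to
          -- zero; `p-determined` then yields the missing coordinate.
          lhs-y : lhs y ≡ 0ℚ
          lhs-y = begin
            lhs y ≡⟨ lin c x y (λ _ → refl) ⟩
            sumF (λ i → c i * lhs (x i))
              ≡⟨ sum-cong (λ i → trans (cong (c i *_) (on-face i)) (*-comm (c i) β)) ⟩
            sumF (λ i → β * c i) ≡⟨ sum-* β c ⟩
            β * sumF c ≡⟨ trans (cong (β *_) sum≡0) (*-zeroʳ β) ⟩
            0ℚ ∎
          all-coordinates : ∀ e → y e ≡ 0ℚ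
          all-coordinates e with edgeIndex e ≟F edgeIndex p
          ... | yes eq = trans (cong y (trans (sym (nthEdge-edgeIndex e))
                           (trans (cong nthEdge eq) (nthEdge-edgeIndex p))))
                         (p-determined y others lhs-y)
          ... | no ≢ = others e (λ e≡p → ≢ (cong edgeIndex e≡p))

    lhs-≤ : ∀ x → InCUT N x → lhs x ≤ β
    lhs-≤ x (m , w , S , w≥0 , sum-w≡1 , x≡) = ≤-trans
      (≤-reflexive (lin w (λ i → δ (S i)) x x≡))
      (≤-trans (sum-≤ (λ i → *-monoˡ-≤-nonNeg (w i) {{nonNegative (w≥0 i)}} (valid (S i))))
               (≤-reflexive (trans (sum-*ʳ β w) (trans (cong (_* β) sum-w≡1) (*-identityˡ β)))))

    facet : IsFacet (InCUT N) lhs β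
    facet = lhs-≤ , dims M refl (edgeIndex p)
      where
      Face : Pt N → Set
      Face x = InCUT N x × lhs x ≡ β
      full-dim : HasDim (InCUT N) M
      full-dim = (withZero , inCUT , withZero-affInd) , λ x _ → polytope-dependent x
        where
        inCUT : ∀ i → InCUT N (withZero i)
        inCUT zero = δ∈CUT (λ _ → false)
        inCUT (suc i) = δ∈CUT (proj₁ (proj₁ family i))
      -- The edge p shows that M is not zero, so that the dimension M - 1 of the face is a natural
      -- number.
      dims : ∀ k → M ≡ k → Fin M → ∃ λ d → HasDim (InCUT N) (suc d) × HasDim Face d
      dims (suc d) M≡1+d _ = d , subst (HasDim (InCUT N)) M≡1+d full-dim ,
        (subst (λ m → Σ (Fin m → Pt N) λ x → (∀ i → Face (x i)) × AffInd x) M≡1+d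
           (root , (λ i → δ∈CUT (proj₁ (proj₁ family i)) , proj₂ (proj₁ family i)) , root-affInd)) ,
        subst (λ m → ∀ (x : Fin (suc m) → Pt N) → (∀ i → Face (x i)) → ¬ AffInd x) M≡1+d
          (λ x x∈F → face-dependent x (λ i → proj₂ (x∈F i)))
      dims zero M≡0 i with () ← subst Fin M≡0 i

-- Sums over 1, ..., k and over lists of indices, single and double.

module FiniteSums where

  open import Data.Nat
  open import Data.Nat.Properties
  open import Data.Nat.Tactic.RingSolver using (solve-∀)
  open import Data.Bool using (true; false; if_then_else_; T)
  open import Data.List using (List; []; _∷_; map)
  open import Data.Nat.ListAction using (sum)
  open import Data.List.Relation.Unary.All as All using (All; []; _∷_)
  open import Data.List.Relation.Unary.AllPairs using (AllPairs; []; _∷_)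
  open import Data.Product using (_×_; _,_)
  open import Data.Empty using (⊥-elim)
  open import Data.Unit using (tt)
  open import Relation.Binary.PropositionalEquality

  sum1 : ℕ → (ℕ → ℕ) → ℕ
  sum1 zero f = 0
  sum1 (suc k) f = f 1 + sum1 k (λ i → f (suc i))

  sumOver : List ℕ → (ℕ → ℕ) → ℕ
  sumOver L f = sum (map f L)

  sum1-cong : ∀ k {f g : ℕ → ℕ} → (∀ i → 1 ≤ i → i ≤ k → f i ≡ g i) → sum1 k f ≡ sum1 k g
  sum1-cong zero eq = refl
  sum1-cong (suc k) eq = cong₂ _+_ (eq 1 ≤-refl (s≤s z≤n))
    (sum1-cong k (λ i 1≤i i≤k → eq (suc i) (s≤s z≤n) (s≤s i≤k)))

  sum1-zero : ∀ k {f : ℕ → ℕ} → (∀ i → 1 ≤ i → i ≤ k → f i ≡ 0) → sum1 k f ≡ 0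
  sum1-zero zero eq = refl
  sum1-zero (suc k) eq = cong₂ _+_ (eq 1 ≤-refl (s≤s z≤n))
    (sum1-zero k (λ i 1≤i i≤k → eq (suc i) (s≤s z≤n) (s≤s i≤k)))

  sum1-+ : ∀ k (f g : ℕ → ℕ) → sum1 k (λ i → f i + g i) ≡ sum1 k f + sum1 k g
  sum1-+ zero f g = refl
  sum1-+ (suc k) f g rewrite sum1-+ k (λ i → f (suc i)) (λ i → g (suc i)) =
    shuffle (f 1) (g 1) (sum1 k (λ i → f (suc i))) (sum1 k (λ i → g (suc i)))
    where
    shuffle : ∀ a b c d → a + b + (c + d) ≡ a + c + (b + d)
    shuffle = solve-∀

  sum1-* : ∀ k c (f : ℕ → ℕ) → sum1 k (λ i → c * f i) ≡ c * sum1 k f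
  sum1-* zero c f = sym (*-zeroʳ c)
  sum1-* (suc k) c f rewrite sum1-* k c (λ i → f (suc i)) = sym (*-distribˡ-+ c (f 1) _)

  sum1-split : ∀ m n (f : ℕ → ℕ) → sum1 (m + n) f ≡ sum1 m f + sum1 n (λ i → f (m + i))
  sum1-split zero n f = refl
  sum1-split (suc m) n f rewrite sum1-split m n (λ i → f (suc i)) = sym (+-assoc (f 1) _ _)

  mask : ℕ → (ℕ → ℕ) → ℕ → ℕ
  mask i f j = if j ≡ᵇ i then 0 else f j

  mask-≢ : ∀ {i j} f → i ≢ j → mask i f j ≡ f j
  mask-≢ {i} {j} f i≢j with j ≡ᵇ i in eq
  ... | false = refl
  ... | true = ⊥-elim (i≢j (sym (≡ᵇ⇒≡ j i (subst T (sym eq) tt))))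

  sum1-extract : ∀ k f {i} → 1 ≤ i → i ≤ k → sum1 k f ≡ f i + sum1 k (mask i f)
  sum1-extract (suc k) f {suc zero} _ _ =
    cong (f 1 +_) (sum1-cong k (λ where (suc i) _ _ → refl))
  sum1-extract (suc k) f {suc (suc i)} _ (s≤s 1+i≤k)
    rewrite sum1-extract k (λ i → f (suc i)) {suc i} (s≤s z≤n) 1+i≤k =
    swap (f 1) (f (suc (suc i))) _
    where
    swap : ∀ a b c → a + (b + c) ≡ b + (a + c)
    swap = solve-∀

  outside : List ℕ → (ℕ → ℕ) → ℕ → ℕ
  outside [] f = f
  outside (i ∷ L) f = outside L (mask i f)

  Within : ℕ → ℕ → Set
  Within k i = 1 ≤ i × i ≤ k

  Distinct : List ℕ → Set
  Distinct = AllPairs _≢_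

  sumOver-cong : ∀ {L} {f g : ℕ → ℕ} → All (λ i → f i ≡ g i) L → sumOver L f ≡ sumOver L g
  sumOver-cong [] = refl
  sumOver-cong (eq ∷ eqs) = cong₂ _+_ eq (sumOver-cong eqs)

  sumOver-+ : ∀ L (f g : ℕ → ℕ) → sumOver L (λ i → f i + g i) ≡ sumOver L f + sumOver L g
  sumOver-+ [] f g = refl
  sumOver-+ (x ∷ L) f g rewrite sumOver-+ L f g = shuffle (f x) (g x) (sumOver L f) (sumOver L g)
    where
    shuffle : ∀ a b c d → a + b + (c + d) ≡ a + c + (b + d)
    shuffle = solve-∀

  -- The indices in L are extracted one at a time; distinctness keeps a mask from altering the
  -- entries extracted after it.
  sum1-outside : ∀ k f {L} → Distinct L → All (Within k) L → sum1 k f ≡ sumOver L f + sum1 k (outside L f)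
  sum1-outside k f [] [] = refl
  sum1-outside k f {i ∷ L} (i∉L ∷ distinct) ((1≤i , i≤k) ∷ within) = begin
    sum1 k f ≡⟨ sum1-extract k f 1≤i i≤k ⟩
    f i + sum1 k (mask i f) ≡⟨ cong (f i +_) (sum1-outside k (mask i f) distinct within) ⟩
    f i + (sumOver L (mask i f) + sum1 k (outside L (mask i f)))
      ≡⟨ cong (λ s → f i + (s + sum1 k (outside L (mask i f)))) (sumOver-cong (All.map (mask-≢ f) i∉L)) ⟩
    f i + (sumOver L f + sum1 k (outside L (mask i f))) ≡⟨ +-assoc (f i) _ _ ⟨
    f i + sumOver L f + sum1 k (outside L (mask i f)) ∎
    where
    open ≡-Reasoning

  outside-zero : ∀ L f {j} → (All (_≢ j) L → f j ≡ 0) → outside L f j ≡ 0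
  outside-zero [] f z = z []
  outside-zero (i ∷ L) f {j} z = outside-zero L (mask i f) masked
    where
    masked : All (_≢ j) L → mask i f j ≡ 0
    masked j∉L with j ≡ᵇ i in eq
    ... | true = refl
    ... | false = z ((λ i≡j → subst T eq (≡⇒≡ᵇ j i (sym i≡j))) ∷ j∉L)

  sum1-support : ∀ k f {L} → Distinct L → All (Within k) L →
    (∀ j → Within k j → All (_≢ j) L → f j ≡ 0) → sum1 k f ≡ sumOver L f
  sum1-support k f {L} distinct within zero-off = begin
    sum1 k f ≡⟨ sum1-outside k f distinct within ⟩
    sumOver L f + sum1 k (outside L f)
      ≡⟨ cong (sumOver L f +_) (sum1-zero k (λ j 1≤j j≤k → outside-zero L f (zero-off j (1≤j , j≤k)))) ⟩
    sumOver L f + 0 ≡⟨ +-identityʳ _ ⟩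
    sumOver L f ∎
    where
    open ≡-Reasoning

  sumOver-≤-sum1 : ∀ k f {L} → Distinct L → All (Within k) L → sumOver L f ≤ sum1 k f
  sumOver-≤-sum1 k f distinct within =
    ≤-trans (m≤m+n _ _) (≤-reflexive (sym (sum1-outside k f distinct within)))

  square : ℕ → (ℕ → ℕ → ℕ) → ℕ
  square k h = sum1 k (λ i → sum1 k (h i))

  -- The sum over i < j, in the order of the double sum in `lhsI'`.
  pairs : ℕ → (ℕ → ℕ → ℕ) → ℕ
  pairs k h = sum1 k (λ j → sum1 (j ∸ 1) (λ i → h i j))

  -- Induction that peels off the index 1: by symmetry its row and its column have the same sum.
  square-pairs : ∀ k h → (∀ i j → h i j ≡ h j i) → square k h ≡ sum1 k (λ i → h i i) + 2 * pairs k h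
  square-pairs zero h h-sym = refl
  square-pairs (suc k) h h-sym = begin
    h 1 1 + row + sum1 k (λ i → h (suc i) 1 + sum1 k (λ j → h (suc i) (suc j)))
      ≡⟨ cong (h 1 1 + row +_) (sum1-+ k _ _) ⟩
    h 1 1 + row + (sum1 k (λ i → h (suc i) 1) + square k h′)
      ≡⟨ cong₂ (λ r s → h 1 1 + row + (r + s)) (sum1-cong k (λ i _ _ → h-sym (suc i) 1))
           (square-pairs k h′ (λ i j → h-sym (suc i) (suc j))) ⟩
    h 1 1 + row + (row + (diag + 2 * pairs k h′)) ≡⟨ regroup (h 1 1) row diag (pairs k h′) ⟩
    h 1 1 + diag + 2 * (row + pairs k h′) ≡⟨ cong (λ p → h 1 1 + diag + 2 * p) tail ⟨
    h 1 1 + diag + 2 * pairs (suc k) h ∎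
    where
    open ≡-Reasoning
    h′ = λ i j → h (suc i) (suc j)
    row = sum1 k (λ j → h 1 (suc j))
    diag = sum1 k (λ i → h′ i i)
    regroup : ∀ a r d p → a + r + (r + (d + 2 * p)) ≡ a + d + 2 * (r + p)
    regroup = solve-∀
    tail : pairs (suc k) h ≡ row + pairs k h′
    tail = trans (sum1-cong k (λ where (suc j) _ _ → refl)) (sum1-+ k _ _)

  square-support : ∀ k h {L} → Distinct L → All (Within k) L →
    (∀ i j → Within k i → Within k j → All (_≢ i) L → h i j ≡ 0) →
    (∀ i j → Within k i → Within k j → All (_≢ j) L → h i j ≡ 0) →
    square k h ≡ sumOver L (λ i → sumOver L (h i))
  square-support k h {L} distinct within zeroˡ zeroʳ = trans
    (sum1-support k _ distinct within (λ i wi i∉L → sum1-zero k (λ j 1≤j j≤k → zeroˡ i j wi (1≤j , j≤k) i∉L)))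
    (sumOver-cong (All.map (λ {i} wi → sum1-support k (h i) distinct within (λ j wj → zeroʳ i j wi wj)) within))

  pairsOver : List ℕ → (ℕ → ℕ → ℕ) → ℕ
  pairsOver [] h = 0
  pairsOver (i ∷ L) h = sumOver L (h i) + pairsOver L h

  squareOver-pairsOver : ∀ L h → (∀ i j → h i j ≡ h j i) →
    sumOver L (λ i → sumOver L (h i)) ≡ sumOver L (λ i → h i i) + 2 * pairsOver L h
  squareOver-pairsOver [] h h-sym = refl
  squareOver-pairsOver (x ∷ L) h h-sym = begin
    h x x + row + sumOver L (λ i → h i x + sumOver L (h i))
      ≡⟨ cong (h x x + row +_) (sumOver-+ L _ _) ⟩
    h x x + row + (sumOver L (λ i → h i x) + sumOver L (λ i → sumOver L (h i)))
      ≡⟨ cong₂ (λ r s → h x x + row + (r + s)) (sumOver-cong (All.universal (λ i → h-sym i x) L))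
           (squareOver-pairsOver L h h-sym) ⟩
    h x x + row + (row + (diag + 2 * pairsOver L h)) ≡⟨ regroup (h x x) row diag (pairsOver L h) ⟩
    h x x + diag + 2 * (row + pairsOver L h) ∎
    where
    open ≡-Reasoning
    row = sumOver L (h x)
    diag = sumOver L (λ i → h i i)
    regroup : ∀ a r d p → a + r + (r + (d + 2 * p)) ≡ a + d + 2 * (r + p)
    regroup = solve-∀

-- Full components against inner edges: the counting inequalities behind validity.

module CutCount where

  open import Defs using (ValidEnds; Adj; IsC4)
  open FiniteSums
  open import Data.Nat
  open import Data.Nat.Properties
  open import Data.Nat.Tactic.RingSolver using (solve-∀)
  open import Data.Bool using (Bool; true; false; if_then_else_; _∧_; T)
  open import Data.Bool.Properties using (∧-comm)
  open import Data.Fin using (Fin; zero; suc)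
  open import Data.Fin.Properties using (all?)
  open import Data.List using (List; []; _∷_)
  open import Data.List.Relation.Unary.All as All using (All; []; _∷_)
  open import Data.List.Relation.Unary.AllPairs using ([]; _∷_)
  open import Data.Product using (_×_; _,_; proj₁; proj₂)
  open import Data.Sum using (_⊎_; inj₁; inj₂)
  open import Data.Empty using (⊥-elim)
  open import Data.Unit using (tt)
  open import Relation.Nullary using (yes; no; ⌊_⌋; Dec; toWitness; _×-dec_; _⊎-dec_)
  open import Relation.Binary.PropositionalEquality

  ι : Bool → ℕ
  ι b = if b then 1 else 0

  ι-mono : ∀ {b b′} → (b ≡ true → b′ ≡ true) → ι b ≤ ι b′
  ι-mono {false} imp = z≤n
  ι-mono {true} imp rewrite imp refl = ≤-refl

  ι-∧ : ∀ b b′ → ι b * ι b′ ≡ ι (b ∧ b′)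
  ι-∧ false b′ = refl
  ι-∧ true b′ = +-identityʳ (ι b′)

  ∧-true : ∀ {b b′} → b ∧ b′ ≡ true → b ≡ true × b′ ≡ true
  ∧-true {true} {true} _ = refl , refl

  module _ (k t : ℕ) (end : ℕ → ℕ → ℕ) where

    isFull : (ℕ → Bool) → ℕ → Bool
    isFull S i = if ⌊ i ≤? t ⌋ then S i ∧ S (i + k) else S i

    full : (ℕ → Bool) → ℕ → ℕ
    full S i = ι (isFull S i)

    link : (ℕ → Bool) → ℕ → ℕ → ℕ
    link S i j = ι (S (end i j) ∧ S (end j i))

    -- The diagonal is chosen so that Σᵢⱼ H S i j counts the full components once
    -- and the edges of G inside S twice.
    H : (ℕ → Bool) → ℕ → ℕ → ℕ
    H S i j = if i ≡ᵇ j then full S i else link S i j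

    H-diag : ∀ S i → H S i i ≡ full S i
    H-diag S i with i ≡ᵇ i in eq
    ... | true = refl
    ... | false with () ← subst T eq (≡⇒≡ᵇ i i refl)

    H-off : ∀ S {i j} → i ≢ j → H S i j ≡ link S i j
    H-off S {i} {j} i≢j with i ≡ᵇ j in eq
    ... | false = refl
    ... | true = ⊥-elim (i≢j (≡ᵇ⇒≡ i j (subst T (sym eq) tt)))

    H-sym : ∀ S i j → H S i j ≡ H S j i
    H-sym S i j with i ≟ j
    ... | yes refl = refl
    ... | no i≢j = trans (H-off S i≢j) (trans (cong ι (∧-comm (S (end i j)) _)) (sym (H-off S (≢-sym i≢j))))

    square-H : ∀ S → square k (H S) ≡ sum1 k (full S) + 2 * pairs k (link S)
    square-H S = trans (square-pairs k (H S) (H-sym S)) (cong₂ (λ x y → x + 2 * y)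
      (sum1-cong k (λ i _ _ → H-diag S i))
      (sum1-cong k (λ where
        (suc j) _ _ → sum1-cong j (λ i _ i≤j → H-off S (<⇒≢ (s≤s i≤j))))))

    module _ (valid : ValidEnds k t end) where

      full⇒end : ∀ S {i j} → Within k i → Within k j → i ≢ j → isFull S i ≡ true → S (end i j) ≡ true
      full⇒end S {i} {j} (1≤i , i≤k) (1≤j , j≤k) i≢j fl
        with i ≤? t | valid i j 1≤i i≤k 1≤j j≤k i≢j
      ... | yes _ | inj₁ eq = trans (cong S eq) (proj₁ (∧-true fl))
      ... | yes _ | inj₂ (_ , eq) = trans (cong S eq) (proj₂ (∧-true {S i} fl))
      ... | no _ | inj₁ eq = trans (cong S eq) fl
      ... | no i≰t | inj₂ (i≤t , _) = ⊥-elim (i≰t i≤t)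

      -- The edge between two full components has both ends in S, whichever nodes these are; on the
      -- diagonal both sides equal `full S i`.
      full-full≤H : ∀ S {i j} → Within k i → Within k j → full S i * full S j ≤ H S i j
      full-full≤H S {i} {j} wi wj with i ≟ j
      ... | yes refl = ≤-trans (≤-reflexive (ι-∧ (isFull S i) (isFull S i)))
            (≤-trans (ι-mono (λ eq → proj₁ (∧-true eq))) (≤-reflexive (sym (H-diag S i))))
      ... | no i≢j = ≤-trans (≤-reflexive (ι-∧ (isFull S i) (isFull S j)))
            (≤-trans (ι-mono both) (≤-reflexive (sym (H-off S i≢j))))
        where
        both : isFull S i ∧ isFull S j ≡ true → S (end i j) ∧ S (end j i) ≡ true
        both eq with fi , fj ← ∧-true eq
          rewrite full⇒end S wi wj i≢j fi | full⇒end S wj wi (≢-sym i≢j) fj = refl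

      excess : (ℕ → Bool) → ℕ → ℕ → ℕ
      excess S i j = H S i j ∸ full S i * full S j

      -- The products `full S i * full S j` sum to M², so together with `square-H` this reads M + 2e
      -- = M² + surplus.
      square-excess : ∀ S → square k (H S) ≡ sum1 k (full S) * sum1 k (full S) + square k (excess S)
      square-excess S = begin
        square k (H S)
          ≡⟨ sum1-cong k (λ i 1≤i i≤k → trans
               (sum1-cong k (λ j 1≤j j≤k → sym (m+[n∸m]≡n (full-full≤H S (1≤i , i≤k) (1≤j , j≤k)))))
               (sum1-+ k _ _)) ⟩
        sum1 k (λ i → sum1 k (λ j → full S i * full S j) + sum1 k (excess S i)) ≡⟨ sum1-+ k _ _ ⟩
        sum1 k (λ i → sum1 k (λ j → full S i * full S j)) + square k (excess S)
          ≡⟨ cong (_+ square k (excess S)) (trans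
               (sum1-cong k (λ i _ _ → trans (sum1-* k (full S i) (full S)) (*-comm (full S i) _)))
               (sum1-* k (sum1 k (full S)) (full S))) ⟩
        sum1 k (full S) * sum1 k (full S) + square k (excess S) ∎
        where open ≡-Reasoning

    -- An upper node p + k exceeds k, so both ends of the edge are lower nodes and its pair of
    -- indices must be {x, y}.
    c4-edge : ValidEnds k t end → ∀ {x y} → Within k x → Within k y → Adj k end x y → end x y ≡ x × end y x ≡ y
    c4-edge valid {x} {y} wx wy (i , j , 1≤i , i<j , j≤k , same) = result same
      where
      i≤k = ≤-trans (<⇒≤ i<j) j≤k
      1≤j = ≤-trans 1≤i (<⇒≤ i<j)
      low-end : ∀ {p q x} → Within k p → Within k q → p ≢ q → Within k x → x ≡ end p q → x ≡ p
      low-end {p} {q} (1≤p , p≤k) (1≤q , q≤k) p≢q wx x≡ with valid p q 1≤p p≤k 1≤q q≤k p≢q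
      ... | inj₁ eq = trans x≡ eq
      ... | inj₂ (_ , eq) = ⊥-elim (m+1+n≰m k (begin
          k + suc (pred p) ≡⟨ cong (k +_) (suc-pred p {{>-nonZero 1≤p}}) ⟩
          k + p ≡⟨ +-comm k p ⟩
          p + k ≡⟨ trans x≡ eq ⟨
          _ ≤⟨ proj₂ wx ⟩
          k ∎))
        where open ≤-Reasoning
      result : (x ≡ end i j × y ≡ end j i) ⊎ (x ≡ end j i × y ≡ end i j) → end x y ≡ x × end y x ≡ y
      result (inj₁ (x≡ , y≡))
        with refl ← low-end (1≤i , i≤k) (1≤j , j≤k) (<⇒≢ i<j) wx x≡
           | refl ← low-end (1≤j , j≤k) (1≤i , i≤k) (>⇒≢ i<j) wy y≡ = sym x≡ , sym y≡
      result (inj₂ (x≡ , y≡))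
        with refl ← low-end (1≤j , j≤k) (1≤i , i≤k) (>⇒≢ i<j) wx x≡
           | refl ← low-end (1≤i , i≤k) (1≤j , j≤k) (<⇒≢ i<j) wy y≡ = sym x≡ , sym y≡

  -- How S meets the component of a cycle node: it omits the node, contains the node but not the
  -- whole component, or contains the component. The middle case cannot occur for a one-node
  -- component.
  data State : Set where
    absent partial complete : State

  inside? : State → ℕ
  inside? absent = 0
  inside? _ = 1

  full? : State → ℕ
  full? complete = 1
  full? _ = 0

  state : ∀ b f → (f ≡ true → b ≡ true) → State
  state false _ _ = absent
  state true false _ = partial
  state true true _ = complete

  state-inside : ∀ b f imp → inside? (state b f imp) ≡ ι b
  state-inside false f imp = refl
  state-inside true false imp = refl
  state-inside true true imp = refl

  state-full : ∀ b f imp → full? (state b f imp) ≡ ι f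
  state-full false false imp = refl
  state-full false true imp with () ← imp refl
  state-full true false imp = refl
  state-full true true imp = refl

  states : Fin 3 → State
  states zero = absent
  states (suc zero) = partial
  states (suc (suc zero)) = complete

  states-onto : ∀ (P : State → Set) → (∀ i → P (states i)) → ∀ s → P s
  states-onto P p absent = p zero
  states-onto P p partial = p (suc zero)
  states-onto P p complete = p (suc (suc zero))

  -- The three alternatives are what is needed to absorb the cycle nodes into
  -- 3M ≤ 2 + M² for the number M of full components: the better inequalities
  -- 3M ≤ M² and 3M + 4 ≤ M² hold for M ≥ 3 and M ≥ 4 respectively.
  CycleBound : (inside crossing fulls : ℕ) → Set
  CycleBound s x f = (s ≤ 2 + x) ⊎ (3 ≤ f × s ≤ 3 + x) ⊎ (4 ≤ f × s ≤ 5 + x)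

  cycleBound? : ∀ s x f → Dec (CycleBound s x f)
  cycleBound? s x f = (s ≤? 2 + x) ⊎-dec ((3 ≤? f) ×-dec (s ≤? 3 + x)) ⊎-dec ((4 ≤? f) ×-dec (s ≤? 5 + x))

  -- The surplus of an edge of C: such an edge lies inside S exactly when both of its nodes, which
  -- are lower nodes, do.
  crossing : State → State → ℕ
  crossing p q = inside? p * inside? q ∸ full? p * full? q

  -- A check of all 81 patterns. Only if at least three nodes are inside and all of these are
  -- complete does the first alternative fail, since otherwise a node that is not complete makes the
  -- edges to its inside neighbours count in the crossings.
  cycle-bound : ∀ p q r s → CycleBound
    (inside? p + inside? q + inside? r + inside? s)
    (crossing p q + crossing q r + crossing r s + crossing s p)
    (full? p + full? q + full? r + full? s)
  cycle-bound = states-onto _ λ i → states-onto _ λ j → states-onto _ λ l → states-onto _ λ m →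
    toWitness {a? = all? λ i → all? λ j → all? λ l → all? λ m → bounded? (states i) (states j) (states l) (states m)} tt i j l m
    where
    bounded? : ∀ p q r s → Dec (CycleBound
      (inside? p + inside? q + inside? r + inside? s)
      (crossing p q + crossing q r + crossing r s + crossing s p)
      (full? p + full? q + full? r + full? s))
    bounded? p q r s = cycleBound? _ _ _

  -- This is (m - 1)(m - 2) ≥ 0, with equality for m = 1 and m = 2, the values attained at the roots
  -- V_i and V_i ∪ V_j.
  3m≤m²+2 : ∀ m → 3 * m ≤ m * m + 2
  3m≤m²+2 zero = z≤n
  3m≤m²+2 (suc zero) = ≤-refl
  3m≤m²+2 (suc (suc n)) = ≤-trans (m≤m+n _ (n * n + n)) (≤-reflexive (identity n))
    where
    identity : ∀ n → 3 * suc (suc n) + (n * n + n) ≡ suc (suc n) * suc (suc n) + 2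
    identity = solve-∀

  3m≤m² : ∀ {m} → 3 ≤ m → 3 * m ≤ m * m
  3m≤m² {m} 3≤m = *-monoˡ-≤ m 3≤m

  -- The difference of the two sides is (m - 4)(m + 1).
  3m+4≤m² : ∀ {m} → 4 ≤ m → 3 * m + 4 ≤ m * m
  3m+4≤m² {m} 4≤m = ≤-trans (+-monoʳ-≤ (3 * m) 4≤m) (≤-trans (≤-reflexive (+-comm (3 * m) m)) (*-monoˡ-≤ m 4≤m))

  -- The three bounds on 3m - m² are 2, 0 and -4, and the constants 2, 3, 5 in `CycleBound` balance
  -- them: 2 + 2·2 = 0 + 2·3 = -4 + 2·5 = 6.
  cycle-absorbed : ∀ {s x f} m → CycleBound s x f → f ≤ m → 3 * m + 2 * s ≤ m * m + 2 * x + 6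
  cycle-absorbed {s} {x} m (inj₁ s≤) _ = ≤-trans (+-mono-≤ (3m≤m²+2 m) (*-monoʳ-≤ 2 s≤)) (≤-reflexive (regroup (m * m) x))
    where
    regroup : ∀ a x → a + 2 + 2 * (2 + x) ≡ a + 2 * x + 6
    regroup = solve-∀
  cycle-absorbed {s} {x} m (inj₂ (inj₁ (3≤f , s≤))) f≤m =
    ≤-trans (+-mono-≤ (3m≤m² (≤-trans 3≤f f≤m)) (*-monoʳ-≤ 2 s≤)) (≤-reflexive (regroup (m * m) x))
    where
    regroup : ∀ a x → a + 2 * (3 + x) ≡ a + 2 * x + 6
    regroup = solve-∀
  cycle-absorbed {s} {x} m (inj₂ (inj₂ (4≤f , s≤))) f≤m = +-cancelʳ-≤ 4 _ _ (begin
    3 * m + 2 * s + 4 ≡⟨ regroup₁ (3 * m) s ⟩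
    3 * m + 4 + 2 * s ≤⟨ +-mono-≤ (3m+4≤m² (≤-trans 4≤f f≤m)) (*-monoʳ-≤ 2 s≤) ⟩
    m * m + 2 * (5 + x) ≡⟨ regroup₂ (m * m) x ⟩
    m * m + 2 * x + 6 + 4 ∎)
    where
    open ≤-Reasoning
    regroup₁ : ∀ a s → a + 2 * s + 4 ≡ a + 4 + 2 * s
    regroup₁ = solve-∀
    regroup₂ : ∀ a x → a + 2 * (5 + x) ≡ a + 2 * x + 6 + 4
    regroup₂ = solve-∀

  module _ (k t : ℕ) (end : ℕ → ℕ → ℕ) (valid : ValidEnds k t end) where

    -- Validity for n+2 ∉ S: twice e is at least M² - M, and M² ≥ 3M - 2.
    full-bound : ∀ S → sum1 k (full k t end S) ≤ 1 + pairs k (link k t end S)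
    full-bound S = *-cancelˡ-≤ 2 (+-cancelʳ-≤ m _ _ (begin
      2 * m + m ≡⟨ regroup₁ m ⟩
      3 * m ≤⟨ 3m≤m²+2 m ⟩
      m * m + 2 ≤⟨ +-monoˡ-≤ 2 (m≤m+n (m * m) _) ⟩
      m * m + square k (excess k t end valid S) + 2 ≡⟨ cong (_+ 2) (square-excess k t end valid S) ⟨
      square k (H k t end S) + 2 ≡⟨ cong (_+ 2) (square-H k t end S) ⟩
      m + 2 * e + 2 ≡⟨ regroup₂ m e ⟩
      2 * (1 + e) + m ∎))
      where
      open ≤-Reasoning
      m = sum1 k (full k t end S)
      e = pairs k (link k t end S)
      regroup₁ : ∀ m → 2 * m + m ≡ 3 * m
      regroup₁ = solve-∀
      regroup₂ : ∀ m e → m + 2 * e + 2 ≡ 2 * (1 + e) + m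
      regroup₂ = solve-∀

    nodes-distinct : ∀ {a b c d} → IsC4 k end a b c d → Distinct (a ∷ b ∷ c ∷ d ∷ [])
    nodes-distinct (_ , _ , _ , _ , (ab , ac , ad , bc , bd , cd) , _) =
      (ab ∷ ac ∷ ad ∷ []) ∷ (bc ∷ bd ∷ []) ∷ (cd ∷ []) ∷ [] ∷ []

    nodes-within : ∀ {a b c d} → IsC4 k end a b c d → All (Within k) (a ∷ b ∷ c ∷ d ∷ [])
    nodes-within (wa , wb , wc , wd , _) = wa ∷ wb ∷ wc ∷ wd ∷ []

    -- Validity for n+2 ∈ S. After doubling and adding M, what has to be shown is `cycle-absorbed`
    -- with x the surplus on the edges of C.
    full-cycle-bound : ∀ {a b c d} → IsC4 k end a b c d → ∀ S → sum1 k (full k t end S) + (ι (S a) + ι (S b) + ι (S c) + ι (S d))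
                           ≤ 3 + pairs k (link k t end S)
    full-cycle-bound {a} {b} {c} {d} isC4@(wa , wb , wc , wd , (ab , ac , ad , bc , bd , cd) , Eab , Ebc , Ecd , Eda) S =
      *-cancelˡ-≤ 2 (+-cancelʳ-≤ m _ _ (begin
        2 * (m + s) + m ≡⟨ regroup₁ m s ⟩
        3 * m + 2 * s ≤⟨ cycle-absorbed m bound fulls ⟩
        m * m + 2 * x + 6 ≤⟨ +-monoˡ-≤ 6 (+-monoʳ-≤ (m * m) excesses) ⟩
        m * m + square k D + 6 ≡⟨ cong (_+ 6) (square-excess k t end valid S) ⟨
        square k (H k t end S) + 6 ≡⟨ cong (_+ 6) (square-H k t end S) ⟩
        m + 2 * e + 6 ≡⟨ regroup₂ m e ⟩
        2 * (3 + e) + m ∎))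
      where
      open ≤-Reasoning
      m = sum1 k (full k t end S)
      e = pairs k (link k t end S)
      s = ι (S a) + ι (S b) + ι (S c) + ι (S d)
      D = excess k t end valid S
      F = full k t end S
      x = D a b + D b c + D c d + D d a
      regroup₁ : ∀ m s → 2 * (m + s) + m ≡ 3 * m + 2 * s
      regroup₁ = solve-∀
      regroup₂ : ∀ m e → m + 2 * e + 6 ≡ 2 * (3 + e) + m
      regroup₂ = solve-∀
      full⇒inside : ∀ y → isFull k t end S y ≡ true → S y ≡ true
      full⇒inside y fl with y ≤? t
      ... | yes _ = proj₁ (∧-true fl)
      ... | no _ = fl
      st : ℕ → State
      st y = state (S y) (isFull k t end S y) (full⇒inside y)
      ins : ∀ y → inside? (st y) ≡ ι (S y)
      ins y = state-inside (S y) _ (full⇒inside y)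
      ful : ∀ y → full? (st y) ≡ F y
      ful y = state-full (S y) _ (full⇒inside y)
      cross : ∀ {y z} → y ≢ z → Within k y → Within k z → Adj k end y z → crossing (st y) (st z) ≡ D y z
      cross {y} {z} y≢z wy wz adj with eq₁ , eq₂ ← c4-edge k t end valid wy wz adj = cong₂ _∸_
        (trans (cong₂ _*_ (ins y) (ins z)) (trans (ι-∧ (S y) (S z))
          (trans (cong₂ (λ p q → ι (S p ∧ S q)) (sym eq₁) (sym eq₂)) (sym (H-off k t end S y≢z)))))
        (cong₂ _*_ (ful y) (ful z))
      add₄ : ∀ {p p′ q q′ r r′ s s′ : ℕ} → p ≡ p′ → q ≡ q′ → r ≡ r′ → s ≡ s′ → p + q + r + s ≡ p′ + q′ + r′ + s′
      add₄ refl refl refl refl = refl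
      bound : CycleBound s x (F a + F b + F c + F d)
      bound = subst₂ (λ s′ x′ → CycleBound s′ x′ (F a + F b + F c + F d)) (add₄ (ins a) (ins b) (ins c) (ins d))
        (add₄ (cross ab wa wb Eab) (cross bc wb wc Ebc) (cross cd wc wd Ecd) (cross (≢-sym ad) wd wa Eda))
        (subst (CycleBound (inside? (st a) + inside? (st b) + inside? (st c) + inside? (st d)) (crossing (st a) (st b) + crossing (st b) (st c) + crossing (st c) (st d) + crossing (st d) (st a))) (add₄ (ful a) (ful b) (ful c) (ful d)) (cycle-bound (st a) (st b) (st c) (st d)))
      fulls : F a + F b + F c + F d ≤ m
      fulls = ≤-trans (≤-reflexive (assoc (F a) (F b) (F c) (F d))) (sumOver-≤-sum1 k F (nodes-distinct isC4) (nodes-within isC4))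
        where
        assoc : ∀ a b c d → a + b + c + d ≡ a + (b + (c + (d + 0)))
        assoc = solve-∀
      D-sym : ∀ i j → D i j ≡ D j i
      D-sym i j = cong₂ _∸_ (H-sym k t end S i j) (*-comm (F i) (F j))
      -- Each edge of C occurs as two ordered pairs in the square; the diagonal entries, the chords
      -- ac and bd, and everything off C are discarded.
      excesses : 2 * x ≤ square k D
      excesses = begin
        2 * x ≤⟨ m≤n+m (2 * x) (D a a + D b b + D c c + D d d + 2 * D a c + 2 * D b d) ⟩
        (D a a + D b b + D c c + D d d + 2 * D a c + 2 * D b d) + 2 * x
          ≡⟨ expand (D a a) (D b b) (D c c) (D d d) (D a b) (D a c) (D a d) (D b c) (D b d) (D c d) (D d a) (D-sym d a) ⟩
        D a a + D b b + D c c + D d d + 2 * (D a b + D a c + D a d + D b c + D b d + D c d)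
          ≡⟨ expand′ (D a a) (D b b) (D c c) (D d d) (D a b) (D a c) (D a d) (D b c) (D b d) (D c d) ⟩
        sumOver C (λ i → D i i) + 2 * pairsOver C D ≡⟨ squareOver-pairsOver C D D-sym ⟨
        sumOver C (λ i → sumOver C (D i))
          ≤⟨ sumOver-mono (nodes-within isC4) ⟩
        sumOver C (λ i → sum1 k (D i)) ≤⟨ sumOver-≤-sum1 k _ (nodes-distinct isC4) (nodes-within isC4) ⟩
        square k D ∎
        where
        C = a ∷ b ∷ c ∷ d ∷ []
        sumOver-mono : ∀ {L} → All (Within k) L → sumOver L (λ i → sumOver C (D i)) ≤ sumOver L (λ i → sum1 k (D i))
        sumOver-mono [] = z≤n
        sumOver-mono {i ∷ _} (_ ∷ ws) = +-mono-≤ (sumOver-≤-sum1 k (D i) (nodes-distinct isC4) (nodes-within isC4)) (sumOver-mono ws)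
        expand : ∀ aa bb cc dd ab ac ad bc bd cd da → da ≡ ad →
          (aa + bb + cc + dd + 2 * ac + 2 * bd) + 2 * (ab + bc + cd + da)
          ≡ aa + bb + cc + dd + 2 * (ab + ac + ad + bc + bd + cd)
        expand aa bb cc dd ab ac ad bc bd cd _ refl = go aa bb cc dd ab ac ad bc bd cd
          where
          go : ∀ aa bb cc dd ab ac ad bc bd cd →
            (aa + bb + cc + dd + 2 * ac + 2 * bd) + 2 * (ab + bc + cd + ad)
            ≡ aa + bb + cc + dd + 2 * (ab + ac + ad + bc + bd + cd)
          go = solve-∀
        expand′ : ∀ aa bb cc dd ab ac ad bc bd cd →
          aa + bb + cc + dd + 2 * (ab + ac + ad + bc + bd + cd)
          ≡ aa + (bb + (cc + (dd + 0))) + 2 * (ab + (ac + (ad + 0)) + (bc + (bd + 0) + (cd + 0 + (0 + 0))))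
        expand′ = solve-∀

-- The left-hand side evaluated at cut vectors, its validity, and the pivot coordinate.

module LhsValue where

  open import Defs
  open LinearAlgebra using (sum-cong; sum-zero; sum-+; sum-*)
  open FacetCriterion using (Linear; linear-cong; edge-≡)
  open FiniteSums
  open CutCount
  open import Data.Nat as ℕ using (ℕ; zero; suc; z≤n; s≤s; _∸_; _≤?_; _<?_) renaming (_+_ to _+ℕ_; _*_ to _*ℕ_; _≤_ to _≤ℕ_; _<_ to _<ℕ_)
  import Data.Nat.Properties as ℕ
  open import Data.Nat.Tactic.RingSolver using (solve-∀)
  open import Data.Bool using (Bool; true; false; _xor_; _∧_; not; if_then_else_)
  open import Data.Bool.Properties using (xor-comm)
  open import Data.List using (List; []; _∷_; map; foldr; upTo; applyUpTo)
  open import Data.List.Relation.Unary.All using (All; []; _∷_)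
  open import Data.Product using (_,_; proj₁; proj₂)
  open import Data.Sum using (inj₁; inj₂)
  open import Data.Empty using (⊥-elim)
  open import Relation.Nullary using (yes; no)
  open import Data.Rational using (ℚ; 0ℚ; 1ℚ; _+_; _-_; _*_; -_; _≤_)
  open import Data.Rational.Properties hiding (_≤?_; _<?_)
  open import Data.Rational.Solver
  open +-*-Solver
  open import Relation.Binary.PropositionalEquality

  linear-+ : ∀ {N} {F G : Pt N → ℚ} → Linear F → Linear G → Linear (λ x → F x + G x)
  linear-+ {F = F} {G} linF linG {m} w p x x≡ = trans (cong₂ _+_ (linF w p x x≡) (linG w p x x≡))
    (trans (sym (sum-+ (λ i → w i * F (p i)) (λ i → w i * G (p i))))
           (sum-cong (λ i → sym (*-distribˡ-+ (w i) (F (p i)) (G (p i))))))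

  linear-* : ∀ {N} {F : Pt N → ℚ} c → Linear F → Linear (λ x → c * F x)
  linear-* {F = F} c linF {m} w p x x≡ = trans (cong (c *_) (linF w p x x≡))
    (trans (sym (sum-* c (λ i → w i * F (p i))))
           (sum-cong (λ i → solve 3 (λ c w f → c :* (w :* f) := w :* (c :* f)) refl c (w i) (F (p i)))))

  linear-zero : ∀ {N} → Linear {N} (λ _ → 0ℚ)
  linear-zero w p x x≡ = sym (sum-zero (λ i → *-zeroʳ (w i)))

  linear-- : ∀ {N} {F G : Pt N → ℚ} → Linear F → Linear G → Linear (λ x → F x - G x)
  linear-- {F = F} {G} linF linG {m} w p x x≡ =
    trans (cong (F x +_) (neg (G x))) (trans (linear-+ {F = F} {λ x → - 1ℚ * G x} linF (linear-* {F = G} (- 1ℚ) linG) w p x x≡)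
      (sum-cong (λ i → cong (λ y → w i * (F (p i) + y)) (sym (neg (G (p i)))))))
    where
    neg : ∀ q → - q ≡ - 1ℚ * q
    neg q = solve 1 (λ q → :- q := :- con 1ℚ :* q) refl q

  linear-sumL : ∀ {N} (L : List ℕ) (F : ℕ → Pt N → ℚ) → (∀ i → Linear (F i)) → Linear (λ x → sumL L (λ i → F i x))
  linear-sumL [] F lin = linear-zero
  linear-sumL (i ∷ L) F lin = linear-+ {F = F i} {λ x → sumL L (λ i → F i x)} (lin i) (linear-sumL L F lin)

  linear-val : ∀ {N} u v → Linear {N} (λ x → val x u v)
  linear-val {N} u v w p x x≡ with 1 ≤? u | u <? v | v ≤? N
  ... | yes 1≤u | yes u<v | yes v≤N = x≡ (edge u v 1≤u u<v v≤N)
  ... | no _ | _ | _ = linear-zero w p x x≡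
  ... | yes _ | no _ | _ = linear-zero w p x x≡
  ... | yes _ | yes _ | no _ = linear-zero w p x x≡

  linear-xs : ∀ {N} u v → Linear {N} (λ x → xs x u v)
  linear-xs u v w p x x≡ with u <? v
  ... | yes _ = linear-val u v w p x x≡
  ... | no _ = linear-val v u w p x x≡

  linear-T : ∀ {N} u v w → Linear {N} (λ x → T x u v w)
  linear-T u v w = linear-- {F = λ x → xs x u v - xs x u w} {λ x → xs x v w}
    (linear-- {F = λ x → xs x u v} {λ x → xs x u w} (linear-xs u v) (linear-xs u w)) (linear-xs v w)

  linear-lhs : ∀ k t end a b c d → Linear (lhsI' k t end a b c d)
  linear-lhs k t end a b c d =
    linear-+ {F = λ x → A x - B x + two * C x} {D}
      (linear-+ {F = λ x → A x - B x} {λ x → two * C x}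
        (linear-- {F = A} {B} linA linB) (linear-* {F = C} two linC)) linD
    where
    n = k +ℕ t
    A B C D : Pt (n +ℕ 2) → ℚ
    A x = sumR 1 k (λ j → sumR 1 (j ∸ 1) (λ i → T x (end i j) (end j i) (n +ℕ 1)))
    B x = sumR 1 t (λ i → T x i (i +ℕ k) (n +ℕ 1))
    C x = sumR (suc t) k (λ i → xs x i (n +ℕ 1))
    D x = sumL (a ∷ b ∷ c ∷ d ∷ []) (λ u → xs x u (n +ℕ 1) - xs x u (n +ℕ 2))
    linA : Linear A
    linA = linear-sumL (upTo k) _ λ j → linear-sumL (upTo j) _ λ i →
      linear-T (end (suc i) (suc j)) (end (suc j) (suc i)) (n +ℕ 1)
    linB : Linear B
    linB = linear-sumL (upTo t) _ λ i → linear-T (suc i) (suc i +ℕ k) (n +ℕ 1)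
    linC : Linear C
    linC = linear-sumL (upTo (k ∸ t)) _ λ i → linear-xs (suc t +ℕ i) (n +ℕ 1)
    linD : Linear D
    linD = linear-sumL (a ∷ b ∷ c ∷ d ∷ []) _ λ u →
      linear-- {F = λ x → xs x u (n +ℕ 1)} {λ x → xs x u (n +ℕ 2)} (linear-xs u (n +ℕ 1)) (linear-xs u (n +ℕ 2))

  ind : Bool → ℚ
  ind b = if b then 1ℚ else 0ℚ

  xs-δ : ∀ {N} S {u v} → u ≢ v → Within N u → Within N v → xs {N} (δ S) u v ≡ ind (S u xor S v)
  xs-δ {N} S {u} {v} u≢v (1≤u , u≤N) (1≤v , v≤N) with u <? v
  ... | yes u<v with 1 ≤? u | u <? v | v ≤? N
  ...   | yes _ | yes _ | yes _ = refl
  ...   | no ≰ | _ | _ = ⊥-elim (≰ 1≤u)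
  ...   | yes _ | no ≮ | _ = ⊥-elim (≮ u<v)
  ...   | yes _ | yes _ | no ≰ = ⊥-elim (≰ v≤N)
  xs-δ {N} S {u} {v} u≢v (1≤u , u≤N) (1≤v , v≤N) | no u≮v with 1 ≤? v | v <? u | u ≤? N
  ...   | yes _ | yes _ | yes _ = cong ind (xor-comm (S v) (S u))
  ...   | no ≰ | _ | _ = ⊥-elim (≰ 1≤v)
  ...   | yes _ | no ≮ | _ = ⊥-elim (u≢v (ℕ.≤-antisym (ℕ.≮⇒≥ ≮) (ℕ.≮⇒≥ u≮v)))
  ...   | yes _ | yes _ | no ≰ = ⊥-elim (≰ u≤N)

  nat : ℕ → ℚ
  nat zero = 0ℚ
  nat (suc n) = 1ℚ + nat n

  nat-+ : ∀ m n → nat (m +ℕ n) ≡ nat m + nat n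
  nat-+ zero n = sym (+-identityˡ _)
  nat-+ (suc m) n = trans (cong (1ℚ +_) (nat-+ m n)) (sym (+-assoc 1ℚ (nat m) (nat n)))

  nat-nonneg : ∀ n → 0ℚ ≤ nat n
  nat-nonneg zero = ≤-refl
  nat-nonneg (suc n) = ≤-trans (≤ᵇ⇒≤ _) (+-monoʳ-≤ 1ℚ (nat-nonneg n))

  nat-mono : ∀ {m n} → m ≤ℕ n → nat m ≤ nat n
  nat-mono {n = n} z≤n = nat-nonneg n
  nat-mono (s≤s m≤n) = +-monoʳ-≤ 1ℚ (nat-mono m≤n)

  -- Since `upTo` unfolds to `applyUpTo`, whose tail shifts its function, the induction needs an
  -- arbitrary h. The factor c carries the -2 of the triangle terms.
  sum-applyUpTo : ∀ n (h : ℕ → ℕ) (f : ℕ → ℚ) c (g : ℕ → ℕ) →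
    (∀ i → i <ℕ n → f (h i) ≡ c * nat (g (suc i))) →
    foldr _+_ 0ℚ (map f (applyUpTo h n)) ≡ c * nat (sum1 n g)
  sum-applyUpTo zero h f c g eq = sym (*-zeroʳ c)
  sum-applyUpTo (suc n) h f c g eq = trans
    (cong₂ _+_ (eq 0 (s≤s z≤n)) (sum-applyUpTo n (λ i → h (suc i)) f c (λ i → g (suc i)) (λ i i<n → eq (suc i) (s≤s i<n))))
    (trans (sym (*-distribˡ-+ c (nat (g 1)) _)) (cong (c *_) (sym (nat-+ (g 1) _))))

  sum-upTo : ∀ n (f : ℕ → ℚ) c (g : ℕ → ℕ) → (∀ i → i <ℕ n → f i ≡ c * nat (g (suc i))) →
    foldr _+_ 0ℚ (map f (upTo n)) ≡ c * nat (sum1 n g)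
  sum-upTo n = sum-applyUpTo n (λ i → i)

  sum-upTo-zero : ∀ n (f : ℕ → ℚ) → (∀ i → i <ℕ n → f i ≡ 0ℚ) → foldr _+_ 0ℚ (map f (upTo n)) ≡ 0ℚ
  sum-upTo-zero n f eq = trans (sum-upTo n f 0ℚ (λ _ → 0) (λ i i<n → trans (eq i i<n) (sym (*-zeroˡ 0ℚ)))) (*-zeroˡ (nat (sum1 n (λ _ → 0))))

  module _ (k t : ℕ) (t≤k : t ≤ℕ k) (end : ℕ → ℕ → ℕ) (valid : ValidEnds k t end) where

    private
      n = k +ℕ t
      o = n +ℕ 1
      z = n +ℕ 2
      N = n +ℕ 2

    end-within : ∀ {i j} → Within k i → Within k j → i ≢ j → Within n (end i j)
    end-within {i} {j} (1≤i , i≤k) (1≤j , j≤k) i≢j with valid i j 1≤i i≤k 1≤j j≤k i≢j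
    ... | inj₁ eq = subst (Within n) (sym eq) (1≤i , ℕ.m≤n⇒m≤n+o t i≤k)
    ... | inj₂ (i≤t , eq) = subst (Within n) (sym eq)
          (ℕ.m≤n⇒m≤n+o k 1≤i , ℕ.≤-trans (ℕ.+-monoˡ-≤ k i≤t) (ℕ.≤-reflexive (ℕ.+-comm t k)))

    upper-distinct : ∀ {i j} → Within k i → Within k j → i ≢ j +ℕ k
    upper-distinct {i} {j} (_ , i≤k) (1≤j , _) i≡j+k =
      ℕ.<⇒≱ (ℕ.m<n+m k 1≤j) (subst (_≤ℕ k) i≡j+k i≤k)

    ends-distinct : ∀ {i j} → Within k i → Within k j → i ≢ j → end i j ≢ end j i
    ends-distinct {i} {j} wi@(1≤i , i≤k) wj@(1≤j , j≤k) i≢j eq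
      with valid i j 1≤i i≤k 1≤j j≤k i≢j | valid j i 1≤j j≤k 1≤i i≤k (≢-sym i≢j)
    ... | inj₁ p | inj₁ q = i≢j (trans (sym p) (trans eq q))
    ... | inj₁ p | inj₂ (_ , q) = upper-distinct wi wj (trans (sym p) (trans eq q))
    ... | inj₂ (_ , p) | inj₁ q = upper-distinct wj wi (trans (sym q) (trans (sym eq) p))
    ... | inj₂ (_ , p) | inj₂ (_ , q) = i≢j (ℕ.+-cancelʳ-≡ k i j (trans (sym p) (trans eq q)))

    within-o : Within N o
    within-o = ℕ.m≤n+m 1 n , ℕ.+-monoʳ-≤ n (s≤s z≤n)

    within-z : Within N z
    within-z = ℕ.m≤n⇒m≤o+n n (s≤s z≤n) , ℕ.≤-refl

    within-N : ∀ {u} → Within n u → Within N u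
    within-N (1≤u , u≤n) = 1≤u , ℕ.m≤n⇒m≤n+o 2 u≤n

    ≢o : ∀ {u} → Within n u → u ≢ o
    ≢o (_ , u≤n) refl = ℕ.m+1+n≰m n u≤n

    ≢z : ∀ {u} → Within n u → u ≢ z
    ≢z (_ , u≤n) refl = ℕ.m+1+n≰m n u≤n

    o≢z : o ≢ z
    o≢z eq with () ← ℕ.+-cancelˡ-≡ n 1 2 eq

    within-n : ∀ {i} → Within k i → Within n i
    within-n (1≤i , i≤k) = 1≤i , ℕ.m≤n⇒m≤n+o t i≤k

    within-upper : ∀ {i} → 1 ≤ℕ i → i ≤ℕ t → Within n (i +ℕ k)
    within-upper {i} 1≤i i≤t = ℕ.m≤n⇒m≤n+o k 1≤i , ℕ.≤-trans (ℕ.+-monoˡ-≤ k i≤t) (ℕ.≤-reflexive (ℕ.+-comm t k))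

    module _ (S : ℕ → Bool) (So : S o ≡ false) where

      xs-o : ∀ {u} → Within n u → xs {N} (δ S) u o ≡ nat (ι (S u))
      xs-o {u} wu = trans (xs-δ S (≢o wu) (within-N wu) within-o) (trans (cong (λ b → ind (S u xor b)) So) (flip (S u)))
        where
        flip : ∀ b → ind (b xor false) ≡ nat (ι b)
        flip false = refl
        flip true = refl

      -- With n+1 outside S and x, y the indicators of u and v, exclusive or is x + y - 2xy, so
      -- subtracting x and y leaves -2xy.
      T-δ : ∀ {u v} → Within n u → Within n v → u ≢ v → T {N} (δ S) u v o ≡ - two * nat (ι (S u ∧ S v))
      T-δ {u} {v} wu wv u≢v = trans
        (cong₂ _-_ (cong₂ _-_ (xs-δ S u≢v (within-N wu) (within-N wv)) (xs-o wu)) (xs-o wv)) (table (S u) (S v))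
        where
        table : ∀ b b′ → ind (b xor b′) - nat (ι b) - nat (ι b′) ≡ - two * nat (ι (b ∧ b′))
        table false false = refl
        table false true = refl
        table true false = refl
        table true true = refl

      -- Over the four nodes of C these terms add up to 2zs - 4z, which is twice z (s - 2).
      cycle-term : ∀ {u} → Within k u → xs {N} (δ S) u o - xs (δ S) u z ≡ two * nat (ι (S z) *ℕ ι (S u)) - nat (ι (S z))
      cycle-term {u} wu = trans
        (cong₂ _-_ (xs-o (within-n wu)) (xs-δ S (≢z (within-n wu)) (within-N (within-n wu)) within-z)) (table (S u) (S z))
        where
        table : ∀ b b′ → nat (ι b) - ind (b xor b′) ≡ two * nat (ι b′ *ℕ ι b) - nat (ι b′)
        table false false = refl
        table false true = refl
        table true false = refl
        table true true = refl

      -- The two-node components enter the left-hand side through the edges of F and the one-node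
      -- components through the sum with factor 2; each full one contributes 2.
      full-count : sum1 t (λ i → ι (S i ∧ S (i +ℕ k))) +ℕ sum1 (k ∸ t) (λ i → ι (S (t +ℕ i))) ≡ sum1 k (full k t end S)
      full-count = trans (cong₂ _+ℕ_ (sum1-cong t paired) (sum1-cong (k ∸ t) unpaired))
        (trans (sym (sum1-split t (k ∸ t) (full k t end S))) (cong (λ m → sum1 m (full k t end S)) (ℕ.m+[n∸m]≡n t≤k)))
        where
        paired : ∀ i → 1 ≤ℕ i → i ≤ℕ t → ι (S i ∧ S (i +ℕ k)) ≡ full k t end S i
        paired i _ i≤t with i ≤? t
        ... | yes _ = refl
        ... | no i≰t = ⊥-elim (i≰t i≤t)
        unpaired : ∀ i → 1 ≤ℕ i → i ≤ℕ k ∸ t → ι (S (t +ℕ i)) ≡ full k t end S (t +ℕ i)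
        unpaired (suc i) _ _ with t +ℕ suc i ≤? t
        ... | yes le = ⊥-elim (ℕ.m+1+n≰m t le)
        ... | no _ = refl

      -- The negative terms are moved to the left, so that both counts are natural numbers.
      lhs-δ : ∀ {a b c d} → All (Within k) (a ∷ b ∷ c ∷ d ∷ []) →
        lhsI' k t end a b c d (δ S) + two * nat (pairs k (link k t end S) +ℕ 2 *ℕ ι (S z))
        ≡ two * nat (sum1 k (full k t end S) +ℕ ι (S z) *ℕ (ι (S a) +ℕ ι (S b) +ℕ ι (S c) +ℕ ι (S d)))
      lhs-δ {a} {b} {c} {d} (wa ∷ wb ∷ wc ∷ wd ∷ []) = begin
        A - B + two * C + D + two * nat (e +ℕ 2 *ℕ ιz)
          ≡⟨ cong₂ _+_ (cong₂ _+_ (cong₂ _+_ (cong₂ _-_ A≡ B≡) (cong (two *_) C≡)) D≡) (cong (two *_) (nat-+ e (2 *ℕ ιz))) ⟩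
        - two * nat e - - two * nat f + two * (1ℚ * nat g)
          + (q a - r + (q b - r + (q c - r + (q d - r + 0ℚ)))) + two * (nat e + nat (2 *ℕ ιz))
          ≡⟨ cong (λ y → - two * nat e - - two * nat f + two * (1ℚ * nat g)
               + (q a - r + (q b - r + (q c - r + (q d - r + 0ℚ)))) + two * (nat e + y)) double ⟩
        - two * nat e - - two * nat f + two * (1ℚ * nat g)
          + (q a - r + (q b - r + (q c - r + (q d - r + 0ℚ)))) + two * (nat e + (r + (r + 0ℚ)))
          ≡⟨ solve 8 (λ e f g u v w x r →
               :- con two :* e :- :- con two :* f :+ con two :* (con 1ℚ :* g)
               :+ (con two :* u :- r :+ (con two :* v :- r :+ (con two :* w :- r :+ (con two :* x :- r :+ con 0ℚ))))
               :+ con two :* (e :+ (r :+ (r :+ con 0ℚ)))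
               := con two :* ((f :+ g) :+ (u :+ v :+ w :+ x))) refl
               (nat e) (nat f) (nat g) (nat (ιz *ℕ ι (S a))) (nat (ιz *ℕ ι (S b))) (nat (ιz *ℕ ι (S c))) (nat (ιz *ℕ ι (S d))) r ⟩
        two * ((nat f + nat g) + (nat (ιz *ℕ ι (S a)) + nat (ιz *ℕ ι (S b)) + nat (ιz *ℕ ι (S c)) + nat (ιz *ℕ ι (S d))))
          ≡⟨ cong (two *_) (sym collect) ⟩
        two * nat (sum1 k (full k t end S) +ℕ ιz *ℕ (ι (S a) +ℕ ι (S b) +ℕ ι (S c) +ℕ ι (S d))) ∎
        where
        open ≡-Reasoning
        x : Pt N
        x = δ S
        ιz = ι (S z)
        r = nat ιz
        q : ℕ → ℚ
        q u = two * nat (ιz *ℕ ι (S u))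
        A = sumR 1 k (λ j → sumR 1 (j ∸ 1) (λ i → T x (end i j) (end j i) o))
        B = sumR 1 t (λ i → T x i (i +ℕ k) o)
        C = sumR (suc t) k (λ i → xs x i o)
        D = sumL (a ∷ b ∷ c ∷ d ∷ []) (λ u → xs x u o - xs x u z)
        e = pairs k (link k t end S)
        f = sum1 t (λ i → ι (S i ∧ S (i +ℕ k)))
        g = sum1 (k ∸ t) (λ i → ι (S (t +ℕ i)))
        A≡ : A ≡ - two * nat e
        A≡ = sum-upTo k _ (- two) (λ j → sum1 (j ∸ 1) (λ i → link k t end S i j)) λ j j<k →
          sum-upTo j _ (- two) (λ i → link k t end S i (suc j)) λ i i<j →
            let wi = s≤s z≤n , ℕ.<-trans i<j j<k
                wj = s≤s z≤n , j<k
                i≢j = ℕ.<⇒≢ (s≤s i<j)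
            in T-δ (end-within wi wj i≢j) (end-within wj wi (≢-sym i≢j)) (ends-distinct wi wj i≢j)
        B≡ : B ≡ - two * nat f
        B≡ = sum-upTo t _ (- two) _ λ i i<t →
          let wi = s≤s z≤n , ℕ.≤-trans i<t t≤k
          in T-δ (within-n wi) (within-upper (s≤s z≤n) i<t) (upper-distinct wi wi)
        C≡ : C ≡ 1ℚ * nat g
        C≡ = sum-upTo (k ∸ t) _ 1ℚ _ λ i i<k∸t → trans
          (xs-o (within-n (s≤s z≤n , ℕ.≤-trans (ℕ.≤-reflexive (sym (ℕ.+-suc t i)))
                  (ℕ.≤-trans (ℕ.+-monoʳ-≤ t i<k∸t) (ℕ.≤-reflexive (ℕ.m+[n∸m]≡n t≤k))))))
          (trans (cong (λ u → nat (ι (S u))) (sym (ℕ.+-suc t i))) (sym (*-identityˡ _)))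
        D≡ : D ≡ q a - r + (q b - r + (q c - r + (q d - r + 0ℚ)))
        D≡ = cong₂ _+_ (cycle-term wa) (cong₂ _+_ (cycle-term wb) (cong₂ _+_ (cycle-term wc) (cong₂ _+_ (cycle-term wd) refl)))
        double : nat (2 *ℕ ιz) ≡ r + (r + 0ℚ)
        double = trans (nat-+ ιz (ιz +ℕ 0)) (cong (r +_) (nat-+ ιz 0))
        collect : nat (sum1 k (full k t end S) +ℕ ιz *ℕ (ι (S a) +ℕ ι (S b) +ℕ ι (S c) +ℕ ι (S d)))
          ≡ (nat f + nat g) + (nat (ιz *ℕ ι (S a)) + nat (ιz *ℕ ι (S b)) + nat (ιz *ℕ ι (S c)) + nat (ιz *ℕ ι (S d)))
        collect = trans (nat-+ (sum1 k (full k t end S)) _) (cong₂ _+_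
          (trans (cong nat (sym full-count)) (nat-+ f g))
          (trans (cong nat (distribute ιz (ι (S a)) (ι (S b)) (ι (S c)) (ι (S d))))
            (trans (nat-+ (u +ℕ v +ℕ w) y) (cong (_+ nat y) (trans (nat-+ (u +ℕ v) w) (cong (_+ nat w) (nat-+ u v)))))))
          where
          u = ιz *ℕ ι (S a)
          v = ιz *ℕ ι (S b)
          w = ιz *ℕ ι (S c)
          y = ιz *ℕ ι (S d)
          distribute : ∀ z a b c d → z *ℕ (a +ℕ b +ℕ c +ℕ d) ≡ z *ℕ a +ℕ z *ℕ b +ℕ z *ℕ c +ℕ z *ℕ d
          distribute = solve-∀

    lhs-value : ∀ S → S o ≡ false → ∀ {a b c d} → IsC4 k end a b c d → ∀ {m} →
      sum1 k (full k t end S) +ℕ ι (S z) *ℕ (ι (S a) +ℕ ι (S b) +ℕ ι (S c) +ℕ ι (S d))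
        ≡ m +ℕ (pairs k (link k t end S) +ℕ 2 *ℕ ι (S z)) →
      lhsI' k t end a b c d (δ S) ≡ two * nat m
    lhs-value S So {a} {b} {c} {d} isC4 {m} eq = begin
      L ≡⟨ solve 2 (λ l y → l := l :+ y :- y) refl L (two * nat B) ⟩
      L + two * nat B - two * nat B
        ≡⟨ cong (_- two * nat B) (trans (lhs-δ S So (nodes-within k t end valid isC4))
             (cong (two *_) (trans (cong nat eq) (nat-+ m B)))) ⟩
      two * (nat m + nat B) - two * nat B
        ≡⟨ solve 2 (λ m b → con two :* (m :+ b) :- con two :* b := con two :* m) refl (nat m) (nat B) ⟩
      two * nat m ∎
      where
      open ≡-Reasoning
      L = lhsI' k t end a b c d (δ S)
      B = pairs k (link k t end S) +ℕ 2 *ℕ ι (S z)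

    lhs-bound₀ : ∀ S → S o ≡ false → ∀ {a b c d} → IsC4 k end a b c d → lhsI' k t end a b c d (δ S) ≤ two
    lhs-bound₀ S So {a} {b} {c} {d} isC4 = begin
      L ≡⟨ solve 2 (λ l y → l := l :+ y :- y) refl L (two * nat B) ⟩
      L + two * nat B - two * nat B
        ≡⟨ cong (_- two * nat B) (lhs-δ S So (nodes-within k t end valid isC4)) ⟩
      two * nat A - two * nat B
        ≤⟨ +-monoˡ-≤ (- (two * nat B)) (*-monoˡ-≤-nonNeg two (nat-mono A≤1+B)) ⟩
      two * (1ℚ + nat B) - two * nat B
        ≡⟨ solve 1 (λ b → con two :* (con 1ℚ :+ b) :- con two :* b := con two) refl (nat B) ⟩
      two ∎
      where
      open ≤-Reasoning
      L = lhsI' k t end a b c d (δ S)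
      e = pairs k (link k t end S)
      B = e +ℕ 2 *ℕ ι (S z)
      A = sum1 k (full k t end S) +ℕ ι (S z) *ℕ (ι (S a) +ℕ ι (S b) +ℕ ι (S c) +ℕ ι (S d))
      A≤1+B : A ≤ℕ 1 +ℕ B
      A≤1+B with S z
      ... | false = ℕ.≤-trans (ℕ.≤-reflexive (ℕ.+-identityʳ _))
            (ℕ.≤-trans (full-bound k t end valid S) (s≤s (ℕ.m≤m+n e 0)))
      ... | true = ℕ.≤-trans (ℕ.≤-reflexive (cong (sum1 k (full k t end S) +ℕ_) (ℕ.+-identityʳ _)))
            (ℕ.≤-trans (full-cycle-bound k t end valid isC4 S) (ℕ.≤-reflexive (rearrange e)))
        where
        rearrange : ∀ e → 3 +ℕ e ≡ 1 +ℕ (e +ℕ 2)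
        rearrange = solve-∀

    lhs-bound : ∀ {a b c d} → IsC4 k end a b c d → ∀ S → lhsI' k t end a b c d (δ S) ≤ two
    lhs-bound {a} {b} {c} {d} isC4 S with S o in So
    ... | false = lhs-bound₀ S So isC4
    -- S and its complement have the same cut vector, and the complement avoids n+1.
    ... | true = ≤-trans (≤-reflexive (linear-cong (linear-lhs k t end a b c d) same))
                         (lhs-bound₀ (λ u → not (S u)) (cong not So) isC4)
      where
      xor-not : ∀ b b′ → b xor b′ ≡ not b xor not b′
      xor-not false false = refl
      xor-not false true = refl
      xor-not true false = refl
      xor-not true true = refl
      same : ∀ (e : Edge N) → δ S e ≡ δ (λ u → not (S u)) e
      same (edge u v _ _ _) = cong ind (xor-not (S u) (S v))

    module _ {a b c d} (isC4 : IsC4 k end a b c d) where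

      wa : Within k a
      wa = proj₁ isC4

      -- Only the four variables from C to n+2 involve n+2, each with coefficient -1; the first of
      -- them is the coordinate at which equations are normalised.
      pivot : Edge N
      pivot = edge a z (proj₁ wa) (ℕ.≤-<-trans (proj₂ (within-n wa)) (ℕ.m<m+n n (s≤s z≤n))) ℕ.≤-refl

      -- Every variable of the left-hand side other than the pivot avoids n+2 or avoids a, so at a
      -- point supported on the pivot only `- x pivot` survives.
      pivot-determined : ∀ (x : Pt N) → (∀ e → e ≢ pivot → x e ≡ 0ℚ) → lhsI' k t end a b c d x ≡ 0ℚ → x pivot ≡ 0ℚ
      pivot-determined x off lhs≡0 = begin
        x pivot ≡⟨ solve 1 (λ p → p := :- (con 0ℚ :- con 0ℚ :+ con two :* con 0ℚ :+ (con 0ℚ :- p :+ con 0ℚ))) refl (x pivot) ⟩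
        - (0ℚ - 0ℚ + two * 0ℚ + (0ℚ - x pivot + 0ℚ)) ≡⟨ cong -_ (value isC4) ⟨
        - lhsI' k t end a b c d x ≡⟨ cong -_ lhs≡0 ⟩
        0ℚ ∎
        where
        open ≡-Reasoning
        xs-off-z : ∀ {u v} → u ≢ z → v ≢ z → xs x u v ≡ 0ℚ
        xs-off-z {u} {v} u≢z v≢z with u <? v
        ... | yes _ with 1 ≤? u | u <? v | v ≤? N
        ...   | yes _ | yes _ | yes _ = off _ (λ eq → v≢z (cong Edge.v eq))
        ...   | no _ | _ | _ = refl
        ...   | yes _ | no _ | _ = refl
        ...   | yes _ | yes _ | no _ = refl
        xs-off-z {u} {v} u≢z v≢z | no _ with 1 ≤? v | v <? u | u ≤? N
        ...   | yes _ | yes _ | yes _ = off _ (λ eq → u≢z (cong Edge.v eq))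
        ...   | no _ | _ | _ = refl
        ...   | yes _ | no _ | _ = refl
        ...   | yes _ | yes _ | no _ = refl
        xs-off-a : ∀ {u v} → u ≢ a → v ≢ a → xs x u v ≡ 0ℚ
        xs-off-a {u} {v} u≢a v≢a with u <? v
        ... | yes _ with 1 ≤? u | u <? v | v ≤? N
        ...   | yes _ | yes _ | yes _ = off _ (λ eq → u≢a (cong Edge.u eq))
        ...   | no _ | _ | _ = refl
        ...   | yes _ | no _ | _ = refl
        ...   | yes _ | yes _ | no _ = refl
        xs-off-a {u} {v} u≢a v≢a | no _ with 1 ≤? v | v <? u | u ≤? N
        ...   | yes _ | yes _ | yes _ = off _ (λ eq → v≢a (cong Edge.u eq))
        ...   | no _ | _ | _ = refl
        ...   | yes _ | no _ | _ = refl
        ...   | yes _ | yes _ | no _ = refl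
        xs-pivot : xs x a z ≡ x pivot
        xs-pivot with a <? z
        ... | no a≮z = ⊥-elim (a≮z (Edge.u<v pivot))
        ... | yes _ with 1 ≤? a | a <? z | z ≤? N
        ...   | yes p | yes q | yes r = cong x (edge-≡ refl refl)
        ...   | no ≰ | _ | _ = ⊥-elim (≰ (proj₁ wa))
        ...   | yes _ | no ≮ | _ = ⊥-elim (≮ (Edge.u<v pivot))
        ...   | yes _ | yes _ | no ≰ = ⊥-elim (≰ ℕ.≤-refl)
        T-off : ∀ {u v} → Within n u → Within n v → T x u v o ≡ 0ℚ
        T-off wu wv = cong₂ _-_ (cong₂ _-_ (xs-off-z (≢z wu) (≢z wv)) (xs-off-z (≢z wu) o≢z)) (xs-off-z (≢z wv) o≢z)
        node : ∀ {u} → u ≢ a → Within k u → xs x u o - xs x u z ≡ 0ℚ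
        node u≢a wu = cong₂ _-_ (xs-off-z (≢z (within-n wu)) o≢z) (xs-off-a u≢a (≢-sym (≢z (within-n wa))))
        value : IsC4 k end a b c d → lhsI' k t end a b c d x ≡ 0ℚ - 0ℚ + two * 0ℚ + (0ℚ - x pivot + 0ℚ)
        value (_ , wb , wc , wd , (ab , ac , ad , _) , _) = cong₂ _+_ (cong₂ _+_ (cong₂ _-_
            (sum-upTo-zero k _ λ j j<k → sum-upTo-zero j _ λ i i<j →
              let wi = s≤s z≤n , ℕ.<-trans i<j j<k
                  wj = s≤s z≤n , j<k
                  i≢j = ℕ.<⇒≢ (s≤s i<j)
              in T-off (end-within wi wj i≢j) (end-within wj wi (≢-sym i≢j)))
            (sum-upTo-zero t _ λ i i<t → T-off (within-n (s≤s z≤n , ℕ.≤-trans i<t t≤k)) (within-upper (s≤s z≤n) i<t)))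
            (cong (two *_) (sum-upTo-zero (k ∸ t) _ λ i i<k∸t → xs-off-z
              (≢z (within-n (s≤s z≤n , ℕ.≤-trans (ℕ.≤-reflexive (sym (ℕ.+-suc t i)))
                  (ℕ.≤-trans (ℕ.+-monoʳ-≤ t i<k∸t) (ℕ.≤-reflexive (ℕ.m+[n∸m]≡n t≤k)))))) o≢z)))
            (cong₂ _+_ (cong₂ _-_ (xs-off-z (≢z (within-n wa)) o≢z) xs-pivot)
              (cong₂ _+_ (node (≢-sym ab) wb) (cong₂ _+_ (node (≢-sym ac) wc) (cong₂ _+_ (node (≢-sym ad) wd) refl))))

-- Linear functionals of cut vectors as quadratic functions of the set.

module QuadraticForm where

  open import Defs
  open LinearAlgebra
  open FacetCriterion using (sumE; nthEdge; edge-≡; edgeIndex; nthEdge-edgeIndex; edgeIndex-nthEdge; edgeCount)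
  open FiniteSums using (Distinct; Within)
  open import Data.Nat as ℕ using (ℕ; zero; suc; _≡ᵇ_)
  import Data.Nat.Properties as ℕ
  open import Data.Bool using (Bool; true; false; _xor_; _∨_; if_then_else_)
  import Data.Bool as Bool
  open import Data.List using (List; []; _∷_)
  open import Data.List.Relation.Unary.All as All using (All; []; _∷_)
  open import Data.List.Relation.Unary.AllPairs using ([]; _∷_)
  open import Data.Product using (_,_)
  open import Data.Sum using (_⊎_; inj₁; inj₂)
  open import Data.Empty using (⊥-elim)
  open import Data.Unit using (tt)
  open import Relation.Nullary using (yes; no)
  open import Data.Rational using (ℚ; 0ℚ; 1ℚ; _+_; _-_; _*_; -_)
  open import Data.Rational.Properties
  open import Data.Rational.Solver
  open +-*-Solver
  open import Relation.Binary.PropositionalEquality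
  open ≡-Reasoning

  mem : List ℕ → ℕ → Bool
  mem [] u = false
  mem (v ∷ L) u = (u ≡ᵇ v) ∨ mem L u

  ≡ᵇ-refl : ∀ u → (u ≡ᵇ u) ≡ true
  ≡ᵇ-refl zero = refl
  ≡ᵇ-refl (suc u) = ≡ᵇ-refl u

  ≢⇒≡ᵇ : ∀ {u v} → u ≢ v → (u ≡ᵇ v) ≡ false
  ≢⇒≡ᵇ {u} {v} u≢v with u ≡ᵇ v in eq
  ... | false = refl
  ... | true = ⊥-elim (u≢v (ℕ.≡ᵇ⇒≡ u v (subst Bool.T (sym eq) tt)))

  mem-∉ : ∀ {L u} → All (u ≢_) L → mem L u ≡ false
  mem-∉ [] = refl
  mem-∉ (u≢v ∷ u∉L) = cong₂ _∨_ (≢⇒≡ᵇ u≢v) (mem-∉ u∉L)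

  [_≈_] : ℕ → ℕ → ℚ
  [ u ≈ x ] = if u ≡ᵇ x then 1ℚ else 0ℚ

  ≈-refl : ∀ u → [ u ≈ u ] ≡ 1ℚ
  ≈-refl u = cong (if_then 1ℚ else 0ℚ) (≡ᵇ-refl u)

  ≈-≢ : ∀ {u v} → u ≢ v → [ u ≈ v ] ≡ 0ℚ
  ≈-≢ u≢v = cong (if_then 1ℚ else 0ℚ) (≢⇒≡ᵇ u≢v)

  sumL-cong : ∀ L {f g : ℕ → ℚ} → (∀ u → f u ≡ g u) → sumL L f ≡ sumL L g
  sumL-cong [] eq = refl
  sumL-cong (u ∷ L) eq = cong₂ _+_ (eq u) (sumL-cong L eq)

  indicator : ∀ {L} x → Distinct L → (if mem L x then 1ℚ else 0ℚ) ≡ sumL L (λ u → [ x ≈ u ])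
  indicator x [] = refl
  indicator {u ∷ L} x (u∉L ∷ distinct) with x ≡ᵇ u in eq
  ... | false = trans (indicator x distinct) (sym (+-identityˡ _))
  ... | true with refl ← ℕ.≡ᵇ⇒≡ x u (subst Bool.T (sym eq) tt) =
    cong (1ℚ +_) (trans (sym (cong (if_then 1ℚ else 0ℚ) (mem-∉ u∉L))) (indicator x distinct))

  pairwise : (ℕ → ℕ → ℚ) → List ℕ → ℚ
  pairwise g [] = 0ℚ
  pairwise g (u ∷ L) = sumL L (g u) + pairwise g L

  -- The quadratic form with linear coefficients q and pair coefficients g, evaluated at the
  -- indicator of L.
  quadratic : (ℕ → ℚ) → (ℕ → ℕ → ℚ) → List ℕ → ℚ
  quadratic q g L = sumL L q + pairwise g L

  -- The cut vector of {w}, with exclusive or written as x + y - 2xy for the indicators x, y of the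
  -- ends.
  singleton : ∀ {N} → ℕ → Edge N → ℚ
  singleton w e = [ Edge.u e ≈ w ] + [ Edge.v e ≈ w ] - two * ([ Edge.u e ≈ w ] * [ Edge.v e ≈ w ])

  -- The correction in passing from {w} and {v} to {w, v}: for distinct w and v it is -2 at the edge
  -- wv and 0 elsewhere.
  interaction : ∀ {N} → ℕ → ℕ → Edge N → ℚ
  interaction w v e = - two * ([ Edge.u e ≈ w ] * [ Edge.v e ≈ v ] + [ Edge.v e ≈ w ] * [ Edge.u e ≈ v ])

  -- The indicators of the ends are sums over L, since L has no repetitions, and expanding x + y -
  -- 2xy over L gives the linear and pair terms.
  δ-quadratic : ∀ {N} {L} → Distinct L → (e : Edge N) →
    δ (mem L) e ≡ quadratic (λ w → singleton w e) (λ w v → interaction w v e) L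
  δ-quadratic {N} {L} distinct e@(edge x y _ _ _) = begin
    (if mem L x xor mem L y then 1ℚ else 0ℚ) ≡⟨ xor-table (mem L x) (mem L y) ⟩
    i x + i y - two * (i x * i y)
      ≡⟨ cong₂ (λ p q → p + q - two * (p * q)) (indicator x distinct) (indicator y distinct) ⟩
    s L x + s L y - two * (s L x * s L y) ≡⟨ expand L ⟩
    quadratic (λ w → singleton w e) (λ w v → interaction w v e) L ∎
    where
    i : ℕ → ℚ
    i u = if mem L u then 1ℚ else 0ℚ
    s : List ℕ → ℕ → ℚ
    s L u = sumL L (λ w → [ u ≈ w ])
    xor-table : ∀ b b′ → (if b xor b′ then 1ℚ else 0ℚ) ≡
      (if b then 1ℚ else 0ℚ) + (if b′ then 1ℚ else 0ℚ) - two * ((if b then 1ℚ else 0ℚ) * (if b′ then 1ℚ else 0ℚ))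
    xor-table false false = refl
    xor-table false true = refl
    xor-table true false = refl
    xor-table true true = refl
    interactions : ∀ w L → sumL L (λ v → interaction w v e) ≡ - two * ([ x ≈ w ] * s L y + [ y ≈ w ] * s L x)
    interactions w [] = solve 2 (λ p q → con 0ℚ := :- con two :* (p :* con 0ℚ :+ q :* con 0ℚ)) refl [ x ≈ w ] [ y ≈ w ]
    interactions w (v ∷ L) = trans (cong (interaction w v e +_) (interactions w L))
      (solve 6 (λ xw yw xv yv sx sy →
        :- con two :* (xw :* yv :+ yw :* xv) :+ :- con two :* (xw :* sy :+ yw :* sx)
        := :- con two :* (xw :* (yv :+ sy) :+ yw :* (xv :+ sx))) refl
        [ x ≈ w ] [ y ≈ w ] [ x ≈ v ] [ y ≈ v ] (s L x) (s L y))
    expand : ∀ L → s L x + s L y - two * (s L x * s L y) ≡ quadratic (λ w → singleton w e) (λ w v → interaction w v e) L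
    expand [] = refl
    expand (w ∷ L) = begin
      [ x ≈ w ] + s L x + ([ y ≈ w ] + s L y) - two * (([ x ≈ w ] + s L x) * ([ y ≈ w ] + s L y))
        ≡⟨ solve 4 (λ xw yw sx sy →
             xw :+ sx :+ (yw :+ sy) :- con two :* ((xw :+ sx) :* (yw :+ sy))
             := (xw :+ yw :- con two :* (xw :* yw)) :+ (sx :+ sy :- con two :* (sx :* sy))
                :+ :- con two :* (xw :* sy :+ yw :* sx)) refl [ x ≈ w ] [ y ≈ w ] (s L x) (s L y) ⟩
      singleton w e + (s L x + s L y - two * (s L x * s L y)) + - two * ([ x ≈ w ] * s L y + [ y ≈ w ] * s L x)
        ≡⟨ cong₂ (λ p r → singleton w e + p + r) (expand L) (sym (interactions w L)) ⟩
      singleton w e + (sumL L (λ w → singleton w e) + pairwise (λ w v → interaction w v e) L) + sumL L (λ v → interaction w v e)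
        ≡⟨ solve 4 (λ a b c d → a :+ (b :+ c) :+ d := a :+ b :+ (d :+ c)) refl (singleton w e) _ _ _ ⟩
      quadratic (λ w → singleton w e) (λ w v → interaction w v e) (w ∷ L) ∎

  module Functional {N} (α : Edge N → ℚ) where

    pair : (Edge N → ℚ) → ℚ
    pair f = sumE (λ e → α e * f e)

    -- The value of α on the cut of {w}. The pair coefficients `g` recover the entries of α up to
    -- the factor -2, by `g-edge`.
    q : ℕ → ℚ
    q w = pair (singleton w)

    g : ℕ → ℕ → ℚ
    g w v = pair (interaction w v)

    pair-+ : ∀ f h → pair (λ e → f e + h e) ≡ pair f + pair h
    pair-+ f h = trans (sum-cong {edgeCount N} (λ i → *-distribˡ-+ (α (nthEdge i)) (f (nthEdge i)) (h (nthEdge i))))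
      (sum-+ {edgeCount N} (λ i → α (nthEdge i) * f (nthEdge i)) (λ i → α (nthEdge i) * h (nthEdge i)))

    pair-0 : pair (λ _ → 0ℚ) ≡ 0ℚ
    pair-0 = sum-zero {edgeCount N} (λ i → *-zeroʳ (α (nthEdge i)))

    pair-sumL : ∀ L (f : ℕ → Edge N → ℚ) → pair (λ e → sumL L (λ w → f w e)) ≡ sumL L (λ w → pair (f w))
    pair-sumL [] f = pair-0
    pair-sumL (w ∷ L) f = trans (pair-+ (f w) (λ e → sumL L (λ w → f w e))) (cong (pair (f w) +_) (pair-sumL L f))

    pair-pairwise : ∀ L (f : ℕ → ℕ → Edge N → ℚ) →
      pair (λ e → pairwise (λ w v → f w v e) L) ≡ pairwise (λ w v → pair (f w v)) L
    pair-pairwise [] f = pair-0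
    pair-pairwise (w ∷ L) f = trans (pair-+ (λ e → sumL L (λ v → f w v e)) (λ e → pairwise (λ w v → f w v e) L))
      (cong₂ _+_ (pair-sumL L (f w)) (pair-pairwise L f))

    pair-δ : ∀ {L} → Distinct L → pair (δ (mem L)) ≡ quadratic q g L
    pair-δ {L} distinct = begin
      pair (δ (mem L)) ≡⟨ sum-cong {edgeCount N} (λ i → cong (α (nthEdge {N} i) *_) (δ-quadratic distinct (nthEdge {N} i))) ⟩
      pair (λ e → quadratic (λ w → singleton w e) (λ w v → interaction w v e) L)
        ≡⟨ pair-+ (λ e → sumL L (λ w → singleton w e)) (λ e → pairwise (λ w v → interaction w v e) L) ⟩
      pair (λ e → sumL L (λ w → singleton w e)) + pair (λ e → pairwise (λ w v → interaction w v e) L)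
        ≡⟨ cong₂ _+_ (pair-sumL L singleton) (pair-pairwise L interaction) ⟩
      quadratic q g L ∎

    g-sym : ∀ w v → g w v ≡ g v w
    g-sym w v = sum-cong {edgeCount N} (λ i → cong (α (nthEdge {N} i) *_) (flip (nthEdge {N} i)))
      where
      flip : ∀ (e : Edge N) → interaction w v e ≡ interaction v w e
      flip (edge x y _ _ _) = solve 4 (λ xw yv yw xv →
        :- con two :* (xw :* yv :+ yw :* xv) := :- con two :* (xv :* yw :+ yv :* xw)) refl [ x ≈ w ] [ y ≈ v ] [ y ≈ w ] [ x ≈ v ]

    pair-single : ∀ (e : Edge N) f → (∀ e′ → e′ ≢ e → α e′ * f e′ ≡ 0ℚ) → pair f ≡ α e * f e
    pair-single e f off = trans
      (sum-single {edgeCount N} (edgeIndex e) (λ i i≢ → off (nthEdge i) (λ eq → i≢ (trans (sym (edgeIndex-nthEdge {N} i)) (cong edgeIndex eq)))))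
      (cong (λ e → α e * f e) (nthEdge-edgeIndex e))

    g-edge : ∀ (e : Edge N) → g (Edge.u e) (Edge.v e) ≡ α e * - two
    g-edge e@(edge x y _ x<y _) = trans (pair-single e (interaction x y) off) (cong (α e *_) here)
      where
      here : interaction x y e ≡ - two
      here = trans (cong₂ (λ p r → - two * (p + r)) (cong₂ _*_ (≈-refl x) (≈-refl y))
        (cong₂ _*_ (≈-≢ (λ y≡x → ℕ.<⇒≢ x<y (sym y≡x))) (≈-≢ (ℕ.<⇒≢ x<y)))) refl
      off : ∀ e′ → e′ ≢ e → α e′ * interaction x y e′ ≡ 0ℚ
      off e′@(edge x′ y′ _ x′<y′ _) e′≢e = trans (cong (α e′ *_) zero-here) (*-zeroʳ (α e′))
        where
        first : [ x′ ≈ x ] * [ y′ ≈ y ] ≡ 0ℚ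
        first with x′ ℕ.≟ x | y′ ℕ.≟ y
        ... | yes x′≡x | yes y′≡y = ⊥-elim (e′≢e (edge-≡ x′≡x y′≡y))
        ... | no x′≢x | _ = trans (cong (_* [ y′ ≈ y ]) (≈-≢ x′≢x)) (*-zeroˡ [ y′ ≈ y ])
        ... | yes _ | no y′≢y = trans (cong ([ x′ ≈ x ] *_) (≈-≢ y′≢y)) (*-zeroʳ [ x′ ≈ x ])
        second : [ y′ ≈ x ] * [ x′ ≈ y ] ≡ 0ℚ
        second with y′ ℕ.≟ x | x′ ℕ.≟ y
        ... | yes refl | yes refl = ⊥-elim (ℕ.<-asym x<y x′<y′)
        ... | no y′≢x | _ = trans (cong (_* [ x′ ≈ y ]) (≈-≢ y′≢x)) (*-zeroˡ [ x′ ≈ y ])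
        ... | yes _ | no x′≢y = trans (cong ([ y′ ≈ x ] *_) (≈-≢ x′≢y)) (*-zeroʳ [ y′ ≈ x ])
        zero-here : interaction x y e′ ≡ 0ℚ
        zero-here = cong₂ (λ p r → - two * (p + r)) first second

    -- The pair coefficients kill α on all edges avoiding o. Then the edge wo is the only one at w
    -- on which α can be nonzero, and q w is its entry. Nothing is asked at o, which lies in no set
    -- under consideration.
    vanishes : ∀ o → (∀ {u} → Within N u → u ≢ o → q u ≡ 0ℚ) →
      (∀ {u v} → Within N u → Within N v → u ≢ o → v ≢ o → u ≢ v → g u v ≡ 0ℚ) → ∀ e → α e ≡ 0ℚ
    vanishes o q≡0 g≡0 = all
      where
      inner : ∀ e → Edge.u e ≢ o → Edge.v e ≢ o → α e ≡ 0ℚ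
      inner e@(edge x y 1≤x x<y y≤N) x≢o y≢o = *-cancel-0 { - two} (λ ()) (trans (*-comm (- two) (α e)) (trans (sym (g-edge e))
        (g≡0 (1≤x , ℕ.≤-trans (ℕ.<⇒≤ x<y) y≤N) (ℕ.≤-trans 1≤x (ℕ.<⇒≤ x<y) , y≤N) x≢o y≢o (ℕ.<⇒≢ x<y))))
      outer : ∀ e w → Within N w → w ≢ o → singleton w e ≡ 1ℚ →
        (∀ e′ → (Edge.u e′ ≡ o ⊎ Edge.v e′ ≡ o) → e′ ≢ e → singleton w e′ ≡ 0ℚ) → α e ≡ 0ℚ
      outer e w ww w≢o here away = begin
        α e ≡⟨ *-identityʳ (α e) ⟨
        α e * 1ℚ ≡⟨ cong (α e *_) here ⟨
        α e * singleton w e ≡⟨ pair-single e (singleton w) off ⟨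
        q w ≡⟨ q≡0 ww w≢o ⟩
        0ℚ ∎
        where
        off : ∀ e′ → e′ ≢ e → α e′ * singleton w e′ ≡ 0ℚ
        off e′ e′≢e with Edge.u e′ ℕ.≟ o | Edge.v e′ ℕ.≟ o
        ... | yes u≡o | _ = trans (cong (α e′ *_) (away e′ (inj₁ u≡o) e′≢e)) (*-zeroʳ (α e′))
        ... | no _ | yes v≡o = trans (cong (α e′ *_) (away e′ (inj₂ v≡o) e′≢e)) (*-zeroʳ (α e′))
        ... | no u≢o | no v≢o = trans (cong (_* singleton w e′) (inner e′ u≢o v≢o)) (*-zeroˡ (singleton w e′))
      singleton-off : ∀ {w} (e : Edge N) → Edge.u e ≢ w → Edge.v e ≢ w → singleton w e ≡ 0ℚ
      singleton-off e u≢w v≢w = cong₂ (λ p r → p + r - two * (p * r)) (≈-≢ u≢w) (≈-≢ v≢w)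
      all : ∀ e → α e ≡ 0ℚ
      all e@(edge x y 1≤x x<y y≤N) with x ℕ.≟ o | y ℕ.≟ o
      ... | no x≢o | no y≢o = inner e x≢o y≢o
      ... | yes refl | _ = outer e y (ℕ.≤-trans 1≤x (ℕ.<⇒≤ x<y) , y≤N) (λ eq → ℕ.<⇒≢ x<y (sym eq))
            (cong₂ (λ p r → p + r - two * (p * r)) (≈-≢ (ℕ.<⇒≢ x<y)) (≈-refl y))
            λ where
              e′ (inj₁ refl) e′≢e → singleton-off e′ (ℕ.<⇒≢ x<y) (λ v≡y → e′≢e (edge-≡ refl v≡y))
              e′ (inj₂ refl) e′≢e → singleton-off e′ (ℕ.<⇒≢ (ℕ.<-trans (Edge.u<v e′) x<y)) (ℕ.<⇒≢ x<y)
      ... | no x≢o | yes refl = outer e x (1≤x , ℕ.≤-trans (ℕ.<⇒≤ x<y) y≤N) x≢o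
            (cong₂ (λ p r → p + r - two * (p * r)) (≈-refl x) (≈-≢ (λ eq → ℕ.<⇒≢ x<y (sym eq))))
            λ where
              e′ (inj₁ refl) e′≢e → singleton-off e′ (λ eq → x≢o (sym eq)) (λ eq → ℕ.<⇒≢ (ℕ.<-trans x<y (Edge.u<v e′)) (sym eq))
              e′ (inj₂ refl) e′≢e → singleton-off e′ (λ u≡x → e′≢e (edge-≡ u≡x refl)) (λ eq → x≢o (sym eq))

-- Roots assembled from whole components and single nodes.

module Roots where

  open import Defs
  open FiniteSums
  open CutCount renaming (full to fullCount)
  open LhsValue
  open QuadraticForm
  open FacetCriterion using (sumE)
  open import Data.Nat as ℕ using (ℕ; _≡ᵇ_; _≟_; _≤?_) renaming (_+_ to _+ℕ_; _*_ to _*ℕ_; _≤_ to _≤ℕ_)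
  import Data.Nat.Properties as ℕ
  open import Data.Bool using (Bool; true; false; _xor_; _∧_; _∨_; not; if_then_else_)
  open import Data.Bool.Properties using (∨-identityʳ; ∨-zeroʳ; ∨-assoc; ∧-comm)
  open import Data.List using (List; []; _∷_; _++_; map)
  open import Data.List.Relation.Unary.All as All using (All; []; _∷_)
  open import Data.List.Relation.Unary.All.Properties using () renaming (++⁺ to All-++⁺)
  open import Data.List.Relation.Unary.AllPairs using (AllPairs; []; _∷_)
  open import Data.List.Relation.Unary.AllPairs.Properties using () renaming (++⁺ to AllPairs-++⁺)
  open import Data.Product using (_×_; _,_; proj₁; proj₂; ∃)
  open import Data.Sum using (inj₁; inj₂)
  open import Data.Empty using (⊥-elim)
  open import Relation.Nullary using (yes; no; ⌊_⌋)
  open import Data.Rational using (ℚ; 0ℚ; _+_; _*_)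
  open import Data.Rational.Properties using (+-identityˡ; +-identityʳ; +-assoc)
  open import Data.Rational.Solver
  open +-*-Solver
  open import Relation.Binary.PropositionalEquality

  mem-++ : ∀ L L′ u → mem (L ++ L′) u ≡ mem L u ∨ mem L′ u
  mem-++ [] L′ u = refl
  mem-++ (v ∷ L) L′ u = trans (cong ((u ≡ᵇ v) ∨_) (mem-++ L L′ u)) (sym (∨-assoc (u ≡ᵇ v) _ _))

  mem-members : ∀ L → All (λ u → mem L u ≡ true) L
  mem-members [] = []
  mem-members (u ∷ L) = cong (_∨ mem L u) (≡ᵇ-refl u)
    ∷ All.map (λ {v} hit → trans (cong ((v ≡ᵇ u) ∨_) hit) (∨-zeroʳ (v ≡ᵇ u))) (mem-members L)

  infix 4 _==_
  _==_ : Bool → Bool → Bool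
  b == b′ = not (b xor b′)

  sumL-++ : ∀ L L′ (f : ℕ → ℚ) → sumL (L ++ L′) f ≡ sumL L f + sumL L′ f
  sumL-++ [] L′ f = sym (+-identityˡ _)
  sumL-++ (u ∷ L) L′ f = trans (cong (f u +_) (sumL-++ L L′ f)) (sym (+-assoc (f u) _ _))

  sumL-+ : ∀ L (f f′ : ℕ → ℚ) → sumL L (λ u → f u + f′ u) ≡ sumL L f + sumL L f′
  sumL-+ [] f f′ = refl
  sumL-+ (u ∷ L) f f′ = trans (cong (f u + f′ u +_) (sumL-+ L f f′))
    (solve 4 (λ a b c d → a :+ b :+ (c :+ d) := a :+ c :+ (b :+ d)) refl (f u) (f′ u) (sumL L f) (sumL L f′))

  sumL-zero : ∀ L → sumL L (λ _ → 0ℚ) ≡ 0ℚ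
  sumL-zero [] = refl
  sumL-zero (_ ∷ L) = trans (+-identityˡ _) (sumL-zero L)

  cross : (ℕ → ℕ → ℚ) → List ℕ → List ℕ → ℚ
  cross g L L′ = sumL L (λ u → sumL L′ (g u))

  cross-++ : ∀ g K L L′ → cross g K (L ++ L′) ≡ cross g K L + cross g K L′
  cross-++ g K L L′ = trans (sumL-cong K (λ u → sumL-++ L L′ (g u))) (sumL-+ K (λ u → sumL L (g u)) (λ u → sumL L′ (g u)))

  quadratic-++ : ∀ q g L L′ → quadratic q g (L ++ L′) ≡ quadratic q g L + (cross g L L′ + quadratic q g L′)
  quadratic-++ q g [] L′ = solve 1 (λ x → x := con 0ℚ :+ con 0ℚ :+ (con 0ℚ :+ x)) refl (quadratic q g L′)
  quadratic-++ q g (u ∷ L) L′ = begin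
    q u + sumL (L ++ L′) q + (sumL (L ++ L′) (g u) + pairwise g (L ++ L′))
      ≡⟨ cong (λ y → q u + sumL (L ++ L′) q + (y + pairwise g (L ++ L′))) (sumL-++ L L′ (g u)) ⟩
    q u + sumL (L ++ L′) q + (sumL L (g u) + sumL L′ (g u) + pairwise g (L ++ L′))
      ≡⟨ solve 5 (λ a b c d e → a :+ b :+ (c :+ d :+ e) := a :+ c :+ d :+ (b :+ e)) refl
           (q u) (sumL (L ++ L′) q) (sumL L (g u)) (sumL L′ (g u)) (pairwise g (L ++ L′)) ⟩
    q u + sumL L (g u) + sumL L′ (g u) + quadratic q g (L ++ L′)
      ≡⟨ cong (q u + sumL L (g u) + sumL L′ (g u) +_) (quadratic-++ q g L L′) ⟩
    q u + sumL L (g u) + sumL L′ (g u) + (quadratic q g L + (cross g L L′ + quadratic q g L′))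
      ≡⟨ solve 7 (λ qu gL gL′ sL pL x y → qu :+ gL :+ gL′ :+ (sL :+ pL :+ (x :+ y))
                   := qu :+ sL :+ (gL :+ pL) :+ ((gL′ :+ x) :+ y)) refl
           (q u) (sumL L (g u)) (sumL L′ (g u)) (sumL L q) (pairwise g L) (cross g L L′) (quadratic q g L′) ⟩
    quadratic q g (u ∷ L) + (cross g (u ∷ L) L′ + quadratic q g L′) ∎
    where open ≡-Reasoning

  -- Components not met by S contribute nothing. `pairs` orders indices by size and `pairsOver` by
  -- position in I; comparing the symmetric squares makes the order irrelevant.
  count-support : ∀ k t end S {I} → Distinct I → All (Within k) I →
    (∀ i → Within k i → All (_≢ i) I → isFull k t end S i ≡ false × (∀ j → Within k j → i ≢ j → S (end i j) ≡ false)) →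
    sum1 k (fullCount k t end S) ≡ sumOver I (fullCount k t end S) × pairs k (link k t end S) ≡ pairsOver I (link k t end S)
  count-support k t end S {I} distinct within off = fulls ,
    ℕ.*-cancelˡ-≡ _ _ 2 (ℕ.+-cancelˡ-≡ (sumOver I F) _ _ (begin
      sumOver I F +ℕ 2 *ℕ pairs k (link k t end S) ≡⟨ cong (_+ℕ 2 *ℕ pairs k (link k t end S)) fulls ⟨
      sum1 k F +ℕ 2 *ℕ pairs k (link k t end S) ≡⟨ square-H k t end S ⟨
      square k h ≡⟨ square-support k h distinct within offˡ (λ i j wi wj j∉I → trans (H-sym k t end S i j) (offˡ j i wj wi j∉I)) ⟩
      sumOver I (λ i → sumOver I (h i)) ≡⟨ squareOver-pairsOver I h (H-sym k t end S) ⟩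
      sumOver I (λ i → h i i) +ℕ 2 *ℕ pairsOver I h
        ≡⟨ cong₂ (λ x y → x +ℕ 2 *ℕ y) (sumOver-cong (All.universal (H-diag k t end S) I)) (links distinct) ⟩
      sumOver I F +ℕ 2 *ℕ pairsOver I (link k t end S) ∎))
    where
    open ≡-Reasoning
    F = fullCount k t end S
    h = H k t end S
    fulls : sum1 k F ≡ sumOver I F
    fulls = sum1-support k F distinct within (λ i wi i∉I → cong ι (proj₁ (off i wi i∉I)))
    offˡ : ∀ i j → Within k i → Within k j → All (_≢ i) I → h i j ≡ 0
    offˡ i j wi wj i∉I with i ≟ j
    ... | yes refl = trans (H-diag k t end S i) (cong ι (proj₁ (off i wi i∉I)))
    ... | no i≢j = trans (H-off k t end S i≢j) (cong (λ b → ι (b ∧ S (end j i))) (proj₂ (off i wi i∉I) j wj i≢j))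
    links : ∀ {L} → Distinct L → pairsOver L h ≡ pairsOver L (link k t end S)
    links [] = refl
    links (i∉L ∷ distinct) = cong₂ _+ℕ_ (sumOver-cong (All.map (H-off k t end S) i∉L)) (links distinct)

  -- full i stands for V_i, and one i b for a single node of a two-node V_i:
  -- i if b = false, i + k if b = true.
  data Part : Set where
    full : ℕ → Part
    one : ℕ → Bool → Part

  index : Part → ℕ
  index (full i) = i
  index (one i _) = i

  isFullPart : Part → Bool
  isFullPart (full _) = true
  isFullPart (one _ _) = false

  -- has (full i) true is junk for i > t, where V_i has no second node.
  has : Part → Bool → Bool
  has (full _) _ = true
  has (one _ b) b′ = b′ == b

  sumParts : List Part → (Part → ℚ) → ℚ
  sumParts [] f = 0ℚ
  sumParts (p ∷ ps) f = f p + sumParts ps f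

  pairParts : (Part → Part → ℚ) → List Part → ℚ
  pairParts f [] = 0ℚ
  pairParts f (p ∷ ps) = sumParts ps (f p) + pairParts f ps

  countParts : List Part → (Part → ℕ) → ℕ
  countParts [] f = 0
  countParts (p ∷ ps) f = f p +ℕ countParts ps f

  countPairs : (Part → Part → ℕ) → List Part → ℕ
  countPairs f [] = 0
  countPairs f (p ∷ ps) = countParts ps (f p) +ℕ countPairs f ps

  module Parts (k t : ℕ) (t≤k : t ≤ℕ k) (end : ℕ → ℕ → ℕ) (valid : ValidEnds k t end) where

    node : ℕ → Bool → ℕ
    node i b = if b then i +ℕ k else i

    -- Existence of the node: i + k belongs to V only for i ≤ t.
    Node : ℕ → Bool → Set
    Node i b = b ≡ true → i ≤ℕ t

    upperEnd : ℕ → ℕ → Bool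
    upperEnd i j = ⌊ end i j ≟ i +ℕ k ⌋

    end-node : ∀ {i j} → Within k i → Within k j → i ≢ j → end i j ≡ node i (upperEnd i j) × Node i (upperEnd i j)
    end-node {i} {j} (1≤i , i≤k) (1≤j , j≤k) i≢j with end i j ≟ i +ℕ k | valid i j 1≤i i≤k 1≤j j≤k i≢j
    ... | yes eq | inj₁ eq′ = eq , λ _ → ⊥-elim (upper-distinct k t t≤k end valid (1≤i , i≤k) (1≤i , i≤k) (trans (sym eq′) eq))
    ... | yes eq | inj₂ (i≤t , _) = eq , λ _ → i≤t
    ... | no _ | inj₁ eq = eq , λ ()
    ... | no ≢ | inj₂ (_ , eq) = ⊥-elim (≢ eq)

    node-injective : ∀ {i j b b′} → Within k i → Within k j → node i b ≡ node j b′ → i ≡ j × b ≡ b′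
    node-injective {b = false} {false} wi wj eq = eq , refl
    node-injective {b = false} {true} wi wj eq = ⊥-elim (upper-distinct k t t≤k end valid wi wj eq)
    node-injective {b = true} {false} wi wj eq = ⊥-elim (upper-distinct k t t≤k end valid wj wi (sym eq))
    node-injective {i} {j} {true} {true} wi wj eq = ℕ.+-cancelʳ-≡ k i j eq , refl

    node-within : ∀ {i b} → Within k i → Node i b → Within (k +ℕ t) (node i b)
    node-within {b = false} wi _ = within-n k t t≤k end valid wi
    node-within {b = true} (1≤i , _) i≤t = within-upper k t t≤k end valid 1≤i (i≤t refl)

    nodes : Part → List ℕ
    nodes (full i) = if ⌊ i ≤? t ⌋ then i ∷ i +ℕ k ∷ [] else i ∷ []
    nodes (one i b) = node i b ∷ []

    Valid : Part → Set
    Valid (full i) = Within k i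
    Valid (one i b) = Within k i × i ≤ℕ t

    index-within : ∀ p → Valid p → Within k (index p)
    index-within (full i) wi = wi
    index-within (one i b) (wi , _) = wi

    nodes-form : ∀ p → Valid p → All (λ v → ∃ λ b → v ≡ node (index p) b × Node (index p) b) (nodes p)
    nodes-form (full i) wi with i ≤? t
    ... | yes i≤t = (false , refl , λ ()) ∷ (true , refl , λ _ → i≤t) ∷ []
    ... | no _ = (false , refl , λ ()) ∷ []
    nodes-form (one i b) (wi , i≤t) = (b , refl , λ _ → i≤t) ∷ []

    ==-table : ∀ {i} → Within k i → ∀ b b′ → (node i b ≡ᵇ node i b′) ≡ (b == b′)
    ==-table {i} wi false false = ≡ᵇ-refl i
    ==-table {i} wi true true = ≡ᵇ-refl (i +ℕ k)
    ==-table wi false true = ≢⇒≡ᵇ (upper-distinct k t t≤k end valid wi wi)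
    ==-table wi true false = ≢⇒≡ᵇ (λ eq → upper-distinct k t t≤k end valid wi wi (sym eq))

    mem-own : ∀ p → Valid p → ∀ b → Node (index p) b → mem (nodes p) (node (index p) b) ≡ has p b
    mem-own (one i b′) (wi , _) b _ = trans (∨-identityʳ _) (==-table wi b b′)
    mem-own (full i) wi b ok with i ≤? t
    mem-own (full i) wi false ok | yes _ = cong (_∨ ((i ≡ᵇ i +ℕ k) ∨ false)) (≡ᵇ-refl i)
    mem-own (full i) wi true ok | yes _ = trans (cong (λ x → (i +ℕ k ≡ᵇ i) ∨ (x ∨ false)) (≡ᵇ-refl (i +ℕ k))) (∨-zeroʳ _)
    mem-own (full i) wi false ok | no _ = cong (_∨ false) (≡ᵇ-refl i)
    mem-own (full i) wi true ok | no i≰t = ⊥-elim (i≰t (ok refl))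

    mem-other : ∀ p → Valid p → ∀ {i} → Within k i → index p ≢ i → ∀ b → mem (nodes p) (node i b) ≡ false
    mem-other p vp wi p≢i b = mem-∉ (All.map
      (λ where (b′ , refl , _) eq → p≢i (sym (proj₁ (node-injective {b = b} {b′} wi (index-within p vp) eq)))) (nodes-form p vp))

    allNodes : List Part → List ℕ
    allNodes [] = []
    allNodes (p ∷ ps) = nodes p ++ allNodes ps

    DistinctParts : List Part → Set
    DistinctParts = AllPairs (λ p p′ → index p ≢ index p′)

    mem-allNodes-other : ∀ {ps} → All Valid ps → ∀ {i} → Within k i → All (λ p → index p ≢ i) ps → ∀ b → mem (allNodes ps) (node i b) ≡ false
    mem-allNodes-other [] wi [] b = refl
    mem-allNodes-other {p ∷ ps} (vp ∷ vps) wi (p≢i ∷ ps≢i) b = trans (mem-++ (nodes p) _ _)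
      (cong₂ _∨_ (mem-other p vp wi p≢i b) (mem-allNodes-other vps wi ps≢i b))

    mem-allNodes-own : ∀ {ps} → All Valid ps → DistinctParts ps →
      All (λ p → ∀ b → Node (index p) b → mem (allNodes ps) (node (index p) b) ≡ has p b) ps
    mem-allNodes-own [] [] = []
    mem-allNodes-own {p ∷ ps} (vp ∷ vps) (p∉ps ∷ distinct) =
      (λ b ok → trans (mem-++ (nodes p) _ _) (trans (cong₂ _∨_ (mem-own p vp b ok)
          (mem-allNodes-other vps (index-within p vp) (All.map (λ ≢ eq → ≢ (sym eq)) p∉ps) b)) (∨-identityʳ _)))
      ∷ All.zipWith (λ {p′} ((p≢p′ , vp′) , own) b ok → trans (mem-++ (nodes p) _ _)
            (cong₂ _∨_ (mem-other p vp (index-within p′ vp′) p≢p′ b) (own b ok)))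
        (All.zip (p∉ps , vps) , mem-allNodes-own vps distinct)

    part-nodes-distinct : ∀ p → Valid p → Distinct (nodes p)
    part-nodes-distinct (one i b) _ = [] ∷ []
    part-nodes-distinct (full i) wi with i ≤? t
    ... | yes _ = (upper-distinct k t t≤k end valid wi wi ∷ []) ∷ [] ∷ []
    ... | no _ = [] ∷ []

    allNodes-form : ∀ {ps} → All Valid ps → ∀ {P : ℕ → Set} →
      All (λ p → ∀ b → Node (index p) b → P (node (index p) b)) ps → All P (allNodes ps)
    allNodes-form [] [] = []
    allNodes-form {p ∷ ps} (vp ∷ vps) (prf ∷ prfs) =
      All-++⁺ (All.map (λ where (b , refl , ok) → prf b ok) (nodes-form p vp)) (allNodes-form vps prfs)

    allNodes-distinct : ∀ {ps} → All Valid ps → DistinctParts ps → Distinct (allNodes ps)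
    allNodes-distinct [] [] = []
    allNodes-distinct {p ∷ ps} (vp ∷ vps) (p∉ps ∷ distinct) =
      AllPairs-++⁺ (part-nodes-distinct p vp) (allNodes-distinct vps distinct)
        (All.map (λ where
          (b , refl , _) → allNodes-form vps (All.zipWith (λ {p′} (p≢p′ , vp′) b′ _ eq → p≢p′ (proj₁ (node-injective {b = b} {b′} (index-within p vp) (index-within p′ vp′) eq)))
            (p∉ps , vps))) (nodes-form p vp))

    o z : ℕ
    o = k +ℕ t +ℕ 1
    z = k +ℕ t +ℕ 2

    support : Bool → List Part → List ℕ
    support true ps = z ∷ allNodes ps
    support false ps = allNodes ps

    adjacency : Part → Part → ℕ
    adjacency p p′ = ι (has p (upperEnd (index p) (index p′)) ∧ has p′ (upperEnd (index p′) (index p)))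

    module _ {ps : List Part} (vps : All Valid ps) (distinct : DistinctParts ps) (zb : Bool) where

      S : ℕ → Bool
      S = mem (support zb ps)

      allNodes-≢ : ∀ {u} → (∀ {v} → Within (k +ℕ t) v → v ≢ u) → All (u ≢_) (allNodes ps)
      allNodes-≢ ≢u = allNodes-form vps (All.map (λ {p} vp b ok eq → ≢u (node-within (index-within p vp) ok) (sym eq)) vps)

      S-o : S o ≡ false
      S-o = go zb
        where
        go : ∀ zb → mem (support zb ps) o ≡ false
        go true = mem-∉ (o≢z k t t≤k end valid ∷ allNodes-≢ (≢o k t t≤k end valid))
        go false = mem-∉ (allNodes-≢ (≢o k t t≤k end valid))

      S-z : S z ≡ zb
      S-z = go zb
        where
        go : ∀ zb → mem (support zb ps) z ≡ zb
        go true = cong (_∨ mem (allNodes ps) z) (≡ᵇ-refl z)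
        go false = mem-∉ (allNodes-≢ (≢z k t t≤k end valid))

      S-node : ∀ {u} → Within (k +ℕ t) u → S u ≡ mem (allNodes ps) u
      S-node {u} wu = go zb
        where
        go : ∀ zb → mem (support zb ps) u ≡ mem (allNodes ps) u
        go true = cong (_∨ mem (allNodes ps) u) (≢⇒≡ᵇ (≢z k t t≤k end valid wu))
        go false = refl

      support-distinct : Distinct (support zb ps)
      support-distinct = go zb
        where
        go : ∀ zb → Distinct (support zb ps)
        go true = allNodes-≢ (≢z k t t≤k end valid) ∷ allNodes-distinct vps distinct
        go false = allNodes-distinct vps distinct

      S-own : All (λ p → ∀ b → Node (index p) b → S (node (index p) b) ≡ has p b) ps
      S-own = All.zipWith (λ {p} (vp , own) b ok → trans (S-node (node-within (index-within p vp) ok)) (own b ok))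
        (vps , mem-allNodes-own vps distinct)

      S-other : ∀ {i} → Within k i → All (λ p → index p ≢ i) ps → ∀ b → Node i b → S (node i b) ≡ false
      S-other wi ps≢i b ok = trans (S-node (node-within wi ok)) (mem-allNodes-other vps wi ps≢i b)

      S-full : All (λ p → fullCount k t end S (index p) ≡ ι (isFullPart p)) ps
      S-full = All.zipWith (λ {p} (vp , own) → cong ι (value p vp own)) (vps , S-own)
        where
        value : ∀ p → Valid p → (∀ b → Node (index p) b → S (node (index p) b) ≡ has p b) → isFull k t end S (index p) ≡ isFullPart p
        value (full i) _ own with i ≤? t
        ... | yes i≤t = cong₂ _∧_ (own false λ ()) (own true λ _ → i≤t)
        ... | no _ = own false λ ()
        value (one i b) (_ , i≤t) own with i ≤? t
        ... | no i≰t = ⊥-elim (i≰t i≤t)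
        ... | yes _ = trans (cong₂ _∧_ (own false λ ()) (own true λ _ → i≤t)) (exclusive b)
          where
          exclusive : ∀ b → (false == b) ∧ (true == b) ≡ false
          exclusive true = refl
          exclusive false = refl

      indices-distinct : ∀ {ps} → DistinctParts ps → Distinct (map index ps)
      indices-distinct [] = []
      indices-distinct (p∉ps ∷ distinct) = go p∉ps ∷ indices-distinct distinct
        where
        go : ∀ {i ps} → All (λ p → i ≢ index p) ps → All (i ≢_) (map index ps)
        go [] = []
        go (≢ ∷ ≢s) = ≢ ∷ go ≢s

      indices-within : ∀ {ps} → All Valid ps → All (Within k) (map index ps)
      indices-within [] = []
      indices-within {p ∷ _} (vp ∷ vps) = index-within p vp ∷ indices-within vps

      from-indices : ∀ {i ps} → All (_≢ i) (map index ps) → All (λ p → index p ≢ i) ps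
      from-indices {ps = []} [] = []
      from-indices {ps = _ ∷ _} (≢ ∷ ≢s) = ≢ ∷ from-indices ≢s

      sumOver-parts : ∀ {ps f h} → All (λ p → f (index p) ≡ h p) ps → sumOver (map index ps) f ≡ countParts ps h
      sumOver-parts [] = refl
      sumOver-parts (eq ∷ eqs) = cong₂ _+ℕ_ eq (sumOver-parts eqs)

      links : ∀ {ps} → All Valid ps → DistinctParts ps → All (λ p → ∀ b → Node (index p) b → S (node (index p) b) ≡ has p b) ps →
        pairsOver (map index ps) (link k t end S) ≡ countPairs adjacency ps
      links [] [] [] = refl
      links {p ∷ ps} (vp ∷ vps) (p∉ps ∷ distinct) (own ∷ owns) = cong₂ _+ℕ_
        (sumOver-parts (All.zipWith (λ {p′} ((p≢p′ , vp′) , own′) →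
            let wp = index-within p vp
                wp′ = index-within p′ vp′
                end₁ , ok₁ = end-node wp wp′ p≢p′
                end₂ , ok₂ = end-node wp′ wp (≢-sym p≢p′)
            in cong₂ (λ x y → ι (x ∧ y)) (trans (cong S end₁) (own _ ok₁)) (trans (cong S end₂) (own′ _ ok₂)))
          (All.zip (p∉ps , vps) , owns)))
        (links vps distinct owns)

      -- Reduces M and e to sums over a short explicit list of parts, so that `IsRoot` can be
      -- settled by computation.
      counts : sum1 k (fullCount k t end S) ≡ countParts ps (λ p → ι (isFullPart p)) ×
               pairs k (link k t end S) ≡ countPairs adjacency ps
      counts = trans (proj₁ supported) (sumOver-parts S-full) , trans (proj₂ supported) (links vps distinct S-own)
        where
        off : ∀ i → Within k i → All (_≢ i) (map index ps) →
          isFull k t end S i ≡ false × (∀ j → Within k j → i ≢ j → S (end i j) ≡ false)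
        off i wi i∉ = notFull , λ j wj i≢j →
            let end₁ , ok = end-node wi wj i≢j in trans (cong S end₁) (S-other wi (from-indices i∉) _ ok)
          where
          notFull : isFull k t end S i ≡ false
          notFull with i ≤? t
          ... | yes _ = cong (_∧ S (i +ℕ k)) (S-other wi (from-indices i∉) false λ ())
          ... | no _ = S-other wi (from-indices i∉) false λ ()
        supported = count-support k t end S (indices-distinct distinct) (indices-within vps) off

    module Cycle {a b c d} (isC4 : IsC4 k end a b c d) where

      C : List ℕ
      C = a ∷ b ∷ c ∷ d ∷ []

      -- The nodes of C have index at most k, so a part contains one exactly when its index lies on
      -- C and it has the lower node.
      inCycle : Part → ℕ
      inCycle p = ι (mem C (index p) ∧ has p false)

      module _ {ps} (vps : All Valid ps) (distinct : DistinctParts ps) (zb : Bool) where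

        -- The function f vanishes off C and off the indices of the parts, so its sum over either
        -- list is its sum over 1, ..., k.
        cycle-count : ι (S vps distinct zb a) +ℕ ι (S vps distinct zb b) +ℕ ι (S vps distinct zb c) +ℕ ι (S vps distinct zb d)
          ≡ countParts ps inCycle
        cycle-count = begin
          ι (s a) +ℕ ι (s b) +ℕ ι (s c) +ℕ ι (s d) ≡⟨ assoc (ι (s a)) (ι (s b)) (ι (s c)) (ι (s d)) ⟩
          sumOver C (λ i → ι (s i)) ≡⟨ sumOver-cong (All.map (λ i∈C → cong (λ x → ι (x ∧ s _)) (sym i∈C)) (mem-members C)) ⟩
          sumOver C f ≡⟨ sum1-support k f (nodes-distinct k t end valid isC4) (nodes-within k t end valid isC4)
                           (λ j _ j∉C → cong (λ x → ι (x ∧ s j)) (mem-∉ (All.map (λ ≢ eq → ≢ (sym eq)) j∉C))) ⟨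
          sum1 k f ≡⟨ sum1-support k f (indices-distinct vps distinct zb distinct) (indices-within vps distinct zb vps)
                        (λ i wi i∉ → trans (cong (λ x → ι (mem C i ∧ x)) (S-other vps distinct zb wi (from-indices vps distinct zb i∉) false λ ()))
                                       (cong ι (∧-comm (mem C i) false))) ⟩
          sumOver (map index ps) f ≡⟨ sumOver-parts vps distinct zb (All.map (λ {p} own → cong (λ x → ι (mem C (index p) ∧ x)) (own false λ ())) (S-own vps distinct zb)) ⟩
          countParts ps inCycle ∎
          where
          open ≡-Reasoning
          open import Data.Nat.Tactic.RingSolver using (solve-∀)
          s = S vps distinct zb
          f : ℕ → ℕ
          f i = ι (mem C i ∧ s i)
          assoc : ∀ a b c d → a +ℕ b +ℕ c +ℕ d ≡ a +ℕ (b +ℕ (c +ℕ (d +ℕ 0)))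
          assoc = solve-∀

        -- The equation M - e + z (s - 2) = 1, free of subtraction.
        IsRoot : Set
        IsRoot = countParts ps (λ p → ι (isFullPart p)) +ℕ ι zb *ℕ countParts ps inCycle ≡ 1 +ℕ (countPairs adjacency ps +ℕ 2 *ℕ ι zb)

        root-lhs : IsRoot → lhsI' k t end a b c d (δ (S vps distinct zb)) ≡ two
        root-lhs isRoot = lhs-value k t t≤k end valid s (S-o vps distinct zb) isC4 {1} (trans
          (cong₂ _+ℕ_ (proj₁ (counts vps distinct zb)) (cong₂ _*ℕ_ (cong ι (S-z vps distinct zb)) cycle-count))
          (trans isRoot (cong₂ (λ x y → 1 +ℕ (x +ℕ 2 *ℕ ι y)) (sym (proj₂ (counts vps distinct zb))) (sym (S-z vps distinct zb)))))
          where
          s = S vps distinct zb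

      module Equations (α₀ : ℚ) (α : Edge (k +ℕ t +ℕ 2) → ℚ)
        (vanish : ∀ S → lhsI' k t end a b c d (δ S) ≡ two → α₀ + sumE (λ e → α e * δ S e) ≡ 0ℚ) where

        open Functional α

        qPart : Part → ℚ
        qPart p = quadratic q g (nodes p)

        xPart : Part → Part → ℚ
        xPart p p′ = cross g (nodes p) (nodes p′)

        zPart : Part → ℚ
        zPart p = sumL (nodes p) (g z)

        quadraticParts : List Part → ℚ
        quadraticParts ps = sumParts ps qPart + pairParts xPart ps

        zTerm : Bool → List Part → ℚ
        zTerm true ps = q z + sumParts ps zPart
        zTerm false ps = 0ℚ

        cross-allNodes : ∀ K ps → cross g K (allNodes ps) ≡ sumParts ps (λ p → cross g K (nodes p))
        cross-allNodes K [] = sumL-zero K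
        cross-allNodes K (p ∷ ps) = trans (cross-++ g K (nodes p) (allNodes ps)) (cong (cross g K (nodes p) +_) (cross-allNodes K ps))

        quadratic-allNodes : ∀ ps → quadratic q g (allNodes ps) ≡ quadraticParts ps
        quadratic-allNodes [] = refl
        quadratic-allNodes (p ∷ ps) = trans (quadratic-++ q g (nodes p) (allNodes ps))
          (trans (cong₂ (λ x y → qPart p + (x + y)) (cross-allNodes (nodes p) ps) (quadratic-allNodes ps))
            (solve 4 (λ a b c d → a :+ (b :+ (c :+ d)) := a :+ c :+ (b :+ d)) refl (qPart p) (sumParts ps (xPart p)) (sumParts ps qPart) (pairParts xPart ps)))

        sumL-allNodes : ∀ ps (f : ℕ → ℚ) → sumL (allNodes ps) f ≡ sumParts ps (λ p → sumL (nodes p) f)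
        sumL-allNodes [] f = refl
        sumL-allNodes (p ∷ ps) f = trans (sumL-++ (nodes p) (allNodes ps) f) (cong (sumL (nodes p) f +_) (sumL-allNodes ps f))

        quadratic-support : ∀ zb ps → quadratic q g (support zb ps) ≡ quadraticParts ps + zTerm zb ps
        quadratic-support false ps = trans (quadratic-allNodes ps) (sym (+-identityʳ _))
        quadratic-support true ps = trans
          (solve 4 (λ a b c d → a :+ b :+ (c :+ d) := (b :+ d) :+ (a :+ c)) refl (q z) (sumL (allNodes ps) q) (sumL (allNodes ps) (g z)) (pairwise g (allNodes ps)))
          (cong₂ (λ x y → x + (q z + y)) (quadratic-allNodes ps) (sumL-allNodes ps (g z)))

        -- Each root made of parts becomes one linear equation in the block coefficients `qPart`,
        -- `xPart`, `zPart` and in `q z`.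
        root-equation : ∀ {ps} (vps : All Valid ps) (distinct : DistinctParts ps) zb → IsRoot vps distinct zb →
          α₀ + (quadraticParts ps + zTerm zb ps) ≡ 0ℚ
        root-equation {ps} vps distinct zb isRoot = trans
          (cong (α₀ +_) (sym (trans (pair-δ (support-distinct vps distinct zb)) (quadratic-support zb ps))))
          (vanish (mem (support zb ps)) (root-lhs vps distinct zb isRoot))

-- Uniqueness of the equation satisfied by all roots.

module Core where

  open import Defs
  open FiniteSums
  open CutCount hiding (full)
  open LhsValue
  open QuadraticForm
  open Roots
  open FacetCriterion using (sumE)
  open import Data.Nat as ℕ using (ℕ; _≟_; _≤?_) renaming (_+_ to _+ℕ_; _*_ to _*ℕ_; _≤_ to _≤ℕ_; _<_ to _<ℕ_)
  import Data.Nat.Properties as ℕ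
  open import Data.Bool using (Bool; true; false; _∧_; not)
  open import Data.Bool.Properties using (∧-comm)
  open import Data.List using (List; []; _∷_; length; filter)
  open import Data.List.Relation.Unary.All as All using (All; []; _∷_)
  open import Data.List.Relation.Unary.All.Properties using (all-filter) renaming (filter⁺ to All-filter⁺)
  open import Data.List.Relation.Unary.AllPairs using ([]; _∷_)
  open import Data.List.Relation.Unary.AllPairs.Properties using () renaming (filter⁺ to AllPairs-filter⁺)
  open import Data.Product using (_×_; _,_; proj₁; proj₂; ∃; ∃₂)
  open import Data.Sum using (_⊎_; inj₁; inj₂)
  open import Data.Empty using (⊥-elim)
  open import Relation.Nullary using (¬_; yes; no)
  open import Data.Rational using (ℚ; 0ℚ; 1ℚ; _+_; _-_; _*_; -_)
  open import Data.Rational.Properties using (+-identityˡ; *-zeroˡ; *-zeroʳ)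
  open import Data.Rational.Solver
  open +-*-Solver
  open import Relation.Binary.PropositionalEquality

  infixl 6 _⊕_ _⊖_
  -- The deductions below share one pattern: the ring solver writes the target as a combination of
  -- known expressions, and `_⊕_` and `_⊖_` combine the proofs that these vanish.
  _⊕_ : ∀ {x y} → x ≡ 0ℚ → y ≡ 0ℚ → x + y ≡ 0ℚ
  refl ⊕ refl = refl

  _⊖_ : ∀ {x y} → x ≡ 0ℚ → y ≡ 0ℚ → x - y ≡ 0ℚ
  refl ⊖ refl = refl

  same-or-not : ∀ x y → x ≡ y ⊎ x ≡ not y
  same-or-not false false = inj₁ refl
  same-or-not false true = inj₂ refl
  same-or-not true false = inj₂ refl
  same-or-not true true = inj₁ refl

  not-not : ∀ {x y} → x ≡ y → x ≡ not (not y)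
  not-not {false} refl = refl
  not-not {true} refl = refl

  hit : ∀ {x y} → x ≡ y → (x == y) ≡ true
  hit {false} refl = refl
  hit {true} refl = refl

  miss : ∀ {x y} → x ≡ not y → (x == y) ≡ false
  miss {y = false} refl = refl
  miss {y = true} refl = refl

  cross-sym : ∀ (g : ℕ → ℕ → ℚ) → (∀ u v → g u v ≡ g v u) → ∀ K L → cross g K L ≡ cross g L K
  cross-sym g g-sym [] L = sym (sumL-zero L)
  cross-sym g g-sym (u ∷ K) L = trans (cong₂ _+_ (sumL-cong L (g-sym u)) (cross-sym g g-sym K L))
    (sym (sumL-+ L (λ v → g v u) (λ v → sumL K (g v))))

  module Uniqueness (k t : ℕ) (t≤k : t ≤ℕ k) (end : ℕ → ℕ → ℕ) (valid : ValidEnds k t end)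
    {a b c d : ℕ} (isC4 : IsC4 k end a b c d)
    (minDeg : MinDeg2 k t end) (condII : CondII k t end a b c d) (condIII : CondIII k t end a b c d)
    (α₀ : ℚ) (α : Edge (k +ℕ t +ℕ 2) → ℚ)
    (α-pivot : α (pivot k t t≤k end valid isC4) ≡ 0ℚ)
    (vanish : ∀ S → lhsI' k t end a b c d (δ S) ≡ two → α₀ + sumE (λ e → α e * δ S e) ≡ 0ℚ) where

    open Parts k t t≤k end valid
    open Cycle isC4
    open Equations α₀ α vanish
    open Functional α

    E : ℕ → ℕ → Bool
    E = upperEnd

    triple-distinct : ∀ {p p′ p″} → index p ≢ index p′ → index p ≢ index p″ → index p′ ≢ index p″ →
      DistinctParts (p ∷ p′ ∷ p″ ∷ [])
    triple-distinct ne ne′ ne″ = (ne ∷ ne′ ∷ []) ∷ (ne″ ∷ []) ∷ [] ∷ []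

    neighbour : ∀ {l b v} → Within k l → Node l b → Adj k end (node l b) v →
      ∃ λ i → Within k i × l ≢ i × E l i ≡ b × v ≡ end i l
    neighbour {l} {b} {v} wl ok (p , q , 1≤p , p<q , q≤k , which) = found which
      where
      wp = 1≤p , ℕ.≤-trans (ℕ.<⇒≤ p<q) q≤k
      wq = ℕ.≤-trans 1≤p (ℕ.<⇒≤ p<q) , q≤k
      found : (node l b ≡ end p q × v ≡ end q p) ⊎ (node l b ≡ end q p × v ≡ end p q) →
        ∃ λ i → Within k i × l ≢ i × E l i ≡ b × v ≡ end i l
      found (inj₁ (u≡ , v≡)) with refl , refl ← node-injective {b = b} {E p q} wl wp
          (trans u≡ (proj₁ (end-node wp wq (ℕ.<⇒≢ p<q)))) = q , wq , ℕ.<⇒≢ p<q , refl , v≡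
      found (inj₂ (u≡ , v≡)) with refl , refl ← node-injective {b = b} {E q p} wl wq
          (trans u≡ (proj₁ (end-node wq wp (≢-sym (ℕ.<⇒≢ p<q))))) = p , wp , ≢-sym (ℕ.<⇒≢ p<q) , refl , v≡

    -- Two components are joined by a single edge, so distinct neighbours of a node lie in distinct
    -- components.
    neighbours : ∀ {l} b → Within k l → l ≤ℕ t → ∃₂ λ i j →
      (Within k i × l ≢ i × E l i ≡ b) × (Within k j × l ≢ j × E l j ≡ b) × i ≢ j
    neighbours {l} b wl l≤t
      with v , w , v≢w , adj₁ , adj₂ ← minDeg (node l b) (proj₁ (node-within {b = b} wl (λ _ → l≤t))) (proj₂ (node-within {b = b} wl (λ _ → l≤t)))
      with i , wi , l≢i , Ei , v≡ ← neighbour {b = b} wl (λ _ → l≤t) adj₁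
      with j , wj , l≢j , Ej , w≡ ← neighbour {b = b} wl (λ _ → l≤t) adj₂ =
      i , j , (wi , l≢i , Ei) , (wj , l≢j , Ej) , λ where refl → v≢w (trans v≡ (sym w≡))

    another-neighbour : ∀ {l} b j → Within k l → l ≤ℕ t → ∃ λ i → (Within k i × l ≢ i × E l i ≡ b) × i ≢ j
    another-neighbour b j wl l≤t with i , i′ , hi , hi′ , i≢i′ ← neighbours b wl l≤t with i ≟ j
    ... | no i≢j = i , hi , i≢j
    ... | yes refl = i′ , hi′ , ≢-sym i≢i′

    eq-full : ∀ {i} → Within k i → α₀ + qPart (full i) ≡ 0ℚ
    eq-full {i} wi = trans
      (solve 2 (λ α q → α :+ q := α :+ (q :+ con 0ℚ :+ (con 0ℚ :+ con 0ℚ) :+ con 0ℚ)) refl α₀ (qPart (full i)))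
      (root-equation {full i ∷ []} (wi ∷ []) ([] ∷ []) false refl)

    -- The root V_i ∪ V_j, with M = 2 and e = 1, minus the roots V_i and V_j.
    eq-full-full : ∀ {i j} → Within k i → Within k j → i ≢ j → xPart (full i) (full j) - α₀ ≡ 0ℚ
    eq-full-full {i} {j} wi wj i≢j = trans
      (solve 4 (λ α p q x → x :- α := α :+ (p :+ (q :+ con 0ℚ) :+ ((x :+ con 0ℚ) :+ (con 0ℚ :+ con 0ℚ)) :+ con 0ℚ) :- (α :+ p) :- (α :+ q))
        refl α₀ (qPart (full i)) (qPart (full j)) (xPart (full i) (full j)))
      (root-equation {full i ∷ full j ∷ []} (wi ∷ wj ∷ []) ((i≢j ∷ []) ∷ [] ∷ []) false refl ⊖ eq-full wi ⊖ eq-full wj)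

    -- V_i with the node of V_j that e_ij misses still has M = 1 and e = 0.
    eq-full-one : ∀ {i j b} → Within k i → Within k j → j ≤ℕ t → j ≢ i → E j i ≡ not b →
      qPart (one j b) + xPart (full i) (one j b) ≡ 0ℚ
    eq-full-one {i} {j} {b} wi wj j≤t j≢i Eji = trans
      (solve 4 (λ α p q x → q :+ x := α :+ (p :+ (q :+ con 0ℚ) :+ ((x :+ con 0ℚ) :+ (con 0ℚ :+ con 0ℚ)) :+ con 0ℚ) :- (α :+ p))
        refl α₀ (qPart (full i)) (qPart (one j b)) (xPart (full i) (one j b)))
      (root-equation {full i ∷ one j b ∷ []} (wi ∷ (wj , j≤t) ∷ []) ((≢-sym j≢i ∷ []) ∷ [] ∷ []) false (isRoot (miss Eji)) ⊖ eq-full wi)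
      where
      isRoot : ∀ {x} → x ≡ false → 1 ≡ 1 +ℕ (ι x +ℕ 0 +ℕ (0 +ℕ 0) +ℕ 0)
      isRoot refl = refl

    -- V_i ∪ V_j ∪ {v} and V_i ∪ {v} are both roots for v isolated from V_i and V_j.
    q-isolated : ∀ {i j l b} → Within k i → Within k j → Within k l → l ≤ℕ t → l ≢ i → l ≢ j → i ≢ j →
      E l i ≡ not b → E l j ≡ not b → qPart (one l b) ≡ 0ℚ
    q-isolated {i} {j} {l} {b} wi wj wl l≤t l≢i l≢j i≢j Eli Elj = trans
      (solve 7 (λ α p q r x y z →
          r := (q :+ con 0ℚ :- q) :+ (((((α :+ p) :+ (α :+ q)) :+ (x :- α)) :+ (r :+ y)) :+ (r :+ z))
               :- (α :+ (p :+ (q :+ (r :+ con 0ℚ)) :+ ((x :+ (y :+ con 0ℚ)) :+ ((z :+ con 0ℚ) :+ (con 0ℚ :+ con 0ℚ))) :+ con 0ℚ)))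
        refl α₀ (qPart (full i)) (qPart (full j)) (qPart (one l b))
        (xPart (full i) (full j)) (xPart (full i) (one l b)) (xPart (full j) (one l b)))
      (cancel (qPart (full j)) ⊕ (eq-full wi ⊕ eq-full wj ⊕ eq-full-full wi wj i≢j
          ⊕ eq-full-one wi wl l≤t l≢i Eli ⊕ eq-full-one wj wl l≤t l≢j Elj)
        ⊖ root-equation {full i ∷ full j ∷ one l b ∷ []} (wi ∷ wj ∷ (wl , l≤t) ∷ [])
            (triple-distinct {full i} {full j} {one l b} i≢j (≢-sym l≢i) (≢-sym l≢j)) false (isRoot (miss Eli) (miss Elj)))
      where
      cancel : ∀ q → q + 0ℚ - q ≡ 0ℚ
      cancel q = solve 1 (λ q → q :+ con 0ℚ :- q := con 0ℚ) refl q
      isRoot : ∀ {x y} → x ≡ false → y ≡ false →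
        2 ≡ 1 +ℕ (1 +ℕ (ι x +ℕ 0) +ℕ (ι y +ℕ 0 +ℕ (0 +ℕ 0)) +ℕ 0)
      isRoot refl refl = refl

    -- The other node of V_l has neighbours in two components; the edges to these miss the node in
    -- question, as `q-isolated` requires.
    q-one : ∀ {l b} → Within k l → l ≤ℕ t → qPart (one l b) ≡ 0ℚ
    q-one {l} {b} wl l≤t
      with i , j , (wi , l≢i , Eli) , (wj , l≢j , Elj) , i≢j ← neighbours (not b) wl l≤t =
      q-isolated wi wj wl l≤t l≢i l≢j i≢j Eli Elj

    x-full-one-miss : ∀ {i j b} → Within k i → Within k j → j ≤ℕ t → j ≢ i → E j i ≡ not b →
      xPart (full i) (one j b) ≡ 0ℚ
    x-full-one-miss {i} {j} {b} wi wj j≤t j≢i Eji = trans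
      (solve 2 (λ q x → x := q :+ x :- q) refl (qPart (one j b)) (xPart (full i) (one j b)))
      (eq-full-one wi wj j≤t j≢i Eji ⊖ q-one wj j≤t)

    nodes-full : ∀ {i} → i ≤ℕ t → nodes (full i) ≡ i ∷ i +ℕ k ∷ []
    nodes-full {i} i≤t with i ≤? t
    ... | yes _ = refl
    ... | no i≰t = ⊥-elim (i≰t i≤t)

    xPart-sym : ∀ p p′ → xPart p p′ ≡ xPart p′ p
    xPart-sym p p′ = cross-sym g g-sym (nodes p) (nodes p′)

    xPart-split : ∀ p {j} → j ≤ℕ t → ∀ b → xPart p (full j) ≡ xPart p (one j b) + xPart p (one j (not b))
    xPart-split p {j} j≤t b = trans (cong (cross g (nodes p)) (nodes-full j≤t))
      (trans (cross-++ g (nodes p) (j ∷ []) (j +ℕ k ∷ [])) (order b))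
      where
      order : ∀ b → xPart p (one j false) + xPart p (one j true) ≡ xPart p (one j b) + xPart p (one j (not b))
      order false = refl
      order true = solve 2 (λ x y → x :+ y := y :+ x) refl (xPart p (one j false)) (xPart p (one j true))

    -- The coefficient α₀ between V_i and V_j splits over the two nodes of V_j, and the node missed
    -- by e_ij takes none of it.
    x-full-one-hit : ∀ {i j b} → Within k i → Within k j → j ≤ℕ t → j ≢ i → E j i ≡ b →
      xPart (full i) (one j b) - α₀ ≡ 0ℚ
    x-full-one-hit {i} {j} {b} wi wj j≤t j≢i Eji = trans
      (solve 3 (λ x y α → x :- α := (x :+ y :- α) :- y) refl (xPart (full i) (one j b)) (xPart (full i) (one j (not b))) α₀)
      (trans (cong (_- α₀) (sym (xPart-split (full i) j≤t b))) (eq-full-full wi wj (≢-sym j≢i))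
        ⊖ x-full-one-miss wi wj j≤t j≢i (not-not Eji))

    -- Some other component l is also joined to V_i at the end of e_ij, so V_l ∪ {v , w} is a
    -- root for the node v of V_i that misses both edges and the node w of V_j that misses e_jl.
    x-one-one-miss : ∀ {i j b} b′ → Within k i → Within k j → i ≤ℕ t → j ≤ℕ t → i ≢ j → E i j ≡ not b →
      xPart (one i b) (one j b′) ≡ 0ℚ
    x-one-one-miss {i} {j} {b} b′ wi wj i≤t j≤t i≢j Eij
      with l , (wl , i≢l , Eil) , l≢j ← another-neighbour (not b) j wi i≤t = finish (same-or-not b′ (not (E j l)))
      where
      β = not (E j l)
      Ejl : E j l ≡ not β
      Ejl = not-not refl
      isRoot : ∀ {x y w} → x ≡ false → y ≡ false → w ≡ false → ∀ w′ →
        1 ≡ 1 +ℕ (ι x +ℕ (ι y +ℕ 0) +ℕ (ι (w ∧ w′) +ℕ 0 +ℕ (0 +ℕ 0)) +ℕ 0)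
      isRoot refl refl refl w′ = refl
      at-β : xPart (one i b) (one j β) ≡ 0ℚ
      at-β = trans
        (solve 7 (λ α p q r x y z →
            z := α :+ (p :+ (q :+ (r :+ con 0ℚ)) :+ ((x :+ (y :+ con 0ℚ)) :+ ((z :+ con 0ℚ) :+ (con 0ℚ :+ con 0ℚ))) :+ con 0ℚ)
                 :- (α :+ p) :- (q :+ x) :- (r :+ y))
          refl α₀ (qPart (full l)) (qPart (one i b)) (qPart (one j β))
          (xPart (full l) (one i b)) (xPart (full l) (one j β)) (xPart (one i b) (one j β)))
        (root-equation {full l ∷ one i b ∷ one j β ∷ []} (wl ∷ (wi , i≤t) ∷ (wj , j≤t) ∷ [])
            (triple-distinct {full l} {one i b} {one j β} (≢-sym i≢l) l≢j i≢j) false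
            (isRoot (miss Eil) (miss Ejl) (miss Eij) (E j i == β))
          ⊖ eq-full wl ⊖ eq-full-one wl wi i≤t i≢l Eil ⊖ eq-full-one wl wj j≤t (≢-sym l≢j) Ejl)
      -- The other node of V_j is reached by additivity, the coefficient between the node of V_i and
      -- all of V_j being zero.
      at-full : xPart (one i b) (full j) ≡ 0ℚ
      at-full = trans (xPart-sym (one i b) (full j)) (x-full-one-miss wj wi i≤t i≢j Eij)
      at-not-β : xPart (one i b) (one j (not β)) ≡ 0ℚ
      at-not-β = trans
        (solve 2 (λ x y → y := x :+ y :- x) refl (xPart (one i b) (one j β)) (xPart (one i b) (one j (not β))))
        (trans (sym (xPart-split (one i b) j≤t β)) at-full ⊖ at-β)
      finish : b′ ≡ β ⊎ b′ ≡ not β → xPart (one i b) (one j b′) ≡ 0ℚ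
      finish (inj₁ refl) = at-β
      finish (inj₂ refl) = at-not-β

    times-0 : ∀ {x m} → x ≡ 0ℚ → m ≡ 0 → x ≡ α₀ * nat m
    times-0 x≡0 refl = trans x≡0 (sym (*-zeroʳ α₀))

    times-1 : ∀ {x m} → x - α₀ ≡ 0ℚ → m ≡ 1 → x ≡ α₀ * nat m
    times-1 {x} x-α≡0 refl = trans (solve 2 (λ x α → x := (x :- α) :+ α :* (con 1ℚ :+ con 0ℚ)) refl x α₀)
      (trans (cong (_+ α₀ * nat 1) x-α≡0) (+-identityˡ _))

    -- Together with `qPart-value` this shows that on sets avoiding n+2 the equation has the value
    -- α₀ (1 - M + e), a multiple of the inequality.
    xPart-value : ∀ p p′ → Valid p → Valid p′ → index p ≢ index p′ → xPart p p′ ≡ α₀ * nat (adjacency p p′)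
    xPart-value (full i) (full j) wi wj i≢j = times-1 (eq-full-full wi wj i≢j) refl
    xPart-value (full i) (one j b) wi (wj , j≤t) i≢j with same-or-not (E j i) b
    ... | inj₁ Eji = times-1 (x-full-one-hit wi wj j≤t (≢-sym i≢j) Eji) (cong ι (hit Eji))
    ... | inj₂ Eji = times-0 (x-full-one-miss wi wj j≤t (≢-sym i≢j) Eji) (cong ι (miss Eji))
    xPart-value (one i b) (full j) vi wj i≢j = trans (xPart-sym (one i b) (full j))
      (trans (xPart-value (full j) (one i b) wj vi (≢-sym i≢j)) (cong (λ x → α₀ * nat (ι x)) (∧-comm true (E i j == b))))
    xPart-value (one i b) (one j b′) (wi , i≤t) (wj , j≤t) i≢j with same-or-not (E i j) b | same-or-not (E j i) b′
    ... | inj₂ Eij | _ = times-0 (x-one-one-miss b′ wi wj i≤t j≤t i≢j Eij) (cong (λ x → ι (x ∧ (E j i == b′))) (miss Eij))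
    ... | inj₁ Eij | inj₂ Eji = times-0
          (trans (xPart-sym (one i b) (one j b′)) (x-one-one-miss b wj wi j≤t i≤t (≢-sym i≢j) Eji))
          (trans (cong ι (∧-comm (E i j == b) (E j i == b′))) (cong (λ x → ι (x ∧ (E i j == b))) (miss Eji)))
    ... | inj₁ Eij | inj₁ Eji = times-1
          (trans (solve 3 (λ x y α → x :- α := (x :+ y :- α) :- y) refl (xPart (one i b) (one j b′)) (xPart (one i b) (one j (not b′))) α₀)
            (trans (cong (_- α₀) (trans (sym (xPart-split (one i b) j≤t b′)) (xPart-sym (one i b) (full j)))) (x-full-one-hit wj wi i≤t i≢j Eij)
              ⊖ trans (xPart-sym (one i b) (one j (not b′))) (x-one-one-miss b wj wi j≤t i≤t (≢-sym i≢j) (not-not Eji))))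
          (cong₂ (λ x y → ι (x ∧ y)) (hit Eij) (hit Eji))

    qPart-value : ∀ p → Valid p → qPart p ≡ - (α₀ * nat (ι (isFullPart p)))
    qPart-value (full i) wi = trans
      (solve 2 (λ α q → q := (α :+ q) :+ :- (α :* (con 1ℚ :+ con 0ℚ))) refl α₀ (qPart (full i)))
      (trans (cong (_+ - (α₀ * nat 1)) (eq-full wi)) (+-identityˡ _))
    qPart-value (one i b) (wi , i≤t) = trans (q-one wi i≤t)
      (solve 1 (λ α → con 0ℚ := :- (α :* con 0ℚ)) refl α₀)

    quadraticParts-value : ∀ {ps} → All Valid ps → DistinctParts ps →
      quadraticParts ps ≡ α₀ * nat (countPairs adjacency ps) - α₀ * nat (countParts ps (λ p → ι (isFullPart p)))
    quadraticParts-value {ps} vps distinct = trans (cong₂ _+_ (linear vps) (pairs-value vps distinct))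
      (solve 2 (λ x y → :- x :+ y := y :- x) refl (α₀ * nat (countParts ps (λ p → ι (isFullPart p)))) (α₀ * nat (countPairs adjacency ps)))
      where
      linear : ∀ {ps} → All Valid ps → sumParts ps qPart ≡ - (α₀ * nat (countParts ps (λ p → ι (isFullPart p))))
      linear [] = solve 1 (λ α → con 0ℚ := :- (α :* con 0ℚ)) refl α₀
      linear {p ∷ ps} (vp ∷ vps) = trans (cong₂ _+_ (qPart-value p vp) (linear vps))
        (trans (solve 3 (λ α x y → :- (α :* x) :+ :- (α :* y) := :- (α :* (x :+ y))) refl α₀ (nat m) (nat m′))
               (cong (λ x → - (α₀ * x)) (sym (nat-+ m m′))))
        where
        m = ι (isFullPart p)
        m′ = countParts ps (λ p → ι (isFullPart p))
      row : ∀ p {ps} → Valid p → All Valid ps → All (λ p′ → index p ≢ index p′) ps →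
        sumParts ps (xPart p) ≡ α₀ * nat (countParts ps (adjacency p))
      row p vp [] [] = sym (*-zeroʳ α₀)
      row p {p′ ∷ ps} vp (vp′ ∷ vps) (p≢p′ ∷ p∉ps) = trans (cong₂ _+_ (xPart-value p p′ vp vp′ p≢p′) (row p vp vps p∉ps))
        (trans (solve 3 (λ α x y → α :* x :+ α :* y := α :* (x :+ y)) refl α₀ (nat m) (nat m′)) (cong (α₀ *_) (sym (nat-+ m m′))))
        where
        m = adjacency p p′
        m′ = countParts ps (adjacency p)
      pairs-value : ∀ {ps} → All Valid ps → DistinctParts ps → pairParts xPart ps ≡ α₀ * nat (countPairs adjacency ps)
      pairs-value [] [] = sym (*-zeroʳ α₀)
      pairs-value {p ∷ ps} (vp ∷ vps) (p∉ps ∷ distinct) = trans (cong₂ _+_ (row p vp vps p∉ps) (pairs-value vps distinct))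
        (trans (solve 3 (λ α x y → α :* x :+ α :* y := α :* (x :+ y)) refl α₀ (nat m) (nat m′)) (cong (α₀ *_) (sym (nat-+ m m′))))
        where
        m = countParts ps (adjacency p)
        m′ = countPairs adjacency ps

    -- κ and y measure how the z-dependent coefficients differ from those of -α₀ times
    -- the inequality; they turn out to vanish.
    κ : ℚ
    κ = q z - two * α₀

    y : Part → ℚ
    y p = zPart p + α₀ * nat (inCycle p)

    sum-y : ∀ ps → sumParts ps y ≡ sumParts ps zPart + α₀ * nat (countParts ps inCycle)
    sum-y [] = solve 1 (λ α → con 0ℚ := con 0ℚ :+ α :* con 0ℚ) refl α₀
    sum-y (p ∷ ps) = trans (cong (y p +_) (sum-y ps))
      (trans (solve 5 (λ α u v x y → (u :+ α :* x) :+ (v :+ α :* y) := (u :+ v) :+ α :* (x :+ y)) refl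
               α₀ (zPart p) (sumParts ps zPart) (nat (inCycle p)) (nat (countParts ps inCycle)))
             (cong (λ x → zPart p + sumParts ps zPart + α₀ * x) (sym (nat-+ (inCycle p) (countParts ps inCycle)))))

    -- Adding α₀ times the root condition to the equation of a root through n+2 absorbs all terms
    -- away from n+2.
    z-root : ∀ {ps} (vps : All Valid ps) (distinct : DistinctParts ps) → IsRoot vps distinct true → κ + sumParts ps y ≡ 0ℚ
    z-root {ps} vps distinct isRoot = begin
      κ + sumParts ps y ≡⟨ cong (κ +_) (sum-y ps) ⟩
      κ + (s + α₀ * nat cc)
        ≡⟨ solve 6 (λ α qz s cc p f →
             qz :- con two :* α :+ (s :+ α :* cc)
             := α :+ ((α :* p :- α :* f) :+ (qz :+ s)) :+ α :* ((f :+ (cc :+ con 0ℚ)) :- (con 1ℚ :+ (p :+ con two)))) refl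
             α₀ (q z) s (nat cc) (nat pp) (nat ff) ⟩
      α₀ + ((α₀ * nat pp - α₀ * nat ff) + (q z + s)) + α₀ * ((nat ff + (nat cc + 0ℚ)) - (1ℚ + (nat pp + two)))
        ≡⟨ cong₂ (λ x w → α₀ + (x + (q z + s)) + α₀ * w) (sym (quadraticParts-value vps distinct)) counts-agree ⟩
      α₀ + (quadraticParts ps + (q z + s)) + α₀ * 0ℚ
        ≡⟨ cong₂ _+_ (root-equation vps distinct true isRoot) (*-zeroʳ α₀) ⟩
      0ℚ ∎
      where
      open ≡-Reasoning
      s = sumParts ps zPart
      cc = countParts ps inCycle
      pp = countPairs adjacency ps
      ff = countParts ps (λ p → ι (isFullPart p))
      -- The root condition M + s = 1 + (e + 2).
      counts-agree : (nat ff + (nat cc + 0ℚ)) - (1ℚ + (nat pp + two)) ≡ 0ℚ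
      counts-agree = trans (cong₂ _-_
        (trans (cong (nat ff +_) (sym (nat-+ cc 0))) (sym (nat-+ ff (cc +ℕ 0))))
        (cong (1ℚ +_) (sym (nat-+ pp 2))))
        (trans (cong (λ m → nat m - nat (1 +ℕ (pp +ℕ 2))) isRoot) (solve 1 (λ x → x :- x := con 0ℚ) refl (nat (1 +ℕ (pp +ℕ 2)))))

    InCycle : ℕ → Set
    InCycle = InC a b c d

    cycle-within : ∀ {i} → InCycle i → Within k i
    cycle-within = go isC4
      where
      go : IsC4 k end a b c d → ∀ {i} → InCycle i → Within k i
      go (wa , wb , wc , wd , _) = λ where
        (inj₁ refl) → wa
        (inj₂ (inj₁ refl)) → wb
        (inj₂ (inj₂ (inj₁ refl))) → wc
        (inj₂ (inj₂ (inj₂ refl))) → wd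

    mem-cycle : ∀ {i} → InCycle i → mem C i ≡ true
    mem-cycle {i} i∈C = go i∈C (mem-members C)
      where
      go : InCycle i → All (λ i → mem C i ≡ true) C → mem C i ≡ true
      go (inj₁ refl) (h ∷ _) = h
      go (inj₂ (inj₁ refl)) (_ ∷ h ∷ _) = h
      go (inj₂ (inj₂ (inj₁ refl))) (_ ∷ _ ∷ h ∷ _) = h
      go (inj₂ (inj₂ (inj₂ refl))) (_ ∷ _ ∷ _ ∷ h ∷ _) = h

    mem-off-cycle : ∀ {i} → ¬ InCycle i → mem C i ≡ false
    mem-off-cycle i∉C = mem-∉ ((λ eq → i∉C (inj₁ eq)) ∷ (λ eq → i∉C (inj₂ (inj₁ eq)))
      ∷ (λ eq → i∉C (inj₂ (inj₂ (inj₁ eq)))) ∷ (λ eq → i∉C (inj₂ (inj₂ (inj₂ eq)))) ∷ [])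

    lower-end : ∀ {i j} → Within k i → end i j ≡ i → E i j ≡ false
    lower-end {i} {j} wi eq with end i j ≟ i +ℕ k
    ... | no _ = refl
    ... | yes eq′ = ⊥-elim (upper-distinct k t t≤k end valid wi wi (trans (sym eq) eq′))

    upper-end : ∀ {i j} → end i j ≡ i +ℕ k → E i j ≡ true
    upper-end {i} {j} eq with end i j ≟ i +ℕ k
    ... | yes _ = refl
    ... | no ≢ = ⊥-elim (≢ eq)

    cycle-neighbours : ∀ {i} → InCycle i → ∃₂ λ j l → InCycle j × InCycle l × i ≢ j × i ≢ l × j ≢ l × E i j ≡ false × E i l ≡ false
    cycle-neighbours = go isC4
      where
      go : IsC4 k end a b c d → ∀ {i} → InCycle i →
        ∃₂ λ j l → InCycle j × InCycle l × i ≢ j × i ≢ l × j ≢ l × E i j ≡ false × E i l ≡ false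
      go (wa , wb , wc , wd , (ab , ac , ad , bc , bd , cd) , Eab , Ebc , Ecd , Eda) = λ where
          (inj₁ refl) → b , d , b∈ , d∈ , ab , ad , bd , lower-end wa (proj₁ a-b) , lower-end wa (proj₂ d-a)
          (inj₂ (inj₁ refl)) → a , c , a∈ , c∈ , ≢-sym ab , bc , ac , lower-end wb (proj₂ a-b) , lower-end wb (proj₁ b-c)
          (inj₂ (inj₂ (inj₁ refl))) → b , d , b∈ , d∈ , ≢-sym bc , cd , bd , lower-end wc (proj₂ b-c) , lower-end wc (proj₁ c-d)
          (inj₂ (inj₂ (inj₂ refl))) → a , c , a∈ , c∈ , ≢-sym ad , ≢-sym cd , ac , lower-end wd (proj₁ d-a) , lower-end wd (proj₂ c-d)
        where
        a∈ : InCycle a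
        a∈ = inj₁ refl
        b∈ : InCycle b
        b∈ = inj₂ (inj₁ refl)
        c∈ : InCycle c
        c∈ = inj₂ (inj₂ (inj₁ refl))
        d∈ : InCycle d
        d∈ = inj₂ (inj₂ (inj₂ refl))
        a-b = c4-edge k t end valid wa wb Eab
        b-c = c4-edge k t end valid wb wc Ebc
        c-d = c4-edge k t end valid wc wd Ecd
        d-a = c4-edge k t end valid wd wa Eda

    z-pair : ∀ {i j} → InCycle i → InCycle j → i ≢ j → κ + (y (full i) + (y (full j) + 0ℚ)) ≡ 0ℚ
    z-pair {i} {j} i∈ j∈ i≢j = z-root {full i ∷ full j ∷ []} (cycle-within i∈ ∷ cycle-within j∈ ∷ []) ((i≢j ∷ []) ∷ [] ∷ [])
      (isRoot (mem-cycle i∈) (mem-cycle j∈))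
      where
      isRoot : ∀ {x y} → x ≡ true → y ≡ true →
        2 +ℕ 1 *ℕ (ι (x ∧ true) +ℕ (ι (y ∧ true) +ℕ 0)) ≡ 1 +ℕ (1 +ℕ 0 +ℕ (0 +ℕ 0) +ℕ 2)
      isRoot refl refl = refl

    z-triple : ∀ {i j l} → InCycle i → InCycle j → InCycle l → i ≢ j → i ≢ l → j ≢ l →
      κ + (y (full i) + (y (full j) + (y (full l) + 0ℚ))) ≡ 0ℚ
    z-triple {i} {j} {l} i∈ j∈ l∈ i≢j i≢l j≢l = z-root {full i ∷ full j ∷ full l ∷ []}
      (cycle-within i∈ ∷ cycle-within j∈ ∷ cycle-within l∈ ∷ []) (triple-distinct {full i} {full j} {full l} i≢j i≢l j≢l)
      (isRoot (mem-cycle i∈) (mem-cycle j∈) (mem-cycle l∈))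
      where
      isRoot : ∀ {x y w} → x ≡ true → y ≡ true → w ≡ true →
        3 +ℕ 1 *ℕ (ι (x ∧ true) +ℕ (ι (y ∧ true) +ℕ (ι (w ∧ true) +ℕ 0)))
        ≡ 1 +ℕ (1 +ℕ (1 +ℕ 0) +ℕ (1 +ℕ 0 +ℕ (0 +ℕ 0)) +ℕ 2)
      isRoot refl refl refl = refl

    -- Three equations for pairs minus twice the equation for the triple: each y cancels and one κ
    -- is left.
    κ≡0 : κ ≡ 0ℚ
    κ≡0 with j , l , j∈ , l∈ , i≢j , i≢l , j≢l , _ ← cycle-neighbours {a} (inj₁ refl) = trans
      (solve 4 (λ κ x y w → κ := (κ :+ (x :+ (y :+ con 0ℚ))) :+ (κ :+ (x :+ (w :+ con 0ℚ))) :+ (κ :+ (y :+ (w :+ con 0ℚ)))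
          :- (κ :+ (x :+ (y :+ (w :+ con 0ℚ)))) :- (κ :+ (x :+ (y :+ (w :+ con 0ℚ)))))
        refl κ (y (full a)) (y (full j)) (y (full l)))
      (z-pair (inj₁ refl) j∈ i≢j ⊕ z-pair (inj₁ refl) l∈ i≢l ⊕ z-pair j∈ l∈ j≢l
        ⊖ z-triple (inj₁ refl) j∈ l∈ i≢j i≢l j≢l ⊖ z-triple (inj₁ refl) j∈ l∈ i≢j i≢l j≢l)

    y-cycle-full : ∀ {i} → InCycle i → y (full i) ≡ 0ℚ
    y-cycle-full {i} i∈ with j , l , j∈ , l∈ , i≢j , i≢l , j≢l , _ ← cycle-neighbours i∈ = trans
      (solve 4 (λ κ x y w → x := κ :+ (x :+ (y :+ (w :+ con 0ℚ))) :- (κ :+ (y :+ (w :+ con 0ℚ))))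
        refl κ (y (full i)) (y (full j)) (y (full l)))
      (z-triple i∈ j∈ l∈ i≢j i≢l j≢l ⊖ z-pair j∈ l∈ j≢l)

    -- A node off C that is joined to neither V_j nor V_l can be added to the root V_j ∪ V_l ∪ {n+2}
    -- without changing M, e or s.
    y-full-full-one : ∀ {i j l b} → Within k i → i ≤ℕ t → InCycle j → InCycle l → i ≢ j → i ≢ l → j ≢ l →
      E i j ≡ not b → E i l ≡ not b → inCycle (one i b) ≡ 0 → y (one i b) ≡ 0ℚ
    y-full-full-one {i} {j} {l} {b} wi i≤t j∈ l∈ i≢j i≢l j≢l Eij Eil outside = trans
      (solve 4 (λ κ x y w → w := κ :+ (x :+ (y :+ (w :+ con 0ℚ))) :- (κ :+ (x :+ (y :+ con 0ℚ))))
        refl κ (y (full j)) (y (full l)) (y (one i b)))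
      (z-root {full j ∷ full l ∷ one i b ∷ []} (cycle-within j∈ ∷ cycle-within l∈ ∷ (wi , i≤t) ∷ [])
          (triple-distinct {full j} {full l} {one i b} j≢l (≢-sym i≢j) (≢-sym i≢l))
          (isRoot (mem-cycle j∈) (mem-cycle l∈) outside (miss Eij) (miss Eil))
        ⊖ z-pair j∈ l∈ j≢l)
      where
      isRoot : ∀ {x y n u v} → x ≡ true → y ≡ true → n ≡ 0 → u ≡ false → v ≡ false →
        2 +ℕ 1 *ℕ (ι (x ∧ true) +ℕ (ι (y ∧ true) +ℕ (n +ℕ 0)))
        ≡ 1 +ℕ (1 +ℕ (ι u +ℕ 0) +ℕ (ι v +ℕ 0 +ℕ (0 +ℕ 0)) +ℕ 2)
      isRoot refl refl refl refl refl = refl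

    y-split : ∀ {i} → i ≤ℕ t → ∀ b → y (full i) ≡ y (one i b) + y (one i (not b))
    y-split {i} i≤t b = trans (trans (cong₂ (λ L n → sumL L (g z) + α₀ * n) (nodes-full i≤t) (count (mem C i)))
        (solve 5 (λ u v α x w → u :+ (v :+ con 0ℚ) :+ α :* (x :+ w) := (u :+ con 0ℚ :+ α :* x) :+ (v :+ con 0ℚ :+ α :* w)) refl
          (g z i) (g z (i +ℕ k)) α₀ (nat (inCycle (one i false))) (nat (inCycle (one i true)))))
      (order b)
      where
      count : ∀ m → nat (ι (m ∧ true)) ≡ nat (ι (m ∧ true)) + nat (ι (m ∧ false))
      count false = refl
      count true = refl
      order : ∀ b → y (one i false) + y (one i true) ≡ y (one i b) + y (one i (not b))
      order false = refl
      order true = solve 2 (λ x y → x :+ y := y :+ x) refl (y (one i false)) (y (one i true))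

    y-other : ∀ {i} b → i ≤ℕ t → y (full i) ≡ 0ℚ → y (one i b) ≡ 0ℚ → y (one i (not b)) ≡ 0ℚ
    y-other {i} b i≤t y-full y-b = trans
      (solve 2 (λ x w → w := x :+ w :- x) refl (y (one i b)) (y (one i (not b))))
      (trans (sym (y-split i≤t b)) y-full ⊖ y-b)

    y-both : ∀ {i} b → i ≤ℕ t → y (full i) ≡ 0ℚ → y (one i b) ≡ 0ℚ → ∀ b′ → y (one i b′) ≡ 0ℚ
    y-both b i≤t y-full y-b b′ with same-or-not b′ b
    ... | inj₁ refl = y-b
    ... | inj₂ refl = y-other b i≤t y-full y-b

    -- The edges of C at i end at its lower node, so the upper node i + k is joined to neither of
    -- the components of the two neighbours of i on C.
    y-cycle-one : ∀ {i} → InCycle i → i ≤ℕ t → ∀ b → y (one i b) ≡ 0ℚ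
    y-cycle-one {i} i∈ i≤t with j , l , j∈ , l∈ , i≢j , i≢l , j≢l , Eij , Eil ← cycle-neighbours i∈ =
      y-both true i≤t (y-cycle-full i∈)
        (y-full-full-one (cycle-within i∈) i≤t j∈ l∈ i≢j i≢l j≢l Eij Eil (cong ι (∧-comm (mem C i) false)))

    opposite : ∀ {j j′} → Opp a b c d j j′ → InCycle j′ × j ≢ j′
    opposite = go isC4
      where
      go : IsC4 k end a b c d → ∀ {j j′} → Opp a b c d j j′ → InCycle j′ × j ≢ j′
      go (_ , _ , _ , _ , (_ , ac , _ , _ , bd , _) , _) = λ where
        (inj₁ (refl , refl)) → inj₂ (inj₂ (inj₁ refl)) , ac
        (inj₂ (inj₁ (refl , refl))) → inj₁ refl , ≢-sym ac
        (inj₂ (inj₂ (inj₁ (refl , refl)))) → inj₂ (inj₂ (inj₂ refl)) , bd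
        (inj₂ (inj₂ (inj₂ (refl , refl)))) → inj₂ (inj₁ refl) , ≢-sym bd

    module _ {i} (wi : Within k i) (i∉ : ¬ InCycle i) where

      ≢-cycle : ∀ {j} → InCycle j → i ≢ j
      ≢-cycle j∈ refl = i∉ j∈

      -- Both e_jj' and e_ji end at j + k. The root {j} ∪ V_j' ∪ V_i ∪ {n+2} thus has M = 2, only
      -- the inner edge e_ij', and s = 2.
      y-free-full : FreeWitness k t end a b c d i → y (full i) ≡ 0ℚ
      y-free-full (j , (j∈ , 1≤j , j≤t , j′ , opp , end-jj′) , end-ji) with j′∈ , j≢j′ ← opposite opp = trans
        (solve 4 (λ κ x y w → w := κ :+ (x :+ (y :+ (w :+ con 0ℚ))) :- κ :- x :- y) refl κ (y (one j false)) (y (full j′)) (y (full i)))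
        (z-root {one j false ∷ full j′ ∷ full i ∷ []} ((cycle-within j∈ , j≤t) ∷ cycle-within j′∈ ∷ wi ∷ [])
            (triple-distinct {one j false} {full j′} {full i} j≢j′ (≢-sym (≢-cycle j∈)) (≢-sym (≢-cycle j′∈)))
            (isRoot (mem-cycle j∈) (mem-cycle j′∈) (mem-off-cycle i∉) (miss (upper-end end-jj′)) (miss (upper-end end-ji)))
          ⊖ κ≡0 ⊖ y-cycle-one j∈ j≤t false ⊖ y-cycle-full j′∈)
        where
        isRoot : ∀ {x y w u v} → x ≡ true → y ≡ true → w ≡ false → u ≡ false → v ≡ false →
          2 +ℕ 1 *ℕ (ι (x ∧ true) +ℕ (ι (y ∧ true) +ℕ (ι (w ∧ true) +ℕ 0)))
          ≡ 1 +ℕ (ι (u ∧ true) +ℕ (ι (v ∧ true) +ℕ 0) +ℕ (1 +ℕ 0 +ℕ (0 +ℕ 0)) +ℕ 2)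
        isRoot refl refl refl refl refl = refl

      -- With V_i replaced by its node that e_ij' misses, the root of `y-free-full` has M = 1, e = 0
      -- and s = 2. The second node of V_i follows from the value at V_i.
      y-free-one : FreeWitness k t end a b c d i → i ≤ℕ t → ∀ b → y (one i b) ≡ 0ℚ
      y-free-one witness@(j , (j∈ , 1≤j , j≤t , j′ , opp , end-jj′) , end-ji) i≤t with j′∈ , j≢j′ ← opposite opp =
        y-both β i≤t (y-free-full witness) (trans
          (solve 4 (λ κ x y w → w := κ :+ (x :+ (y :+ (w :+ con 0ℚ))) :- κ :- x :- y) refl κ (y (one j false)) (y (full j′)) (y (one i β)))
          (z-root {one j false ∷ full j′ ∷ one i β ∷ []} ((cycle-within j∈ , j≤t) ∷ cycle-within j′∈ ∷ (wi , i≤t) ∷ [])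
              (triple-distinct {one j false} {full j′} {one i β} j≢j′ (≢-sym (≢-cycle j∈)) (≢-sym (≢-cycle j′∈)))
              (isRoot (mem-cycle j∈) (mem-cycle j′∈) (mem-off-cycle i∉) (false == β)
                (miss (upper-end end-jj′)) (miss (upper-end end-ji)) (E i j == β) (miss {E i j′} (not-not refl)))
            ⊖ κ≡0 ⊖ y-cycle-one j∈ j≤t false ⊖ y-cycle-full j′∈))
        where
        β = not (E i j′)
        isRoot : ∀ {x y w u v r} → x ≡ true → y ≡ true → w ≡ false → ∀ w′ → u ≡ false → v ≡ false → ∀ v′ → r ≡ false →
          1 +ℕ 1 *ℕ (ι (x ∧ true) +ℕ (ι (y ∧ true) +ℕ (ι (w ∧ w′) +ℕ 0)))
          ≡ 1 +ℕ (ι (u ∧ true) +ℕ (ι (v ∧ v′) +ℕ 0) +ℕ (ι r +ℕ 0 +ℕ (0 +ℕ 0)) +ℕ 2)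
        isRoot refl refl refl w′ refl refl v′ refl = refl

      -- Two cycle nodes have their edges to V_i at the node other than s, so s is joined to neither
      -- of their components.
      two-joined : ∀ s → countEnd end a b c d i (node i (not s)) ≡ 2 → i ≤ℕ t → y (one i s) ≡ 0ℚ
      two-joined s count i≤t = go (filter (λ j → end i j ≟ node i (not s)) C) count
          (AllPairs-filter⁺ (λ j → end i j ≟ node i (not s)) (nodes-distinct k t end valid isC4))
          (all-filter (λ j → end i j ≟ node i (not s)) C)
          (All-filter⁺ (λ j → end i j ≟ node i (not s)) members)
        where
        members : All InCycle C
        members = inj₁ refl ∷ inj₂ (inj₁ refl) ∷ inj₂ (inj₂ (inj₁ refl)) ∷ inj₂ (inj₂ (inj₂ refl)) ∷ []
        joined : ∀ {j} → InCycle j → end i j ≡ node i (not s) → E i j ≡ not s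
        joined {j} j∈ eq = proj₂ (node-injective {b = E i j} {not s} wi wi (trans (sym (proj₁ (end-node wi (cycle-within j∈) (≢-cycle j∈)))) eq))
        go : ∀ L → length L ≡ 2 → Distinct L → All (λ j → end i j ≡ node i (not s)) L → All InCycle L → y (one i s) ≡ 0ℚ
        go (j ∷ l ∷ []) _ ((j≢l ∷ []) ∷ _) (eqj ∷ eql ∷ []) (j∈ ∷ l∈ ∷ []) =
          y-full-full-one wi i≤t j∈ l∈ (≢-cycle j∈) (≢-cycle l∈) j≢l (joined j∈ eqj) (joined l∈ eql)
            (cong (λ x → ι (x ∧ has (one i s) false)) (mem-off-cycle i∉))

    inCycle? : ∀ i → InCycle i ⊎ ¬ InCycle i
    inCycle? i with i ≟ a | i ≟ b | i ≟ c | i ≟ d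
    ... | yes eq | _ | _ | _ = inj₁ (inj₁ eq)
    ... | no _ | yes eq | _ | _ = inj₁ (inj₂ (inj₁ eq))
    ... | no _ | no _ | yes eq | _ = inj₁ (inj₂ (inj₂ (inj₁ eq)))
    ... | no _ | no _ | no _ | yes eq = inj₁ (inj₂ (inj₂ (inj₂ eq)))
    ... | no ≢a | no ≢b | no ≢c | no ≢d = inj₂ λ where
      (inj₁ eq) → ≢a eq
      (inj₂ (inj₁ eq)) → ≢b eq
      (inj₂ (inj₂ (inj₁ eq))) → ≢c eq
      (inj₂ (inj₂ (inj₂ eq))) → ≢d eq

    y-one : ∀ {i} b → Within k i → i ≤ℕ t → y (one i b) ≡ 0ℚ
    y-one {i} s wi i≤t with inCycle? i
    ... | inj₁ i∈ = y-cycle-one i∈ i≤t s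
    ... | inj₂ i∉ with condIII i (proj₁ wi) i≤t i∉
    ...   | inj₂ witness = y-free-one wi i∉ witness i≤t s
    ...   | inj₁ (lower , upper) = two-joined wi i∉ s (count s) i≤t
      where
      -- The edges that avoid a node are those ending at the other one, so the lower node uses the
      -- upper count and conversely.
      count : ∀ b′ → countEnd end a b c d i (node i (not b′)) ≡ 2
      count false = upper
      count true = lower

    y-full-unpaired : ∀ {i} → Within k i → ¬ i ≤ℕ t → y (full i) ≡ 0ℚ
    y-full-unpaired {i} wi i≰t with inCycle? i
    ... | inj₁ i∈ = y-cycle-full i∈
    ... | inj₂ i∉ = y-free-full wi i∉ (condII i (ℕ.≰⇒> i≰t) (proj₂ wi) i∉)

    -- A single node of V as a part: `one i b` in a two-node component, but `full i` in a one-node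
    -- component. It unifies the two cases when coefficients of nodes are read off.
    record Singleton (i : ℕ) (b : Bool) : Set where
      field
        part : Part
        part-valid : Valid part
        part-index : index part ≡ i
        part-nodes : nodes part ≡ node i b ∷ []
        part-has : has part b ≡ true
        part-y : y part ≡ 0ℚ

    open Singleton

    singletonPart : ∀ {i} b → Within k i → Node i b → Singleton i b
    singletonPart {i} b wi ok with i ≤? t
    ... | yes i≤t = record
      { part = one i b ; part-valid = wi , i≤t ; part-index = refl ; part-nodes = refl
      ; part-has = hit {b} refl ; part-y = y-one b wi i≤t }
    singletonPart {i} true wi ok | no i≰t = ⊥-elim (i≰t (ok refl))
    singletonPart {i} false wi ok | no i≰t = record
      { part = full i ; part-valid = wi ; part-index = refl ; part-nodes = alone
      ; part-has = refl ; part-y = y-full-unpaired wi i≰t }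
      where
      alone : nodes (full i) ≡ i ∷ []
      alone with i ≤? t
      ... | yes i≤t = ⊥-elim (i≰t i≤t)
      ... | no _ = refl

    g-za≡0 : g z a ≡ 0ℚ
    g-za≡0 = trans (g-sym z a) (trans (g-edge (pivot k t t≤k end valid isC4))
      (trans (cong (_* - two) α-pivot) (*-zeroˡ (- two))))

    -- Here the normalisation enters: y at the part {a} is `g z a + α₀`, and `g z a` is -2 times the
    -- pivot entry.
    α₀≡0 : α₀ ≡ 0ℚ
    α₀≡0 = trans (solve 1 (λ α → α := con 0ℚ :+ con 0ℚ :+ α :* (con 1ℚ :+ con 0ℚ)) refl α₀)
      (trans (cong₂ (λ x n → x + α₀ * nat n) (sym z-part) (sym counted)) (part-y s))
      where
      s = singletonPart {a} false (cycle-within (inj₁ refl)) λ ()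
      z-part : zPart (part s) ≡ 0ℚ + 0ℚ
      z-part = trans (cong (λ L → sumL L (g z)) (part-nodes s)) (cong (_+ 0ℚ) g-za≡0)
      counted : inCycle (part s) ≡ 1
      counted = cong₂ (λ x w → ι (x ∧ w)) (trans (cong (mem C) (part-index s)) (mem-cycle (inj₁ refl))) (part-has s)

    times-α₀ : ∀ n → α₀ * nat n ≡ 0ℚ
    times-α₀ n = trans (cong (_* nat n) α₀≡0) (*-zeroˡ (nat n))

    q-z≡0 : q z ≡ 0ℚ
    q-z≡0 = trans (solve 2 (λ q α → q := q :- con two :* α :+ α :* (con 1ℚ :+ (con 1ℚ :+ con 0ℚ))) refl (q z) α₀) (κ≡0 ⊕ times-α₀ 2)

    module _ {i b} (wi : Within k i) (ok : Node i b) where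

      private s = singletonPart b wi ok

      q-node≡0 : q (node i b) ≡ 0ℚ
      q-node≡0 = trans (solve 1 (λ q → q := q :+ con 0ℚ :+ (con 0ℚ :+ con 0ℚ)) refl (q (node i b)))
        (trans (cong (quadratic q g) (sym (part-nodes s)))
          (trans (qPart-value (part s) (part-valid s)) (cong -_ (times-α₀ (ι (isFullPart (part s)))))))

      g-z-node≡0 : g z (node i b) ≡ 0ℚ
      g-z-node≡0 = trans (solve 2 (λ x w → x := x :+ con 0ℚ :+ w :- w) refl (g z (node i b)) (α₀ * nat (inCycle (part s))))
        (trans (cong (λ L → sumL L (g z) + α₀ * nat (inCycle (part s))) (sym (part-nodes s))) (part-y s) ⊖ times-α₀ (inCycle (part s)))

      g-node-node≡0 : ∀ {j b′} → Within k j → Node j b′ → i ≢ j → g (node i b) (node j b′) ≡ 0ℚ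
      g-node-node≡0 {j} {b′} wj ok′ i≢j = trans (solve 1 (λ x → x := x :+ con 0ℚ :+ con 0ℚ) refl (g (node i b) (node j b′)))
        (trans (cong₂ (cross g) (sym (part-nodes s)) (sym (part-nodes s′)))
          (trans (xPart-value (part s) (part s′) (part-valid s) (part-valid s′)
              (λ eq → i≢j (trans (sym (part-index s)) (trans eq (part-index s′)))))
            (times-α₀ (adjacency (part s) (part s′)))))
        where
        s′ = singletonPart b′ wj ok′

    -- The pair inside V_i occurs in no `xPart`; it is what remains of `qPart (full i)` once both
    -- nodes have coefficient zero.
    g-own≡0 : ∀ {i} → Within k i → i ≤ℕ t → g i (i +ℕ k) ≡ 0ℚ
    g-own≡0 {i} wi i≤t = trans
      (solve 3 (λ p r x → x := p :+ (r :+ con 0ℚ) :+ (x :+ con 0ℚ :+ (con 0ℚ :+ con 0ℚ)) :- p :- r) refl (q i) (q (i +ℕ k)) (g i (i +ℕ k)))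
      (trans (cong (quadratic q g) (sym (nodes-full i≤t))) (trans (qPart-value (full i) wi) (cong -_ (times-α₀ 1)))
        ⊖ q-node≡0 {b = false} wi (λ ()) ⊖ q-node≡0 {b = true} wi (λ _ → i≤t))

    data Vertex : ℕ → Set where
      top : Vertex z
      nodeOf : ∀ i b → Within k i → Node i b → Vertex (node i b)

    vertex : ∀ {u} → Within (k +ℕ t +ℕ 2) u → u ≢ o → Vertex u
    vertex {u} (1≤u , u≤N) u≢o with u ≤? k
    ... | yes u≤k = nodeOf u false (1≤u , u≤k) λ ()
    ... | no u≰k with u ≤? k +ℕ t
    ...   | yes u≤n = subst Vertex (ℕ.m∸n+n≡m (ℕ.<⇒≤ k<u)) (nodeOf (u ℕ.∸ k) true (ℕ.m<n⇒0<n∸m k<u , ℕ.≤-trans i≤t t≤k) (λ _ → i≤t))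
      where
      k<u = ℕ.≰⇒> u≰k
      i≤t : u ℕ.∸ k ≤ℕ t
      i≤t = ℕ.≤-trans (ℕ.∸-monoˡ-≤ k u≤n) (ℕ.≤-reflexive (ℕ.m+n∸m≡n k t))
    ...   | no u≰n = subst Vertex (sym u≡z) top
      where
      o<u : o <ℕ u
      o<u = ℕ.≤∧≢⇒< (ℕ.≤-trans (ℕ.≤-reflexive (ℕ.+-comm (k +ℕ t) 1)) (ℕ.≰⇒> u≰n)) (≢-sym u≢o)
      u≡z : u ≡ z
      u≡z = ℕ.≤-antisym u≤N (ℕ.≤-trans (ℕ.≤-reflexive (ℕ.+-suc (k +ℕ t) 1)) o<u)

    q≡0 : ∀ {u} → Vertex u → q u ≡ 0ℚ
    q≡0 top = q-z≡0
    q≡0 (nodeOf i b wi ok) = q-node≡0 wi ok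

    g≡0 : ∀ {u v} → Vertex u → Vertex v → u ≢ v → g u v ≡ 0ℚ
    g≡0 top top u≢v = ⊥-elim (u≢v refl)
    g≡0 top (nodeOf i b wi ok) _ = g-z-node≡0 wi ok
    g≡0 (nodeOf i b wi ok) top _ = trans (g-sym (node i b) z) (g-z-node≡0 wi ok)
    g≡0 (nodeOf i b wi ok) (nodeOf j b′ wj ok′) u≢v with i ≟ j
    ... | no i≢j = g-node-node≡0 {b = b} wi ok {b′ = b′} wj ok′ i≢j
    g≡0 (nodeOf i false wi ok) (nodeOf i false wj ok′) u≢v | yes refl = ⊥-elim (u≢v refl)
    g≡0 (nodeOf i false wi ok) (nodeOf i true wj ok′) u≢v | yes refl = g-own≡0 wi (ok′ refl)
    g≡0 (nodeOf i true wi ok) (nodeOf i false wj ok′) u≢v | yes refl = trans (g-sym (i +ℕ k) i) (g-own≡0 wi (ok refl))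
    g≡0 (nodeOf i true wi ok) (nodeOf i true wj ok′) u≢v | yes refl = ⊥-elim (u≢v refl)

    α≡0 : ∀ e → α e ≡ 0ℚ
    α≡0 = vanishes o (λ wu u≢o → q≡0 (vertex wu u≢o))
      (λ wu wv u≢o v≢o u≢v → g≡0 (vertex wu u≢o) (vertex wv v≢o) u≢v)

-- The facet criterion applied to the inequality.

open import Defs
open import Data.Nat using (ℕ; _+_; _≤_)
open import Data.Product using (_,_)
open FacetCriterion using (module Criterion)
open LhsValue using (linear-lhs; lhs-bound; pivot; pivot-determined)
open Core using (module Uniqueness)

theorem5 : (k t : ℕ) → 1 ≤ k → t ≤ k →
    (end : ℕ → ℕ → ℕ) → ValidEnds k t end →
    (a b c d : ℕ) → IsC4 k end a b c d →
    MinDeg2 k t end →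
    CondII k t end a b c d →
    CondIII k t end a b c d →
    IsFacet (InCUT (k + t + 2)) (lhsI' k t end a b c d) two
theorem5 k t _ t≤k end valid a b c d isC4 minDeg condII condIII =
  Criterion.facet (lhsI' k t end a b c d) (linear-lhs k t end a b c d) two (λ ())
    (lhs-bound k t t≤k end valid isC4)
    (pivot k t t≤k end valid isC4) (pivot-determined k t t≤k end valid isC4)
    (λ α₀ α α-pivot vanish →
      let open Uniqueness k t t≤k end valid isC4 minDeg condII condIII α₀ α α-pivot vanish in α₀≡0 , α≡0)
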